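{- Let $q>3$ be a prime power. The ideal $$\mathcal{J}_q+\langle x_{00},\,x_{10}-1,\,x_{01}-1\rangle+\langle x_{0i},\,x_{i0}\colon 2\le i\le q-2\rangle\subset\mathbb{F}_q[\overline{X}_q]$$ is zero-dimensional and radical, and its algebraic set is identified with $\mathcal{RLP}_q$, via the bijection $(s_{ij})_{0\le i,j\le q-2}\mapsto\sum_{i,j=0}^{q-2}s_{ij}x^iy^j$. If $\mathcal{J}_q$ is replaced by $\mathcal{J}_{q,d}$ (for a nonnegative integer $d$), then the algebraic set of the resulting zero-dimensional radical ideal is identified in the same way with $\mathcal{RLP}_{q,d}$.
   Context: $\mathbb{F}_q$ is the finite field with $q$ elements. $\mathcal{LP}_q$ is the set of local permutation polynomials: polynomials $f\in\mathbb{F}_q[x,y]$ of degree less than $q$ in each variable such that, for every $a\in\mathbb{F}_q$, both $f(x,a)$ and $f(a,x)$ act as permutations of $\mathbb{F}_q$. A polynomial $f\in\mathcal{LP}_q$ is reduced if $f(x,0)=x$ and $f(0,y)=y$. $\mathcal{RLP}_q$ is the set of reduced polynomials in $\mathcal{LP}_q$, and $\mathcal{RLP}_{q,d}$ is the subset of those of total degree $d$. $\overline{X}_q:=\{x_{ij}\colon 0\le i,j\le q-2\}$ is a set of variables (all indices below range over $\{0,\ldots,q-2\}$; an empty product is $1$). Put $F(x):=x^{q-1}-1$ and, for $a,b,c\in\mathbb{F}_q$ with $a\ne b$ (with $0^0=1$), $G^{\mathrm{row}}_{a,b,c}:=F(\sum_{i,j=0}^{q-2}(a^i-b^i)c^jx_{ji})$,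 $G^{\mathrm{col}}_{a,b,c}:=F(\sum_{i,j=0}^{q-2}(a^i-b^i)c^jx_{ij})$. Then $$\mathcal{J}_q:=\langle G^{\mathrm{row}}_{a,b,c},\,G^{\mathrm{col}}_{a,b,c}\colon a,b,c\in\mathbb{F}_q,\ a\neq b\rangle+\langle x_{ij}^q-x_{ij}\colon 0\le i,j\le q-2\rangle,$$ $$\mathcal{J}_{q,d}:=\mathcal{J}_q+\langle x_{ij}\colon i+j>d\rangle+\Big\langle\prod_{i+j=d}(x_{ij}^{q-1}-1)\Big\rangle.$$ The algebraic set of an ideal $I$ of a polynomial ring over $\mathbb{F}_q$ in $n$ variables is the set of points of $\mathbb{F}_q^n$ at which all elements of $I$ vanish; $I$ is zero-dimensional if the quotient ring by $I$ is a finite-dimensional $\mathbb{F}_q$-vector space. -}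

module Defs where

open import Algebra.Bundles using (CommutativeRing)
open import Algebra.Bundles.Raw using (RawRing)
open import Algebra.Module.Bundles.Raw using (RawLeftModule)
import Algebra.Definitions as AlgebraDefinitions
import Algebra.Definitions.RawMonoid as RawMonoidDefinitions
import Algebra.Definitions.RawSemiring as RawSemiringDefinitions
open import Data.Bool.Base using (if_then_else_)
open import Data.Fin.Base using (Fin; zero; suc; toℕ; combine)
open import Data.List.Base using (List; []; _∷_; _++_; map; cartesianProductWith)
open import Data.Nat.Base as ℕ using (ℕ; _∸_; _≤_; _<_)
open import Data.Nat.Primality using (Prime)
import Data.Nat.Properties as ℕ
open import Data.Product.Base as Product using (Σ-syntax; ∃; ∃₂; _×_; _,_; proj₁)
open import Data.Vec.Base as Vec using (Vec)
open import Data.Vec.Functional as Vector using (Vector)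
import Data.Vec.Properties as Vec
open import Function.Base using (_on_; id)
open import Function.Bundles using (Inverse)
open import Function.Definitions using (Bijective)
open import Level using (Level; _⊔_; 0ℓ) renaming (suc to lsuc)
open import Relation.Binary.PropositionalEquality using (_≡_; setoid)
open import Relation.Nullary.Decidable using (does)
open import Relation.Unary using (Pred; _∈_; ｛_｝)

IsPrimePower : Pred ℕ 0ℓ
IsPrimePower q = ∃₂ λ p k → Prime p × q ≡ p ℕ.^ ℕ.suc k

record FiniteField (q : ℕ) (c ℓ : Level) : Set (lsuc (c ⊔ ℓ)) where
  field
    commutativeRing : CommutativeRing c ℓ

  open CommutativeRing commutativeRing public
    hiding (zero) renaming (setoid to ≈-setoid)
  open AlgebraDefinitions _≈_ using (Invertible)

  field
    0≉1         : 0# ≉ 1#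
    invertible  : ∀ {x} → x ≉ 0# → Invertible 1# _*_ x
    enumeration : Inverse ≈-setoid (setoid (Fin q))

  open RawSemiringDefinitions (RawRing.rawSemiring rawRing) public using (_^_)

module Ideals {c ℓ : Level} (R : RawRing c ℓ) where
  open RawRing R
  open RawSemiringDefinitions rawSemiring using (_^_; sum)

  infixl 6 _+ᴵ_

  ⟨_⟩ : {s : Level} → Pred Carrier s → Pred Carrier (c ⊔ ℓ ⊔ s)
  ⟨ S ⟩ p = ∃ λ k → Σ[ r ∈ Vector Carrier k ] Σ[ g ∈ Vector Carrier k ]
    (∀ i → g i ∈ S) × p ≈ sum (λ i → r i * g i)

  _+ᴵ_ : {s t : Level} → Pred Carrier s → Pred Carrier t → Pred Carrier (c ⊔ ℓ ⊔ s ⊔ t)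
  (I +ᴵ J) p = ∃₂ λ a b → a ∈ I × b ∈ J × p ≈ a + b

  Radical : {s : Level} → Pred Carrier s → Set (c ⊔ s)
  Radical I = ∀ p m → p ^ m ∈ I → p ∈ I

module _ {c ℓ : Level} (K : CommutativeRing c ℓ) where
  open CommutativeRing K using (Carrier; _≈_; 0#)

  FiniteDimensional : {m ℓm : Level} → RawLeftModule Carrier m ℓm → Set (c ⊔ ℓ ⊔ m ⊔ ℓm)
  FiniteDimensional M = ∃ λ k → Σ[ b ∈ Vector Carrierᴹ k ]
      (∀ v → Σ[ t ∈ Vector Carrier k ] v ≈ᴹ sum (λ i → t i *ₗ b i))
    × (∀ (t : Vector Carrier k) → sum (λ i → t i *ₗ b i) ≈ᴹ 0ᴹ → ∀ i → t i ≈ 0#)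
    where
    open RawLeftModule M
    open RawMonoidDefinitions +ᴹ-rawMonoid using (sum)

-- A polynomial is a formal sum of terms (coefficient , exponent vector).
-- Monomials may be repeated or have coefficient zero; the ring equality
-- compares the resulting coefficient of every monomial.

module Polynomials {c ℓ : Level} (K : CommutativeRing c ℓ) where
  private
    module K = CommutativeRing K

  Poly : ℕ → Set c
  Poly n = List (K.Carrier × Vec ℕ n)

  coeff : ∀ {n} → Poly n → Vec ℕ n → K.Carrier
  coeff []            m = K.0#
  coeff ((a , u) ∷ p) m =
    (if does (Vec.≡-dec ℕ._≟_ u m) then a else K.0#) K.+ coeff p m

  C : ∀ {n} → K.Carrier → Poly n
  C a = (a , Vec.replicate _ 0) ∷ []

  var : ∀ {n} → Fin n → Poly n
  var i = (K.1# , (Vec.replicate _ 0 Vec.[ i ]≔ 1)) ∷ []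

  polyRing : ℕ → RawRing c ℓ
  polyRing n = record
    { Carrier = Poly n
    ; _≈_     = λ p q → ∀ m → coeff p m K.≈ coeff q m
    ; _+_     = _++_
    ; _*_     = cartesianProductWith λ (a , u) (b , v) → a K.* b , Vec.zipWith ℕ._+_ u v
    ; -_      = map λ (a , u) → K.- a , u
    ; 0#      = []
    ; 1#      = C K.1#
    }

  module _ {a ℓa : Level} (A : RawRing a ℓa) (ι : K.Carrier → RawRing.Carrier A) where
    private
      module A = RawRing A
    open RawSemiringDefinitions A.rawSemiring using (_^_; product)

    evalIn : ∀ {n} → Vector A.Carrier n → Poly n → A.Carrier
    evalIn s []            = A.0#
    evalIn s ((a , u) ∷ p) =
      (ι a A.* product (λ i → s i ^ Vec.lookup u i)) A.+ evalIn s p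

  eval : ∀ {n} → Vector K.Carrier n → Poly n → K.Carrier
  eval = evalIn K.rawRing id

  subst : ∀ {m n} → Vector (Poly m) n → Poly n → Poly m
  subst {m} = evalIn (polyRing m) C

  DegreeIn_<_ : ∀ {n} → Fin n → ℕ → Pred (Poly n) ℓ
  (DegreeIn i < k) p = ∀ m → coeff p m K.≉ K.0# → Vec.lookup m i < k

  TotalDegree : ∀ {n} → ℕ → Pred (Poly n) ℓ
  TotalDegree d p =
      (∃ λ m → coeff p m K.≉ K.0# × Vec.sum m ≡ d)
    × (∀ m → coeff p m K.≉ K.0# → Vec.sum m ≤ d)

  AlgebraicSet : ∀ {n} {s : Level} → Pred (Poly n) s → Pred (Vector K.Carrier n) (c ⊔ ℓ ⊔ s)
  AlgebraicSet I s = ∀ p → p ∈ I → eval s p K.≈ K.0#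

  quotient : ∀ {n} {s : Level} → Pred (Poly n) s → RawLeftModule K.Carrier c s
  quotient {n} I = record
    { Carrierᴹ = Poly n
    ; _≈ᴹ_     = λ p q → p + - q ∈ I
    ; _+ᴹ_     = _+_
    ; _*ₗ_     = λ a p → C a * p
    ; 0ᴹ       = 0#
    ; -ᴹ_      = -_
    }
    where open RawRing (polyRing n)

  ZeroDimensional : ∀ {n} {s : Level} → Pred (Poly n) s → Set (c ⊔ ℓ ⊔ s)
  ZeroDimensional I = FiniteDimensional K (quotient I)

module LocalPermutation {q : ℕ} {c ℓ : Level} (𝔽 : FiniteField q c ℓ) where
  private
    module 𝔽 = FiniteField 𝔽
  open Polynomials 𝔽.commutativeRing
  open RawRing (polyRing 2) using (_≈_; _*_; 0#; rawSemiring)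
  open RawSemiringDefinitions rawSemiring using (_^_; sum)

  private
    [_,_] : {a : Level} {A : Set a} → A → A → Vector A 2
    [ u , v ] = u Vector.∷ v Vector.∷ Vector.[]

  X Y : Poly 2
  X = var zero
  Y = var (suc zero)

  LP : Pred (Poly 2) (c ⊔ ℓ)
  LP f = (∀ i → (DegreeIn i < q) f)
       × (∀ a → Bijective 𝔽._≈_ 𝔽._≈_ (λ t → eval [ t , a ] f))
       × (∀ a → Bijective 𝔽._≈_ 𝔽._≈_ (λ t → eval [ a , t ] f))

  RLP : Pred (Poly 2) (c ⊔ ℓ)
  RLP f = f ∈ LP
        × subst [ X , 0# ] f ≈ X
        × subst [ 0# , Y ] f ≈ Y

  RLP[_] : ℕ → Pred (Poly 2) (c ⊔ ℓ)
  RLP[ d ] f = f ∈ RLP × f ∈ TotalDegree d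

  N : ℕ
  N = (q ∸ 1) ℕ.* (q ∸ 1)

  -- The coordinate of a point of 𝔽^N belonging to the variable x i j below.
  _⟦_,_⟧ : Vector 𝔽.Carrier N → Fin (q ∸ 1) → Fin (q ∸ 1) → 𝔽.Carrier
  s ⟦ i , j ⟧ = s (combine i j)

  toPoly : Vector 𝔽.Carrier N → Poly 2
  toPoly s = sum λ i → sum λ j → C (s ⟦ i , j ⟧) * (X ^ toℕ i * Y ^ toℕ j)

  -- Membership proofs are irrelevant: both equalities look only at the first
  -- components.
  IdentifiedBytoPoly : {v t : Level} →
    Pred (Vector 𝔽.Carrier N) v → Pred (Poly 2) t → Set (c ⊔ ℓ ⊔ v ⊔ t)
  IdentifiedBytoPoly V T =
    Σ[ into ∈ (∀ {s} → s ∈ V → toPoly s ∈ T) ]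
      Bijective {A = ∃ V} {B = ∃ T}
        ((λ s s′ → ∀ k → s k 𝔽.≈ s′ k) on proj₁)
        (_≈_ on proj₁)
        (Product.map toPoly into)

module LPIdeals {q : ℕ} {c ℓ : Level} (𝔽 : FiniteField q c ℓ) where
  private
    module 𝔽 = FiniteField 𝔽
  open LocalPermutation 𝔽 using (N)
  open Polynomials 𝔽.commutativeRing
  open RawRing (polyRing N) using (_+_; -_; _*_; 1#; rawSemiring)
  open RawSemiringDefinitions rawSemiring using (_^_; sum; product)
  open Ideals (polyRing N)

  private
    infixl 6 _-_
    _-_ : Poly N → Poly N → Poly N
    p - p′ = p + - p′

  -- Indices 0, …, q − 2 are the elements of Fin (q ∸ 1).
  x : Fin (q ∸ 1) → Fin (q ∸ 1) → Poly N
  x i j = var (combine i j)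

  F : Poly N → Poly N
  F p = p ^ (q ∸ 1) - 1#

  module _ (a b e : 𝔽.Carrier) where
    private
      weight : Fin (q ∸ 1) → Fin (q ∸ 1) → Poly N
      weight i j = C (((a 𝔽.^ toℕ i) 𝔽.- (b 𝔽.^ toℕ i)) 𝔽.* (e 𝔽.^ toℕ j))

    Grow Gcol : Poly N
    Grow = F (sum λ i → sum λ j → weight i j * x j i)
    Gcol = F (sum λ i → sum λ j → weight i j * x i j)

  data Latin : Pred (Poly N) (c ⊔ ℓ) where
    row : ∀ {a b} e → a 𝔽.≉ b → Latin (Grow a b e)
    col : ∀ {a b} e → a 𝔽.≉ b → Latin (Gcol a b e)

  data FieldEquation : Pred (Poly N) (c ⊔ ℓ) where
    fieldEq : ∀ i j → FieldEquation (x i j ^ q - x i j)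

  𝒥 : Pred (Poly N) (c ⊔ ℓ)
  𝒥 = ⟨ Latin ⟩ +ᴵ ⟨ FieldEquation ⟩

  data Above (d : ℕ) : Pred (Poly N) (c ⊔ ℓ) where
    above : ∀ i j → d < toℕ i ℕ.+ toℕ j → Above d (x i j)

  -- Pairs with i + j ≠ d contribute the factor 1.
  diagonal : ℕ → Poly N
  diagonal d = product λ i → product λ j →
    if does (toℕ i ℕ.+ toℕ j ℕ.≟ d) then x i j ^ (q ∸ 1) - 1# else 1#

  𝒥[_] : ℕ → Pred (Poly N) (c ⊔ ℓ)
  𝒥[ d ] = 𝒥 +ᴵ ⟨ Above d ⟩ +ᴵ ⟨ ｛ diagonal d ｝ ⟩

  -- The indices 0 and 1, given here by their values, exist once q > 2.
  data Initial : Pred (Poly N) (c ⊔ ℓ) where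
    x₀₀   : ∀ {i j} → toℕ i ≡ 0 → toℕ j ≡ 0 → Initial (x i j)
    x₁₀-1 : ∀ {i j} → toℕ i ≡ 1 → toℕ j ≡ 0 → Initial (x i j - 1#)
    x₀₁-1 : ∀ {i j} → toℕ i ≡ 0 → toℕ j ≡ 1 → Initial (x i j - 1#)

  data Border : Pred (Poly N) (c ⊔ ℓ) where
    x₀ᵢ : ∀ {z i} → toℕ z ≡ 0 → 2 ≤ toℕ i → Border (x z i)
    xᵢ₀ : ∀ {z i} → toℕ z ≡ 0 → 2 ≤ toℕ i → Border (x i z)

  reduced : Pred (Poly N) (c ⊔ ℓ) → Pred (Poly N) (c ⊔ ℓ)
  reduced I = I +ᴵ ⟨ Initial ⟩ +ᴵ ⟨ Border ⟩

{-# OPTIONS --safe #-}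
-- A polynomial in K[x₁,…,xₘ] modulo the field equations is determined by its values on
-- K^m: with δ_a(x) = 1 - (x - a)^(q-1), every polynomial p satisfies p·Δ_s ≡ p(s)·Δ_s,
-- where Δ_s = ∏ δ_{s_k}(x_k), and the Δ_s sum to 1. Hence an ideal I containing the
-- field equations is the full vanishing ideal of its algebraic set V: for s ∉ V some
-- g ∈ I has g(s) ≠ 0, so Δ_s ∈ I. Thus I is radical and the Δ_s with s ∈ V form a basis
-- of the quotient. For the identification of V, the row and column generators say that
-- f(x,a) and f(a,x) are injective, and conversely no local permutation polynomial has a
-- monomial of degree q-1 in x or y, because ∑_t f(t,a) = ∑_t t = 0 for q > 2, whereas
-- ∑_t t^k is -1 for k = q-1 and 0 for k < q-1.
module Submission where

open import Algebra.Bundles using (CommutativeMonoid; CommutativeRing)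
open import Algebra.Bundles.Raw using (RawRing)
import Algebra.Definitions.RawSemiring as RawSemiringDefinitions
import Algebra.Morphism.Construct.Identity as Identity
open import Algebra.Morphism.Structures using (IsRingHomomorphism)
import Algebra.Properties.CommutativeMonoid.Sum as CommutativeMonoidSum
import Algebra.Properties.CommutativeSemigroup as CommutativeSemigroupProperties
import Algebra.Properties.CommutativeSemiring.Exp as CommutativeSemiringExp
import Algebra.Properties.Group as GroupProperties
import Algebra.Properties.Ring as RingProperties
import Algebra.Properties.Semiring.Sum as SemiringSum
import Algebra.Solver.Ring.NaturalCoefficients.Default as SemiringSolver
open import Data.Bool.Base using (if_then_else_)
open import Data.Fin.Base
  using (Fin; zero; suc; punchIn; toℕ; punchOut; inject≤;
         _↑ˡ_; _↑ʳ_; finToFun; funToFin; fromℕ; fromℕ<; combine; remQuot)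
import Data.Fin.Properties as Fin
open import Data.List.Base using (List; []; _∷_; _++_; map)
import Data.List.Membership.Propositional as List
open import Data.List.Relation.Unary.All as All using (All; []; _∷_)
open import Data.List.Relation.Unary.Any using (here; there)
open import Data.Nat.Base as ℕ using (ℕ; zero; suc; _≤_; _<_; s≤s; z≤n)
import Data.Nat.Properties as ℕ
open import Data.Product.Base using (_×_; _,_; proj₁; proj₂; ∃; ∃₂; Σ-syntax)
open import Data.Sum.Base as Sum using (_⊎_; inj₁; inj₂)
open import Data.Vec.Base as Vec using (Vec)
open import Data.Vec.Functional as Vector using (Vector; tail; removeAt)
import Data.Vec.Properties as Vec
open import Data.Vec.Relation.Binary.Pointwise.Extensional using (ext; Pointwise-≡⇒≡)
open import Defs
open import Function.Base using (_∘_; id; flip)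
open import Function.Bundles using (Inverse; mk⤖)
open import Function.Definitions using (Injective; Surjective; Bijective)
open import Function.Properties.Bijection using (⤖⇒↔)
open import Level using (Level; _⊔_)
import Relation.Binary.Definitions as Binary
open import Relation.Binary.PropositionalEquality as ≡ using (_≡_; _≢_)
import Relation.Binary.Reasoning.Setoid as SetoidReasoning
open import Relation.Nullary using (yes; no; does; contradiction; ¬_; Dec)
open import Relation.Nullary.Decidable using (map′; _×-dec_; ¬?; dec-true; dec-false)
open import Relation.Unary using (Pred; _∈_; Decidable; ｛_｝)

-- Two obstacles shape the development. Polynomials are unnormalised lists of terms, compared only
-- through their coefficients, so the ring laws have to be established for a pairing of such lists
-- with functions on exponents. And the logic is constructive: whether a point lies in V is a
-- question about infinitely many polynomials, so each ideal comes with a decision that yields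
-- either the vanishing of all its elements at the point or an element that does not vanish there.
-- These decisions are finite searches over generators, possible because the enumeration of F_q
-- makes its equality decidable.
--
-- The functions δ_a are built over an arbitrary commutative ring A with a ring homomorphism from
-- F_q. For A = F_q they give the values of the Δ_s at points; for A the quotient by I, where every
-- variable satisfies x^q = x, congruences modulo I become equations. In the form 1 - (x^q - a^q)/(x
-- - a), the relation x δ_a(x) = a δ_a(x) follows from x^q = x and a^q = a, and the sum over all a
-- follows from the power sums of F_q.

-- Finite sums in a commutative monoid

module MonoidSums {c ℓ : Level} (M : CommutativeMonoid c ℓ) where
  open CommutativeMonoid M
  open CommutativeMonoidSum M

  sum-cong : ∀ {n} (f g : Vector Carrier n) → (∀ i → f i ≈ g i) → sum f ≈ sum g
  sum-cong f g = sum-cong-≋ {x = f} {g}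

  sum-all-ε : ∀ {n} (f : Vector Carrier n) → (∀ i → f i ≈ ε) → sum f ≈ ε
  sum-all-ε {n} f f≈ε = trans (sum-cong-≋ f≈ε) (sum-replicate-zero n)

  sum-single : ∀ {n} (f : Vector Carrier n) (k : Fin n) →
               (∀ i → i ≢ k → f i ≈ ε) → sum f ≈ f k
  sum-single {suc n} f k f≈ε =
    trans (sum-remove {i = k} f)
      (trans (∙-congˡ (sum-all-ε _ λ i → f≈ε (punchIn k i) (Fin.punchInᵢ≢i k i)))
             (identityʳ (f k)))

  -- In multiplicative notation: a relation between `x`, `y` and the single factor `f k` passes to
  -- the whole product. In this way the one-variable relation for δ acts on the product Δ.
  ∙-sum-cong : ∀ {n x y} (f : Vector Carrier n) (k : Fin n) →
               x ∙ f k ≈ y ∙ f k → x ∙ sum f ≈ y ∙ sum f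
  ∙-sum-cong {suc n} f k eq =
    trans (∙-congˡ (sum-remove {i = k} f))
      (trans (sym (assoc _ _ _)) (trans (∙-congʳ eq)
        (trans (assoc _ _ _) (∙-congˡ (sym (sum-remove {i = k} f))))))

-- The commutative ring of term lists

module PolynomialRing {c ℓ : Level} (K : CommutativeRing c ℓ) where
  open CommutativeRing K hiding (zero)
  open Polynomials K
  open RingProperties ring using (-0#≈0#; -‿distribˡ-*; -‿+-comm)
  open CommutativeSemigroupProperties +-commutativeSemigroup using (interchange)
  open CommutativeSemigroupProperties *-commutativeSemigroup using (x∙yz≈y∙xz)
  open SetoidReasoning setoid

  private
    module P {n : ℕ} = RawRing (polyRing n)

  infixl 6 _⊕_
  _⊕_ : ∀ {n} → Vec ℕ n → Vec ℕ n → Vec ℕ n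
  _⊕_ = Vec.zipWith ℕ._+_

  𝟎 : ∀ {n} → Vec ℕ n
  𝟎 = Vec.replicate _ 0

  -- The linear form on polynomials with prescribed values on monomials. Two
  -- polynomials are equal iff all these forms agree on them, which turns the
  -- ring axioms into manipulations of finite sums.
  ∫ : ∀ {n} → Poly n → (Vec ℕ n → Carrier) → Carrier
  ∫ []            f = 0#
  ∫ ((a , u) ∷ p) f = a * f u + ∫ p f

  indicator : ∀ {n} → Vec ℕ n → Vec ℕ n → Carrier
  indicator m u = if does (Vec.≡-dec ℕ._≟_ u m) then 1# else 0#

  -- Agreement is asked only at the exponents that occur in `p`, which lets a function be replaced
  -- by one that differs from it elsewhere.
  ∫-congʳ-All : ∀ {n} {f g : Vec ℕ n → Carrier} (p : Poly n) →
                All (λ t → f (proj₂ t) ≈ g (proj₂ t)) p → ∫ p f ≈ ∫ p g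
  ∫-congʳ-All []      []           = refl
  ∫-congʳ-All (_ ∷ p) (eq ∷ eqs) = +-cong (*-congˡ eq) (∫-congʳ-All p eqs)

  ∫-congʳ : ∀ {n} {f g : Vec ℕ n → Carrier} (p : Poly n) →
            (∀ u → f u ≈ g u) → ∫ p f ≈ ∫ p g
  ∫-congʳ p f≈g = ∫-congʳ-All p (All.universal (λ t → f≈g (proj₂ t)) p)

  ∫-zeroʳ : ∀ {n} (p : Poly n) → ∫ p (λ _ → 0#) ≈ 0#
  ∫-zeroʳ []      = refl
  ∫-zeroʳ (_ ∷ p) = trans (+-cong (zeroʳ _) (∫-zeroʳ p)) (+-identityˡ 0#)

  ∫-+ʳ : ∀ {n} (p : Poly n) (f g : Vec ℕ n → Carrier) →
         ∫ p (λ u → f u + g u) ≈ ∫ p f + ∫ p g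
  ∫-+ʳ []            f g = sym (+-identityˡ 0#)
  ∫-+ʳ ((a , u) ∷ p) f g =
    trans (+-cong (distribˡ a (f u) (g u)) (∫-+ʳ p f g)) (interchange _ _ _ _)

  ∫-*ʳ : ∀ {n} (p : Poly n) b (f : Vec ℕ n → Carrier) →
         ∫ p (λ u → b * f u) ≈ b * ∫ p f
  ∫-*ʳ []            b f = sym (zeroʳ b)
  ∫-*ʳ ((a , u) ∷ p) b f =
    trans (+-cong (x∙yz≈y∙xz a b (f u)) (∫-*ʳ p b f)) (sym (distribˡ b _ _))

  -- Fubini for formal sums; through `∫-*` it becomes the commutativity of multiplication.
  ∫-swap : ∀ {m n} (p : Poly m) (r : Poly n) (f : Vec ℕ m → Vec ℕ n → Carrier) →
           ∫ p (λ u → ∫ r (f u)) ≈ ∫ r (λ v → ∫ p (λ u → f u v))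
  ∫-swap []            r f = sym (∫-zeroʳ r)
  ∫-swap ((a , u) ∷ p) r f = begin
    a * ∫ r (f u) + ∫ p (λ u → ∫ r (f u))
      ≈⟨ +-cong (sym (∫-*ʳ r a (f u))) (∫-swap p r f) ⟩
    ∫ r (λ v → a * f u v) + ∫ r (λ v → ∫ p (λ u → f u v))
      ≈⟨ ∫-+ʳ r _ _ ⟨
    ∫ r (λ v → a * f u v + ∫ p (λ u → f u v)) ∎

  ∫-++ : ∀ {n} (p r : Poly n) (f : Vec ℕ n → Carrier) →
         ∫ (p ++ r) f ≈ ∫ p f + ∫ r f
  ∫-++ []      r f = sym (+-identityˡ _)
  ∫-++ (_ ∷ p) r f = trans (+-congˡ (∫-++ p r f)) (sym (+-assoc _ _ _))

  ∫-- : ∀ {n} (p : Poly n) (f : Vec ℕ n → Carrier) → ∫ (P.- p) f ≈ - ∫ p f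
  ∫-- []            f = sym -0#≈0#
  ∫-- ((a , u) ∷ p) f =
    trans (+-cong (sym (-‿distribˡ-* a (f u))) (∫-- p f)) (-‿+-comm _ _)

  ∫-* : ∀ {n} (p r : Poly n) (f : Vec ℕ n → Carrier) →
        ∫ (p P.* r) f ≈ ∫ p (λ u → ∫ r (λ v → f (u ⊕ v)))
  ∫-* []            r f = refl
  ∫-* ((a , u) ∷ p) r f =
    trans (∫-++ (map _ r) (p P.* r) f) (+-cong (scale r) (∫-* p r f))
    where
    scale : ∀ r → ∫ (map (λ (b , v) → a * b , u ⊕ v) r) f ≈ a * ∫ r (λ v → f (u ⊕ v))
    scale []      = sym (zeroʳ a)
    scale (_ ∷ r) = trans (+-cong (*-assoc _ _ _) (scale r)) (sym (distribˡ a _ _))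

  ∫-C : ∀ {n} a (f : Vec ℕ n → Carrier) → ∫ (C a) f ≈ a * f 𝟎
  ∫-C a f = +-identityʳ _

  coeff-∫ : ∀ {n} (p : Poly n) m → coeff p m ≈ ∫ p (indicator m)
  coeff-∫ []            m = refl
  coeff-∫ ((a , u) ∷ p) m with Vec.≡-dec ℕ._≟_ u m
  ... | yes _ = +-cong (sym (*-identityʳ a)) (coeff-∫ p m)
  ... | no  _ = +-cong (sym (zeroʳ a)) (coeff-∫ p m)

  -- Repeated monomials may cancel across distant terms, so a recursion on `p` has no usable
  -- hypothesis. Instead `f` is stripped of its values at the occurring exponents: the part of `f`
  -- at `m` pairs with `p` to `f m` times a coefficient of `p`, which is zero.
  coeff≈0⇒∫≈0 : ∀ {n} (p : Poly n) → (∀ m → coeff p m ≈ 0#) → ∀ f → ∫ p f ≈ 0#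
  coeff≈0⇒∫≈0 {n} p p≈0 f =
    killing (map proj₂ p) f (All.tabulate λ t∈p → inj₁ (∈-map⁺ proj₂ t∈p))
    where
    open import Data.List.Membership.Propositional.Properties using (∈-map⁺)

    -- Induction on a list of exponents outside which f may be taken to vanish.
    killing : ∀ L f → All (λ t → proj₂ t List.∈ L ⊎ f (proj₂ t) ≈ 0#) p → ∫ p f ≈ 0#
    killing []      f small =
      trans (∫-congʳ-All p (All.map (λ { (inj₂ eq) → eq }) small)) (∫-zeroʳ p)
    killing (m ∷ L) f small = begin
      ∫ p f                                    ≈⟨ ∫-congʳ p split ⟩
      ∫ p (λ u → f m * indicator m u + f′ u)   ≈⟨ ∫-+ʳ p _ f′ ⟩
      ∫ p (λ u → f m * indicator m u) + ∫ p f′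
        ≈⟨ +-cong (∫-*ʳ p (f m) _) (killing L f′ (All.map (λ {t} → small′ {t}) small)) ⟩
      f m * ∫ p (indicator m) + 0#             ≈⟨ +-identityʳ _ ⟩
      f m * ∫ p (indicator m)                  ≈⟨ *-congˡ (trans (sym (coeff-∫ p m)) (p≈0 m)) ⟩
      f m * 0#                                 ≈⟨ zeroʳ _ ⟩
      0#                                       ∎
      where
      f′ : Vec ℕ n → Carrier
      f′ u = if does (Vec.≡-dec ℕ._≟_ u m) then 0# else f u

      split : ∀ u → f u ≈ f m * indicator m u + f′ u
      split u with Vec.≡-dec ℕ._≟_ u m
      ... | yes ≡.refl = sym (trans (+-identityʳ _) (*-identityʳ _))
      ... | no  _      = sym (trans (+-congʳ (zeroʳ _)) (+-identityˡ _))

      small′ : ∀ {t : Carrier × Vec ℕ n} → proj₂ t List.∈ m ∷ L ⊎ f (proj₂ t) ≈ 0# →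
               proj₂ t List.∈ L ⊎ f′ (proj₂ t) ≈ 0#
      small′ {_ , u} hyp with Vec.≡-dec ℕ._≟_ u m
      small′ hyp               | yes _  = inj₂ refl
      small′ (inj₁ (here u≡m)) | no u≢m = contradiction u≡m u≢m
      small′ (inj₁ (there u∈)) | no _   = inj₁ u∈
      small′ (inj₂ eq)         | no _   = inj₂ eq

  coeff-- : ∀ {n} (p r : Poly n) m → coeff (p P.+ P.- r) m ≈ coeff p m - coeff r m
  coeff-- p r m = begin
    coeff (p P.+ P.- r) m                   ≈⟨ coeff-∫ (p P.+ P.- r) m ⟩
    ∫ (p P.+ P.- r) (indicator m)           ≈⟨ ∫-++ p (P.- r) _ ⟩
    ∫ p (indicator m) + ∫ (P.- r) (indicator m) ≈⟨ +-cong (sym (coeff-∫ p m)) (∫-- r _) ⟩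
    coeff p m - ∫ r (indicator m)           ≈⟨ +-congˡ (-‿cong (coeff-∫ r m)) ⟨
    coeff p m - coeff r m                   ∎

  ∫-congˡ : ∀ {n} (p r : Poly n) → p P.≈ r → ∀ f → ∫ p f ≈ ∫ r f
  ∫-congˡ p r p≈r f = x-y≈0⇒x≈y (begin
    ∫ p f - ∫ r f       ≈⟨ +-congˡ (∫-- r f) ⟨
    ∫ p f + ∫ (P.- r) f ≈⟨ ∫-++ p (P.- r) f ⟨
    ∫ (p P.+ P.- r) f   ≈⟨ coeff≈0⇒∫≈0 (p P.+ P.- r) (λ m → trans (coeff-- p r m) (x≈y⇒x-y≈0 (p≈r m))) f ⟩
    0#                  ∎)
    where
    open import Algebra.Properties.Group +-group
      using () renaming (x∙y⁻¹≈ε⇒x≈y to x-y≈0⇒x≈y′; x≈y⇒x∙y⁻¹≈ε to x≈y⇒x-y≈0)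
    x-y≈0⇒x≈y : ∀ {x y} → x - y ≈ 0# → x ≈ y
    x-y≈0⇒x≈y = x-y≈0⇒x≈y′ _ _

  ∫-ext : ∀ {n} (p r : Poly n) → (∀ f → ∫ p f ≈ ∫ r f) → p P.≈ r
  ∫-ext p r eq m = trans (coeff-∫ p m) (trans (eq (indicator m)) (sym (coeff-∫ r m)))

  polyCommutativeRing : ℕ → CommutativeRing c ℓ
  polyCommutativeRing n = record
    { RawRing (polyRing n)
    ; isCommutativeRing = record
      { isRing = record
        { +-isAbelianGroup = record
          { isGroup = record
            { isMonoid = record
              { isSemigroup = record
                { isMagma = record
                  { isEquivalence = record
                    { refl  = λ _ → refl
                    ; sym   = λ p≈r m → sym (p≈r m)
                    ; trans = λ p≈r r≈s m → trans (p≈r m) (r≈s m)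
                    }
                  ; ∙-cong = λ {p} {p′} {r} {r′} p≈p′ r≈r′ → ∫-ext (p ++ r) (p′ ++ r′) λ f →
                      trans (∫-++ p r f) 
                        (trans (+-cong (∫-congˡ p p′ p≈p′ f) (∫-congˡ r r′ r≈r′ f)) (sym (∫-++ p′ r′ f)))
                  }
                ; assoc = λ p r s m → reflexive (≡.cong (λ z → coeff z m) (++-assoc p r s))
                }
              ; identity = (λ p m → refl) , λ p m → reflexive (≡.cong (λ z → coeff z m) (++-identityʳ p))
              }
            ; inverse = (λ p → ∫-ext (P.- p ++ p) [] λ f →
                          trans (∫-++ (P.- p) p f) (trans (+-congʳ (∫-- p f)) (-‿inverseˡ _)))
                      , (λ p → ∫-ext (p ++ P.- p) [] λ f →
                          trans (∫-++ p (P.- p) f) (trans (+-congˡ (∫-- p f)) (-‿inverseʳ _)))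
            ; ⁻¹-cong = λ {p} {r} p≈r → ∫-ext (P.- p) (P.- r) λ f →
                trans (∫-- p f) (trans (-‿cong (∫-congˡ p r p≈r f)) (sym (∫-- r f)))
            }
          ; comm = λ p r → ∫-ext (p ++ r) (r ++ p) λ f → trans (∫-++ p r f) (trans (+-comm _ _) (sym (∫-++ r p f)))
          }
        ; *-cong = λ {p} {p′} {r} {r′} p≈p′ r≈r′ → ∫-ext (p P.* r) (p′ P.* r′) λ f → begin
            ∫ (p P.* r) f                        ≈⟨ ∫-* p r f ⟩
            ∫ p (λ u → ∫ r (λ v → f (u ⊕ v)))    ≈⟨ ∫-congʳ p (λ u → ∫-congˡ r r′ r≈r′ _) ⟩
            ∫ p (λ u → ∫ r′ (λ v → f (u ⊕ v)))   ≈⟨ ∫-congˡ p p′ p≈p′ _ ⟩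
            ∫ p′ (λ u → ∫ r′ (λ v → f (u ⊕ v)))  ≈⟨ ∫-* p′ r′ f ⟨
            ∫ (p′ P.* r′) f                      ∎
        ; *-assoc = λ p r s → ∫-ext ((p P.* r) P.* s) (p P.* (r P.* s)) λ f → begin
            ∫ ((p P.* r) P.* s) f                                  ≈⟨ ∫-* (p P.* r) s f ⟩
            ∫ (p P.* r) (λ w → ∫ s (λ x → f (w ⊕ x)))              ≈⟨ ∫-* p r _ ⟩
            ∫ p (λ u → ∫ r (λ v → ∫ s (λ x → f (u ⊕ v ⊕ x))))
              ≈⟨ ∫-congʳ p (λ u → ∫-congʳ r λ v → ∫-congʳ s λ x → reflexive (≡.cong f (⊕-assoc u v x))) ⟩
            ∫ p (λ u → ∫ r (λ v → ∫ s (λ x → f (u ⊕ (v ⊕ x)))))    ≈⟨ ∫-congʳ p (λ u → ∫-* r s _) ⟨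
            ∫ p (λ u → ∫ (r P.* s) (λ w → f (u ⊕ w)))              ≈⟨ ∫-* p (r P.* s) f ⟨
            ∫ (p P.* (r P.* s)) f                                  ∎
        ; *-identity = *-idˡ , λ p → ∫-ext (p P.* C 1#) p λ f →
            trans (comm p (C 1#) f) (∫-congˡ (C 1# P.* p) p (*-idˡ p) f)
        ; distrib = distˡ , λ p r s → ∫-ext ((r P.+ s) P.* p) (r P.* p P.+ s P.* p) λ f → begin
            ∫ ((r P.+ s) P.* p) f           ≈⟨ comm (r P.+ s) p f ⟩
            ∫ (p P.* (r P.+ s)) f           ≈⟨ ∫-congˡ (p P.* (r P.+ s)) (p P.* r P.+ p P.* s) (distˡ p r s) f ⟩
            ∫ (p P.* r P.+ p P.* s) f       ≈⟨ ∫-++ (p P.* r) (p P.* s) f ⟩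
            ∫ (p P.* r) f + ∫ (p P.* s) f   ≈⟨ +-cong (comm p r f) (comm p s f) ⟩
            ∫ (r P.* p) f + ∫ (s P.* p) f   ≈⟨ ∫-++ (r P.* p) (s P.* p) f ⟨
            ∫ (r P.* p P.+ s P.* p) f       ∎
        }
      ; *-comm = λ p r → ∫-ext (p P.* r) (r P.* p) (comm p r)
      }
    }
    where
    open import Data.List.Properties using (++-assoc; ++-identityʳ)

    ⊕-assoc : (u v w : Vec ℕ n) → u ⊕ v ⊕ w ≡ u ⊕ (v ⊕ w)
    ⊕-assoc = Vec.zipWith-assoc ℕ.+-assoc

    comm : ∀ (p r : Poly n) f → ∫ (p P.* r) f ≈ ∫ (r P.* p) f
    comm p r f = begin
      ∫ (p P.* r) f                      ≈⟨ ∫-* p r f ⟩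
      ∫ p (λ u → ∫ r (λ v → f (u ⊕ v)))  ≈⟨ ∫-swap p r _ ⟩
      ∫ r (λ v → ∫ p (λ u → f (u ⊕ v)))
        ≈⟨ ∫-congʳ r (λ v → ∫-congʳ p λ u → reflexive (≡.cong f (Vec.zipWith-comm ℕ.+-comm u v))) ⟩
      ∫ r (λ v → ∫ p (λ u → f (v ⊕ u)))  ≈⟨ ∫-* r p f ⟨
      ∫ (r P.* p) f                      ∎

    *-idˡ : ∀ (p : Poly n) → C 1# P.* p P.≈ p
    *-idˡ p = ∫-ext (C 1# P.* p) p λ f → begin
      ∫ (C 1# P.* p) f                 ≈⟨ ∫-* (C 1#) p f ⟩
      ∫ (C 1#) (λ u → ∫ p (λ v → f (u ⊕ v))) ≈⟨ ∫-C 1# (λ u → ∫ p (λ v → f (u ⊕ v))) ⟩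
      1# * ∫ p (λ v → f (𝟎 ⊕ v))       ≈⟨ *-identityˡ _ ⟩
      ∫ p (λ v → f (𝟎 ⊕ v))
        ≈⟨ ∫-congʳ p (λ v → reflexive (≡.cong f (Vec.zipWith-identityˡ (λ _ → ≡.refl) v))) ⟩
      ∫ p f                            ∎

    distˡ : ∀ (p r s : Poly n) → p P.* (r P.+ s) P.≈ p P.* r P.+ p P.* s
    distˡ p r s = ∫-ext (p P.* (r P.+ s)) (p P.* r P.+ p P.* s) λ f → begin
      ∫ (p P.* (r P.+ s)) f                          ≈⟨ ∫-* p (r P.+ s) f ⟩
      ∫ p (λ u → ∫ (r P.+ s) (λ v → f (u ⊕ v)))      ≈⟨ ∫-congʳ p (λ u → ∫-++ r s _) ⟩
      ∫ p (λ u → ∫ r (λ v → f (u ⊕ v)) + ∫ s (λ v → f (u ⊕ v)))  ≈⟨ ∫-+ʳ p _ _ ⟩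
      ∫ p (λ u → ∫ r (λ v → f (u ⊕ v))) + ∫ p (λ u → ∫ s (λ v → f (u ⊕ v)))
        ≈⟨ +-cong (∫-* p r f) (∫-* p s f) ⟨
      ∫ (p P.* r) f + ∫ (p P.* s) f                  ≈⟨ ∫-++ (p P.* r) (p P.* s) f ⟨
      ∫ (p P.* r P.+ p P.* s) f                      ∎

-- Evaluation, monomials and substitution

module Evaluation {c ℓ : Level} (K : CommutativeRing c ℓ) where
  open CommutativeRing K hiding (zero)
  open Polynomials K
  open PolynomialRing K
  open CommutativeSemiringExp commutativeSemiring using (_^_; ^-congˡ; ^-homo-*)
  open CommutativeMonoidSum +-commutativeMonoid using (sum)
  open CommutativeMonoidSum *-commutativeMonoid using () renaming
    (sum to product; sum-cong-≋ to product-cong; ∑-distrib-+ to product-distrib-*)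
  open MonoidSums *-commutativeMonoid using ()
    renaming (sum-single to product-single; sum-all-ε to product-all-1)
  open MonoidSums ℕ.+-0-commutativeMonoid using () renaming (sum-single to ℕ-sum-single)
  open CommutativeMonoidSum ℕ.+-0-commutativeMonoid using () renaming (sum to ℕ-sum)
  open SetoidReasoning setoid

  private
    module P {n : ℕ} = RawRing (polyRing n)
    module PS {n : ℕ} = RawSemiringDefinitions (RawRing.rawSemiring (polyRing n))

  power : ∀ {n} → Vector Carrier n → Vec ℕ n → Carrier
  power s u = product (λ i → s i ^ Vec.lookup u i)

  power-⊕ : ∀ {n} (s : Vector Carrier n) u v → power s (u ⊕ v) ≈ power s u * power s v
  power-⊕ s u v =
    trans (product-cong λ i →
             trans (reflexive (≡.cong (s i ^_) (Vec.lookup-zipWith ℕ._+_ i u v)))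
                   (^-homo-* (s i) (Vec.lookup u i) (Vec.lookup v i)))
          (product-distrib-* (λ i → s i ^ Vec.lookup u i) (λ i → s i ^ Vec.lookup v i))

  power-𝟎 : ∀ {n} (s : Vector Carrier n) → power s 𝟎 ≈ 1#
  power-𝟎 s = product-all-1 (λ i → s i ^ Vec.lookup 𝟎 i) λ i → reflexive (≡.cong (s i ^_) (Vec.lookup-replicate i 0))

  -- Evaluation is itself one of the linear forms, so it inherits from them its compatibility with
  -- ring equality and with products.
  eval-∫ : ∀ {n} (s : Vector Carrier n) p → eval s p ≈ ∫ p (power s)
  eval-∫ s []      = refl
  eval-∫ s (_ ∷ p) = +-congˡ (eval-∫ s p)

  eval-congˡ : ∀ {n} (s : Vector Carrier n) p r → p P.≈ r → eval s p ≈ eval s r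
  eval-congˡ s p r p≈r =
    trans (eval-∫ s p) (trans (∫-congˡ p r p≈r (power s)) (sym (eval-∫ s r)))

  eval-congʳ : ∀ {n} {s t : Vector Carrier n} → (∀ i → s i ≈ t i) → ∀ p → eval s p ≈ eval t p
  eval-congʳ         s≈t []            = refl
  eval-congʳ {s = s} s≈t ((a , u) ∷ p) =
    +-cong (*-congˡ (product-cong λ i → ^-congˡ (Vec.lookup u i) (s≈t i))) (eval-congʳ {s = s} s≈t p)

  eval-+ : ∀ {n} (s : Vector Carrier n) p r → eval s (p P.+ r) ≈ eval s p + eval s r
  eval-+ s []      r = sym (+-identityˡ _)
  eval-+ s (_ ∷ p) r = trans (+-congˡ (eval-+ s p r)) (sym (+-assoc _ _ _))

  eval-- : ∀ {n} (s : Vector Carrier n) p → eval s (P.- p) ≈ - eval s p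
  eval-- s p = trans (eval-∫ s (P.- p)) (trans (∫-- p (power s)) (-‿cong (sym (eval-∫ s p))))

  eval-* : ∀ {n} (s : Vector Carrier n) p r → eval s (p P.* r) ≈ eval s p * eval s r
  eval-* s p r = begin
    eval s (p P.* r)                             ≈⟨ eval-∫ s (p P.* r) ⟩
    ∫ (p P.* r) (power s)                        ≈⟨ ∫-* p r (power s) ⟩
    ∫ p (λ u → ∫ r (λ v → power s (u ⊕ v)))      ≈⟨ ∫-congʳ p (λ u → ∫-congʳ r (power-⊕ s u)) ⟩
    ∫ p (λ u → ∫ r (λ v → power s u * power s v))
      ≈⟨ ∫-congʳ p (λ u → trans (∫-*ʳ r (power s u) (power s)) (*-comm _ _)) ⟩
    ∫ p (λ u → ∫ r (power s) * power s u)        ≈⟨ ∫-*ʳ p _ (power s) ⟩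
    ∫ r (power s) * ∫ p (power s)                ≈⟨ *-cong (eval-∫ s r) (eval-∫ s p) ⟨
    eval s r * eval s p                          ≈⟨ *-comm _ _ ⟩
    eval s p * eval s r                          ∎

  eval-C : ∀ {n} (s : Vector Carrier n) a → eval s (C a) ≈ a
  eval-C s a = trans (+-identityʳ _) (trans (*-congˡ (power-𝟎 s)) (*-identityʳ a))

  eval-^ : ∀ {n} (s : Vector Carrier n) p k → eval s (p PS.^ k) ≈ eval s p ^ k
  eval-^ s p zero    = eval-C s 1#
  eval-^ s p (suc k) = trans (eval-* s p (p PS.^ k)) (*-congˡ (eval-^ s p k))

  eval-sum : ∀ {m n} (s : Vector Carrier n) (f : Vector (Poly n) m) →
             eval s (PS.sum f) ≈ sum (λ i → eval s (f i))
  eval-sum {zero}  s f = refl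
  eval-sum {suc m} s f =
    trans (eval-+ s (f zero) (PS.sum (f ∘ suc))) (+-congˡ (eval-sum s (f ∘ suc)))

  eval-product : ∀ {m n} (s : Vector Carrier n) (f : Vector (Poly n) m) →
                 eval s (PS.product f) ≈ product (λ i → eval s (f i))
  eval-product {zero}  s f = eval-C s 1#
  eval-product {suc m} s f =
    trans (eval-* s (f zero) (PS.product (f ∘ suc))) (*-congˡ (eval-product s (f ∘ suc)))

  -- The polynomial is the monic monomial with exponent `u`, expressed through the linear forms;
  -- coefficients such as 1 * 1 that arise in products then need no normalisation.
  IsMonomial : ∀ {n} → Poly n → Vec ℕ n → Set (c ⊔ ℓ)
  IsMonomial p u = ∀ f → ∫ p f ≈ f u

  1-isMonomial : ∀ {n} → IsMonomial (P.1# {n}) 𝟎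
  1-isMonomial f = trans (∫-C 1# f) (*-identityˡ _)

  var-isMonomial : ∀ {n} (i : Fin n) → IsMonomial (var i) (𝟎 Vec.[ i ]≔ 1)
  var-isMonomial i f = trans (+-identityʳ _) (*-identityˡ _)

  *-isMonomial : ∀ {n} {p r : Poly n} {u v} →
                 IsMonomial p u → IsMonomial r v → IsMonomial (p P.* r) (u ⊕ v)
  *-isMonomial {p = p} {r} p∼u r∼v f =
    trans (∫-* p r f) (trans (p∼u _) (r∼v _))

  ^-isMonomial : ∀ {n} {p : Poly n} {u} k →
                 IsMonomial p u → IsMonomial (p PS.^ k) (Vec.map (k ℕ.*_) u)
  ^-isMonomial {u = u} zero p∼u f =
    trans (1-isMonomial f) (reflexive (≡.cong f (≡.sym (Vec.map-const u 0))))
  ^-isMonomial {p = p} {u} (suc k) p∼u f =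
    trans (*-isMonomial {p = p} {p PS.^ k} p∼u (^-isMonomial {p = p} k p∼u) f)
          (reflexive (≡.cong f (≡.trans (≡.cong (_⊕ Vec.map (k ℕ.*_) u) (≡.sym (Vec.map-id u)))
                                (zipWith-map u))))
    where
    zipWith-map : ∀ {n} (u : Vec ℕ n) →
                  Vec.map id u ⊕ Vec.map (k ℕ.*_) u ≡ Vec.map (suc k ℕ.*_) u
    zipWith-map Vec.[]       = ≡.refl
    zipWith-map (x Vec.∷ u) = ≡.cong (_ Vec.∷_) (zipWith-map u)

  product-isMonomial : ∀ {m n} (p : Vector (Poly n) m) (u : Vector (Vec ℕ n) m) →
                       (∀ i → IsMonomial (p i) (u i)) →
                       IsMonomial (PS.product p) (Vector.foldr _⊕_ 𝟎 u)
  product-isMonomial {zero}  p u p∼u = 1-isMonomial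
  product-isMonomial {suc m} p u p∼u =
    *-isMonomial {p = p zero} {PS.product (p ∘ suc)} (p∼u zero)
      (product-isMonomial (p ∘ suc) (u ∘ suc) (p∼u ∘ suc))

  eval-monomial : ∀ {n} (s : Vector Carrier n) p {u} → IsMonomial p u → eval s p ≈ power s u
  eval-monomial s p p∼u = trans (eval-∫ s p) (p∼u (power s))

  eval-var : ∀ {n} (s : Vector Carrier n) i → eval s (var i) ≈ s i
  eval-var s i = begin
    eval s (var i)                              ≈⟨ eval-monomial s (var i) (var-isMonomial i) ⟩
    power s (𝟎 Vec.[ i ]≔ 1)                    ≈⟨ product-single (λ j → s j ^ Vec.lookup (𝟎 Vec.[ i ]≔ 1) j) i off ⟩
    s i ^ Vec.lookup (𝟎 Vec.[ i ]≔ 1) i         ≡⟨ ≡.cong (s i ^_) (Vec.lookup∘updateAt i 𝟎) ⟩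
    s i ^ 1                                     ≈⟨ *-identityʳ (s i) ⟩
    s i                                         ∎
    where
    off : ∀ j → j ≢ i → s j ^ Vec.lookup (𝟎 Vec.[ i ]≔ 1) j ≈ 1#
    off j j≢i = reflexive (≡.cong (s j ^_)
      (≡.trans (Vec.lookup∘updateAt′ j i j≢i 𝟎) (Vec.lookup-replicate j 0)))

  product-var-isMonomial : ∀ {n} (u : Vec ℕ n) →
    IsMonomial (PS.product λ i → var i PS.^ Vec.lookup u i) u
  product-var-isMonomial {n} u f =
    trans (product-isMonomial (λ i → var i PS.^ Vec.lookup u i) e
            (λ i → ^-isMonomial {p = var i} (Vec.lookup u i) (var-isMonomial i)) f)
          -- Coordinate j of the exponent is the sum over i of u_i times the j-th entry of the i-th
          -- unit vector, and only i = j contributes.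
          (reflexive (≡.cong f (Pointwise-≡⇒≡ (ext λ j →
             ≡.trans (lookup-foldr e j) (≡.trans (ℕ-sum-single (λ i → Vec.lookup (e i) j) j (off j)) (diagonal j))))))
    where
    e : Vector (Vec ℕ n) n
    e i = Vec.map (Vec.lookup u i ℕ.*_) (𝟎 Vec.[ i ]≔ 1)

    lookup-foldr : ∀ {m} (e : Vector (Vec ℕ n) m) j →
                   Vec.lookup (Vector.foldr _⊕_ 𝟎 e) j ≡ ℕ-sum (λ i → Vec.lookup (e i) j)
    lookup-foldr {zero}  e j = Vec.lookup-replicate j 0
    lookup-foldr {suc m} e j = ≡.trans (Vec.lookup-zipWith ℕ._+_ j (e zero) _)
                                 (≡.cong (Vec.lookup (e zero) j ℕ.+_) (lookup-foldr (e ∘ suc) j))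

    off : ∀ j i → i ≢ j → Vec.lookup (e i) j ≡ 0
    off j i i≢j = ≡.trans (Vec.lookup-map j _ (𝟎 Vec.[ i ]≔ 1))
      (≡.trans (≡.cong (Vec.lookup u i ℕ.*_)
                 (≡.trans (Vec.lookup∘updateAt′ j i (i≢j ∘ ≡.sym) 𝟎) (Vec.lookup-replicate j 0)))
               (ℕ.*-zeroʳ (Vec.lookup u i)))

    diagonal : ∀ j → Vec.lookup (e j) j ≡ Vec.lookup u j
    diagonal j = ≡.trans (Vec.lookup-map j _ (𝟎 Vec.[ j ]≔ 1))
      (≡.trans (≡.cong (Vec.lookup u j ℕ.*_) (Vec.lookup∘updateAt j 𝟎))
               (ℕ.*-identityʳ (Vec.lookup u j)))

  ∫-C* : ∀ {n} a (p : Poly n) f → ∫ (C a P.* p) f ≈ a * ∫ p f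
  ∫-C* a p f = begin
    ∫ (C a P.* p) f                        ≈⟨ ∫-* (C a) p f ⟩
    ∫ (C a) (λ u → ∫ p (λ v → f (u ⊕ v)))  ≈⟨ ∫-C a (λ u → ∫ p (λ v → f (u ⊕ v))) ⟩
    a * ∫ p (λ v → f (𝟎 ⊕ v))
      ≈⟨ *-congˡ (∫-congʳ p (λ v → reflexive (≡.cong f (Vec.zipWith-identityˡ (λ _ → ≡.refl) v)))) ⟩
    a * ∫ p f                              ∎

  -- A term is data, not a ring expression. Rewritten as a constant times powers of variables, it
  -- lets a relation known for constants and variables spread to all polynomials by induction on the
  -- list.
  ∷-decompose : ∀ {n} a u (p : Poly n) →
    (a , u) ∷ p P.≈ C a P.* PS.product (λ i → var i PS.^ Vec.lookup u i) P.+ p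
  ∷-decompose a u p = ∫-ext ((a , u) ∷ p) (C a P.* M P.+ p) λ f → begin
    a * f u + ∫ p f             ≈⟨ +-congʳ (*-congˡ (product-var-isMonomial u f)) ⟨
    a * ∫ M f + ∫ p f           ≈⟨ +-congʳ (∫-C* a M f) ⟨
    ∫ (C a P.* M) f + ∫ p f     ≈⟨ ∫-++ (C a P.* M) p f ⟨
    ∫ (C a P.* M P.+ p) f       ∎
    where M = PS.product λ i → var i PS.^ Vec.lookup u i

  ∫-sum : ∀ {m n} (p : Vector (Poly n) m) f → ∫ (PS.sum p) f ≈ sum (λ i → ∫ (p i) f)
  ∫-sum {zero}  p f = refl
  ∫-sum {suc m} p f =
    trans (∫-++ (p zero) (PS.sum (p ∘ suc)) f) (+-congˡ (∫-sum (p ∘ suc) f))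

  ∫-subst : ∀ {m n} (t : Vector (Poly m) n) p f →
            ∫ (subst t p) f ≈ ∫ p (λ u → ∫ (PS.product λ i → t i PS.^ Vec.lookup u i) f)
  ∫-subst t []            f = refl
  ∫-subst t ((a , u) ∷ p) f =
    trans (∫-++ (C a P.* M) (subst t p) f) (+-cong (∫-C* a M f) (∫-subst t p f))
    where M = PS.product λ i → t i PS.^ Vec.lookup u i

-- A missed value could be punched out of the codomain, leaving an injection into a smaller finite
-- set.
injective⇒surjective : ∀ {n} {f : Fin n → Fin n} →
                       Injective _≡_ _≡_ f → ∀ y → ∃ λ x → f x ≡ y
injective⇒surjective {suc n} {f} f-inj y with Fin.any? (λ x → f x Fin.≟ y)
... | yes found = found
... | no  y∉f   = contradiction
  (Fin.injective⇒≤ {f = λ x → punchOut (y≢f x)}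
    λ {u} {v} → f-inj ∘ Fin.punchOut-injective (y≢f u) (y≢f v)) ℕ.1+n≰n
  where
  y≢f : ∀ x → y ≢ f x
  y≢f x y≡fx = y∉f (x , ≡.sym y≡fx)

-- Univariate polynomial functions: geometric sums and division by a linear factor

module PolynomialFunctions {c ℓ : Level} (K : CommutativeRing c ℓ) where
  open CommutativeRing K hiding (zero)
  open CommutativeSemiringExp commutativeSemiring using (_^_; ^-congˡ)
  open SemiringSum semiring using (sum; *-distribˡ-sum)
  open MonoidSums +-commutativeMonoid using (sum-cong)
  open import Algebra.Properties.CommutativeSemigroup *-commutativeSemigroup using (x∙yz≈y∙xz)
  open SetoidReasoning setoid
  private module Solver = SemiringSolver commutativeSemiring

  -- h k a x = Σ_{i<k} a^{k-1-i} x^i = (x^k - a^k) / (x - a)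
  h : ℕ → Carrier → Carrier → Carrier
  h zero    a x = 0#
  h (suc k) a x = a ^ k + x * h k a x

  -- The factorisation (x - a) h = x^k - a^k with the negative terms moved across, which makes it an
  -- identity of commutative semirings.
  h-geometric : ∀ k a x → x * h k a x + a ^ k ≈ a * h k a x + x ^ k
  h-geometric zero    a x = +-congʳ (trans (zeroʳ x) (sym (zeroʳ a)))
  h-geometric (suc k) a x = begin
    x * (a ^ k + x * h k a x) + a * a ^ k
      ≈⟨ +-congʳ (*-congˡ (trans (+-comm _ _) (h-geometric k a x))) ⟩
    x * (a * h k a x + x ^ k) + a * a ^ k
      ≈⟨ Solver.solve 5 (λ a x h a^k x^k → x :* (a :* h :+ x^k) :+ a :* a^k
           := a :* (a^k :+ x :* h) :+ x :* x^k) refl a x (h k a x) (a ^ k) (x ^ k) ⟩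
    a * (a ^ k + x * h k a x) + x * x ^ k ∎
    where open Solver using (_:+_; _:*_; _:=_)

  P : ∀ {m} → Vector Carrier m → Carrier → Carrier
  P c t = sum (λ i → c i * t ^ toℕ i)

  P-suc : ∀ {m} (c : Vector Carrier (suc m)) t → P c t ≈ c zero + t * P (tail c) t
  P-suc c t = +-cong (*-identityʳ _)
    (trans (sum-cong (λ i → c (suc i) * (t * t ^ toℕ i)) (λ i → t * (c (suc i) * t ^ toℕ i))
              λ i → x∙yz≈y∙xz (c (suc i)) t (t ^ toℕ i))
           (sym (*-distribˡ-sum t (λ i → c (suc i) * t ^ toℕ i))))

  P-congʳ : ∀ {m} (c : Vector Carrier m) {t t′} → t ≈ t′ → P c t ≈ P c t′
  P-congʳ c t≈t′ = sum-cong (λ i → c i * _ ^ toℕ i) (λ i → c i * _ ^ toℕ i) λ i → *-congˡ (^-congˡ (toℕ i) t≈t′)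

  -- Synthetic division by the linear polynomial with root r.
  quot : ∀ {m} → Vector Carrier (suc m) → Carrier → Vector Carrier m
  quot {suc m} c r zero    = P (tail c) r
  quot {suc m} c r (suc i) = quot (tail c) r i

  -- With t = r + d this is P(t) = P(r) + (t - r) Q(t). Taking the difference `d` as the variable
  -- removes all subtraction.
  P-quot : ∀ {m} (c : Vector Carrier (suc m)) r d →
           P c (r + d) ≈ P c r + d * P (quot c r) (r + d)
  P-quot {zero}  c r d = sym (trans (+-congˡ (zeroʳ d)) (+-identityʳ _))
  P-quot {suc m} c r d = begin
    P c (r + d)                                       ≈⟨ P-suc c (r + d) ⟩
    c zero + (r + d) * P (tail c) (r + d)             ≈⟨ +-congˡ (*-congˡ (P-quot (tail c) r d)) ⟩
    c zero + (r + d) * (R + d * Q)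
      ≈⟨ Solver.solve 5 (λ c r d R Q → c :+ (r :+ d) :* (R :+ d :* Q)
           := (c :+ r :* R) :+ d :* (R :+ (r :+ d) :* Q)) refl (c zero) r d R Q ⟩
    (c zero + r * R) + d * (R + (r + d) * Q)
      ≈⟨ +-cong (P-suc c r) (*-congˡ (P-suc (quot c r) (r + d))) ⟨
    P c r + d * P (quot c r) (r + d)                  ∎
    where
    open Solver using (_:+_; _:*_; _:=_)
    R = P (tail c) r
    Q = P (quot (tail c) r) (r + d)

  -- Synthetic division can be undone. The entry `quot c r zero` is the value of `tail c` at `r`, so
  -- the hypothesis on the quotient also supplies the zero remainder that the induction on `tail c`
  -- asks for.
  quot≈0⇒≈0 : ∀ {m} (c : Vector Carrier (suc m)) r → P c r ≈ 0# →
              (∀ i → quot c r i ≈ 0#) → ∀ i → c i ≈ 0#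
  quot≈0⇒≈0 {zero}  c r Pr≈0 quot≈0 zero    = trans (sym (trans (+-identityʳ _) (*-identityʳ _))) Pr≈0
  quot≈0⇒≈0 {suc m} c r Pr≈0 quot≈0 zero    = begin
    c zero                     ≈⟨ trans (+-congˡ (zeroʳ r)) (+-identityʳ _) ⟨
    c zero + r * 0#            ≈⟨ +-congˡ (*-congˡ (quot≈0 zero)) ⟨
    c zero + r * P (tail c) r  ≈⟨ P-suc c r ⟨
    P c r                      ≈⟨ Pr≈0 ⟩
    0#                         ∎
  quot≈0⇒≈0 {suc m} c r Pr≈0 quot≈0 (suc i) =
    quot≈0⇒≈0 (tail c) r (quot≈0 zero) (quot≈0 ∘ suc) i

  monic : ∀ m → Vector Carrier (suc m)
  monic zero    _       = 1#
  monic (suc m) zero    = 0#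
  monic (suc m) (suc i) = monic m i

  P-monic : ∀ m t → P (monic m) t ≈ t ^ m
  P-monic zero    t = trans (+-identityʳ _) (*-identityˡ _)
  P-monic (suc m) t =
    trans (P-suc (monic (suc m)) t) (trans (+-identityˡ _) (*-congˡ (P-monic m t)))

-- A field with q = n + 1 elements: roots, Fermat's identity and power sums

module FiniteFieldProperties {n : ℕ} {c ℓ : Level} (𝔽 : FiniteField (suc n) c ℓ) where
  open FiniteField 𝔽
  open CommutativeSemiringExp commutativeSemiring using (^-congˡ; ^-distrib-*)
  open PolynomialFunctions commutativeRing
  open SemiringSum semiring using (sum; *-distribˡ-sum; sum-remove; ∑-distrib-+; sum-replicate)
  open MonoidSums +-commutativeMonoid using (sum-cong)
  open CommutativeMonoidSum *-commutativeMonoid using () renaming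
    (sum to product; ∑-distrib-+ to product-distrib-*;
     sum-remove to product-remove; sum-replicate to product-replicate)
  open MonoidSums *-commutativeMonoid using () renaming (sum-cong to product-cong)
  open GroupProperties +-group using (∙-cancelˡ; ∙-cancelʳ; x∙y⁻¹≈ε⇒x≈y; inverseʳ-unique)
  open SetoidReasoning ≈-setoid

  el : Fin (suc n) → Carrier
  el = Inverse.from enumeration

  index : Carrier → Fin (suc n)
  index = Inverse.to enumeration

  el-index : ∀ x → el (index x) ≈ x
  el-index x = Inverse.inverseʳ enumeration ≡.refl

  index-el : ∀ i → index (el i) ≡ i
  index-el i = Inverse.inverseˡ enumeration refl

  index-cong : ∀ {x y} → x ≈ y → index x ≡ index y
  index-cong = Inverse.to-cong enumeration

  el-injective : ∀ {i j} → el i ≈ el j → i ≡ j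
  el-injective {i} {j} eq = ≡.trans (≡.sym (index-el i)) (≡.trans (index-cong eq) (index-el j))

  index-injective : ∀ {x y} → index x ≡ index y → x ≈ y
  index-injective {x} {y} eq =
    trans (sym (el-index x)) (trans (reflexive (≡.cong el eq)) (el-index y))

  infix 4 _≟_
  _≟_ : Binary.Decidable _≈_
  x ≟ y = map′ index-injective index-cong (index x Fin.≟ index y)

  *-cancelˡ-≉0 : ∀ x {y z} → x ≉ 0# → x * y ≈ x * z → y ≈ z
  *-cancelˡ-≉0 x {y} {z} x≉0 xy≈xz with x⁻¹ , x⁻¹x≈1 , _ ← invertible x≉0 = begin
    y               ≈⟨ trans (*-congʳ x⁻¹x≈1) (*-identityˡ y) ⟨
    x⁻¹ * x * y     ≈⟨ *-assoc x⁻¹ x y ⟩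
    x⁻¹ * (x * y)   ≈⟨ *-congˡ xy≈xz ⟩
    x⁻¹ * (x * z)   ≈⟨ *-assoc x⁻¹ x z ⟨
    x⁻¹ * x * z     ≈⟨ trans (*-congʳ x⁻¹x≈1) (*-identityˡ z) ⟩
    z               ∎

  x*y≈0⇒y≈0 : ∀ x {y} → x ≉ 0# → x * y ≈ 0# → y ≈ 0#
  x*y≈0⇒y≈0 x x≉0 xy≈0 = *-cancelˡ-≉0 x x≉0 (trans xy≈0 (sym (zeroʳ x)))

  ^-≉0 : ∀ {x} → x ≉ 0# → ∀ k → x ^ k ≉ 0#
  ^-≉0 x≉0 zero    1≈0 = 0≉1 (sym 1≈0)
  ^-≉0 x≉0 (suc k) eq  = ^-≉0 x≉0 k (x*y≈0⇒y≈0 _ x≉0 eq)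

  product-≉0 : ∀ {m} (f : Vector Carrier m) → (∀ i → f i ≉ 0#) → product f ≉ 0#
  product-≉0 {zero}  f f≉0 1≈0 = 0≉1 (sym 1≈0)
  product-≉0 {suc m} f f≉0 eq  = product-≉0 (tail f) (f≉0 ∘ suc) (x*y≈0⇒y≈0 _ (f≉0 zero) eq)

  product≈0⇒ : ∀ {m} (f : Vector Carrier m) → product f ≈ 0# → ∃ λ i → f i ≈ 0#
  product≈0⇒ f eq with Fin.any? (λ i → f i ≟ 0#)
  ... | yes found = found
  ... | no  none  = contradiction eq (product-≉0 f λ i fi≈0 → none (i , fi≈0))

  product-zero : ∀ {m} (f : Vector Carrier m) i → f i ≈ 0# → product f ≈ 0#
  product-zero {suc m} f i fi≈0 = trans (product-remove {i = i} f) (trans (*-congʳ fi≈0) (zeroˡ _))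

  module _ (φ : Carrier → Carrier) (φ-cong : ∀ {x y} → x ≈ y → φ x ≈ φ y)
           (φ-injective : Injective _≈_ _≈_ φ) where

    private
      π : Fin (suc n) → Fin (suc n)
      π i = index (φ (el i))

      π-injective : Injective _≡_ _≡_ π
      π-injective = el-injective ∘ φ-injective ∘ index-injective

    injective⇒Surjective : Surjective _≈_ _≈_ φ
    injective⇒Surjective y with i , πi≡y ← injective⇒surjective π-injective (index y) =
      el i , λ z≈el → trans (φ-cong z≈el) (index-injective πi≡y)

    module _ {m ℓm} (M : CommutativeMonoid m ℓm) where
      private
        module M = CommutativeMonoid M
        module S = CommutativeMonoidSum M

      -- The target monoid is arbitrary because the same reindexing is applied to products, for
      -- Fermat's identity, and to sums, for the power sums and the values of local permutation
      -- polynomials.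
      sum-reindex : (f : Carrier → M.Carrier) → (∀ {x y} → x ≈ y → f x M.≈ f y) →
                    S.sum (f ∘ el) M.≈ S.sum (f ∘ φ ∘ el)
      sum-reindex f f-cong =
        M.trans (S.sum-permute (f ∘ el) (⤖⇒↔ (mk⤖ (π-injective , surjective))))
                (MonoidSums.sum-cong M (λ i → f (el (π i))) (λ i → f (φ (el i))) λ i → f-cong (el-index (φ (el i))))
        where
        surjective : Surjective _≡_ _≡_ π
        surjective y with x , πx≡y ← injective⇒surjective π-injective y = x , λ { ≡.refl → πx≡y }

  -- A nonzero polynomial with `m` coefficients has fewer than `m` roots. The first root is divided
  -- out; the others remain roots of the quotient because their differences from it can be
  -- cancelled.
  roots⇒≈0 : ∀ {m} (c : Vector Carrier m) (ρ : Fin m → Carrier) → Injective _≡_ _≈_ ρ →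
             (∀ i → P c (ρ i) ≈ 0#) → ∀ i → c i ≈ 0#
  roots⇒≈0 {suc m} c ρ ρ-inj root = quot≈0⇒≈0 c r (root zero)
    (roots⇒≈0 (quot c r) (ρ ∘ suc) (Fin.suc-injective ∘ ρ-inj) λ i →
      x*y≈0⇒y≈0 (ρ (suc i) - r) (λ eq → contradiction (ρ-inj (x∙y⁻¹≈ε⇒x≈y _ _ eq)) λ ()) (begin
        (ρ (suc i) - r) * P (quot c r) (ρ (suc i))
          ≈⟨ *-congˡ (P-congʳ (quot c r) (r+[x-r] (ρ (suc i)))) ⟨
        (ρ (suc i) - r) * P (quot c r) (r + (ρ (suc i) - r))
          ≈⟨ trans (+-congʳ (root zero)) (+-identityˡ _) ⟨
        P c r + (ρ (suc i) - r) * P (quot c r) (r + (ρ (suc i) - r))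
          ≈⟨ P-quot c r (ρ (suc i) - r) ⟨
        P c (r + (ρ (suc i) - r))
          ≈⟨ P-congʳ c (r+[x-r] (ρ (suc i))) ⟩
        P c (ρ (suc i))
          ≈⟨ root (suc i) ⟩
        0# ∎))
    where
    r = ρ zero
    r+[x-r] : ∀ x → r + (x - r) ≈ x
    r+[x-r] x = trans (+-comm r _) (trans (+-assoc x _ r) (trans (+-congˡ (-‿inverseˡ r)) (+-identityʳ x)))

  vanishing⇒≈0 : ∀ {m} → m ≤ suc n → (c : Vector Carrier m) →
                 (∀ t → P c t ≈ 0#) → ∀ i → c i ≈ 0#
  vanishing⇒≈0 m≤q c P≈0 =
    roots⇒≈0 c (λ i → el (inject≤ i m≤q)) (Fin.inject≤-injective _ _ _ _ ∘ el-injective) λ i → P≈0 _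

  private
    z : Fin (suc n)
    z = index 0#

    nonzero : Fin n → Carrier
    nonzero j = el (punchIn z j)

    nonzero-injective : Injective _≡_ _≈_ nonzero
    nonzero-injective = Fin.punchIn-injective z _ _ ∘ el-injective

    nonzero-≉0 : ∀ j → nonzero j ≉ 0#
    nonzero-≉0 j eq = Fin.punchInᵢ≢i z j (≡.trans (≡.sym (index-el _)) (index-cong eq))

  -- Multiplication by `x` permutes the nonzero elements, so their product Π satisfies Π = x^(q-1)
  -- Π, and Π can be cancelled.
  x^[q-1]≈1 : ∀ {x} → x ≉ 0# → x ^ n ≈ 1#
  x^[q-1]≈1 {x} x≉0 = sym (*-cancelˡ-≉0 Π (product-≉0 (g ∘ el) λ i → g≉0 (el i)) (begin
    Π * 1#                    ≈⟨ *-identityʳ Π ⟩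
    Π                         ≈⟨ sum-reindex (x *_) *-congˡ (*-cancelˡ-≉0 x x≉0)
                                   *-commutativeMonoid g g-cong ⟩
    product (λ i → g (x * el i))
      ≈⟨ product-cong (λ i → g (x * el i)) (λ i → w (el i) * g (el i)) (λ i → g-* (el i)) ⟩
    product (λ i → w (el i) * g (el i))      ≈⟨ product-distrib-* (w ∘ el) (g ∘ el) ⟩
    product (w ∘ el) * Π      ≈⟨ *-congʳ Πw ⟩
    x ^ n * Π                 ≈⟨ *-comm _ _ ⟩
    Π * x ^ n                 ∎))
    where
    -- Reindexing runs over the whole field, zero included. Hence `g` replaces zero by 1 in the
    -- product, and `w` is the factor gained by an element under multiplication by `x`: `x` in
    -- general, but 1 at zero.
    g w : Carrier → Carrier
    g t with t ≟ 0#
    ... | yes _ = 1#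
    ... | no  _ = t
    w t with t ≟ 0#
    ... | yes _ = 1#
    ... | no  _ = x

    Π = product (g ∘ el)

    g-cong : ∀ {s t} → s ≈ t → g s ≈ g t
    g-cong {s} {t} s≈t with s ≟ 0# | t ≟ 0#
    ... | yes _   | yes _   = refl
    ... | no _    | no _    = s≈t
    ... | yes s≈0 | no  t≉0 = contradiction (trans (sym s≈t) s≈0) t≉0
    ... | no  s≉0 | yes t≈0 = contradiction (trans s≈t t≈0) s≉0

    g≉0 : ∀ t → g t ≉ 0#
    g≉0 t with t ≟ 0#
    ... | yes _   = 0≉1 ∘ sym
    ... | no  t≉0 = t≉0

    g-* : ∀ t → g (x * t) ≈ w t * g t
    g-* t with x * t ≟ 0# | t ≟ 0#
    ... | yes _    | yes _   = sym (*-identityˡ 1#)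
    ... | no _     | no _    = refl
    ... | yes xt≈0 | no  t≉0 = contradiction (x*y≈0⇒y≈0 x x≉0 xt≈0) t≉0
    ... | no xt≉0  | yes t≈0 = contradiction (trans (*-congˡ t≈0) (zeroʳ x)) xt≉0

    w-0 : ∀ {t} → t ≈ 0# → w t ≈ 1#
    w-0 {t} t≈0 with t ≟ 0#
    ... | yes _   = refl
    ... | no  t≉0 = contradiction t≈0 t≉0

    w-≉0 : ∀ {t} → t ≉ 0# → w t ≈ x
    w-≉0 {t} t≉0 with t ≟ 0#
    ... | yes t≈0 = contradiction t≈0 t≉0
    ... | no  _   = refl

    Πw : product (w ∘ el) ≈ x ^ n
    Πw = begin
      product (w ∘ el)                               ≈⟨ product-remove {i = z} (w ∘ el) ⟩
      w (el z) * product (removeAt (w ∘ el) z)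
        ≈⟨ *-cong (w-0 (el-index 0#)) (product-cong (removeAt (w ∘ el) z) (λ _ → x) λ j → w-≉0 (nonzero-≉0 j)) ⟩
      1# * product (Vector.replicate n x)            ≈⟨ trans (*-identityˡ _) (product-replicate n) ⟩
      x ^ n                                          ∎

  x^q≈x : ∀ x → x ^ suc n ≈ x
  x^q≈x x with x ≟ 0#
  ... | yes x≈0 = trans (*-congʳ x≈0) (trans (zeroˡ _) (sym x≈0))
  ... | no  x≉0 = trans (*-congˡ (x^[q-1]≈1 x≉0)) (*-identityʳ x)

  powerSum : ℕ → Carrier
  powerSum k = sum (λ i → el i ^ k)

  -- The translation t ↦ 1 + t permutes the field, so adding the sum of q ones to the sum of all
  -- elements leaves the latter unchanged.
  ∑1≈0 : powerSum 0 ≈ 0#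
  ∑1≈0 = ∙-cancelʳ (sum el) _ _ (begin
    powerSum 0 + sum el      ≈⟨ ∑-distrib-+ {suc n} (λ _ → 1#) el ⟨
    sum (λ i → 1# + el i)    ≈⟨ sum-reindex (1# +_) +-congˡ (λ {x} {y} → ∙-cancelˡ 1# x y) +-commutativeMonoid id id ⟨
    sum el                   ≈⟨ +-identityˡ _ ⟨
    0# + sum el              ∎)

  -- The homothety t ↦ x t permutes the field and multiplies every k-th power by x^k.
  powerSum-scale : ∀ k {x} → x ≉ 0# → x ^ k * powerSum k ≈ powerSum k
  powerSum-scale k {x} x≉0 = begin
    x ^ k * powerSum k            ≈⟨ *-distribˡ-sum (x ^ k) (λ i → el i ^ k) ⟩
    sum (λ i → x ^ k * el i ^ k)
      ≈⟨ sum-cong (λ i → (x * el i) ^ k) (λ i → x ^ k * el i ^ k) (λ i → ^-distrib-* x (el i) k) ⟨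
    sum (λ i → (x * el i) ^ k)
      ≈⟨ sum-reindex (x *_) *-congˡ (*-cancelˡ-≉0 x x≉0) +-commutativeMonoid (_^ k) (^-congˡ k) ⟨
    powerSum k                    ∎

  powerSum≈0 : ∀ k → k < n → powerSum k ≈ 0#
  powerSum≈0 zero    _   = ∑1≈0
  powerSum≈0 (suc k) k<n with powerSum (suc k) ≟ 0#
  ... | yes eq  = eq
  -- Otherwise every nonzero element would be a root of X^(k+1) - 1.
  ... | no  S≉0 = contradiction
    (roots⇒≈0 coefficients (λ i → nonzero (inject≤ i k<n))
      (Fin.inject≤-injective _ _ _ _ ∘ nonzero-injective) (λ i → root (nonzero-≉0 (inject≤ i k<n))) zero)
    (λ -1≈0 → 0≉1 (sym (trans (sym (trans (+-congʳ -1≈0) (+-identityˡ 1#))) (-‿inverseˡ 1#))))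
    where
    -- The polynomial X^(k+1) - 1 has k + 2 coefficients, and `k<n`, which unfolds to k + 2 ≤ n,
    -- provides that many distinct nonzero elements. The contradiction is read off at the constant
    -- coefficient.
    coefficients : Vector Carrier (suc (suc k))
    coefficients = (- 1#) Vector.∷ monic k

    root : ∀ {x} → x ≉ 0# → P coefficients x ≈ 0#
    root {x} x≉0 = begin
      P coefficients x         ≈⟨ P-suc coefficients x ⟩
      - 1# + x * P (monic k) x ≈⟨ +-congˡ (*-congˡ (P-monic k x)) ⟩
      - 1# + x ^ suc k         ≈⟨ +-congˡ x^k≈1 ⟩
      - 1# + 1#                ≈⟨ -‿inverseˡ 1# ⟩
      0#                       ∎
      where
      x^k≈1 : x ^ suc k ≈ 1#
      x^k≈1 = *-cancelˡ-≉0 _ S≉0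
        (trans (*-comm _ _) (trans (powerSum-scale (suc k) x≉0) (sym (*-identityʳ _))))

  -- Each of the q - 1 nonzero elements contributes 1 and zero contributes nothing, as the exponent
  -- is positive; one further 1 completes the sum of q ones, which is zero.
  powerSum≈-1 : 0 < n → powerSum n ≈ - 1#
  powerSum≈-1 0<n = inverseʳ-unique 1# (powerSum n) (begin
    1# + powerSum n
      ≈⟨ +-congˡ (trans (sum-remove {i = z} (λ i → el i ^ n))
                   (trans (+-cong (0^n 0<n) (sum-cong (λ j → nonzero j ^ n) (λ _ → 1#)
                                            λ j → x^[q-1]≈1 (nonzero-≉0 j)))
                          (+-identityˡ _))) ⟩
    1# + sum {n} (λ _ → 1#)   ≈⟨ ∑1≈0 ⟩
    0#                        ∎)
    where
    0^n : ∀ {k} → 0 < k → el z ^ k ≈ 0#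
    0^n {suc k} _ = trans (*-congʳ (el-index 0#)) (zeroˡ _)

-- Lagrange functions in one variable over an F_q-algebra

module Lagrange {n : ℕ} (0<n : 0 < n) {c ℓ a ℓa : Level} (𝔽 : FiniteField (suc n) c ℓ)
  (A : CommutativeRing a ℓa) (ι : FiniteField.Carrier 𝔽 → CommutativeRing.Carrier A)
  (ι-hom : IsRingHomomorphism (FiniteField.rawRing 𝔽) (CommutativeRing.rawRing A) ι) where
  open FiniteField 𝔽 using (Carrier; _≈_; 0#; 1#; -_; _^_; *-congˡ)
  open FiniteFieldProperties 𝔽
  private
    module A = CommutativeRing A
    module E = CommutativeSemiringExp A.commutativeSemiring
    module S = SemiringSum A.semiring
    module ι = IsRingHomomorphism ι-hom
    module FiniteFieldSum = SemiringSum (FiniteField.semiring 𝔽)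
    open MonoidSums A.+-commutativeMonoid using () renaming (sum-cong to A-sum-cong)
    module H = PolynomialFunctions A
  open SetoidReasoning A.setoid

  ι-^ : ∀ x k → ι (x ^ k) A.≈ ι x E.^ k
  ι-^ x zero    = ι.1#-homo
  ι-^ x (suc k) = A.trans (ι.*-homo x (x ^ k)) (A.*-congˡ (ι-^ x k))

  ι-sum : ∀ {m} (f : Vector Carrier m) → ι (FiniteFieldSum.sum f) A.≈ S.sum (ι ∘ f)
  ι-sum {zero}  f = ι.0#-homo
  ι-sum {suc m} f = A.trans (ι.+-homo _ _) (A.+-congˡ (ι-sum (tail f)))

  -- 1 - (x - a)^(q-1), with the power as a geometric sum so that no binomial theorem is needed.
  δ : Carrier → A.Carrier → A.Carrier
  δ a x = A.1# A.- H.h (suc n) (ι a) x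

  -- Summing the Horner form of `h` over all a turns each power of a into a power sum. Only exponent
  -- q - 1 survives, which belongs to the constant term in `x`, so the geometric sums add up to -1.
  -- The constants 1 add up to 0, and the difference is 1.
  ∑δ≈1 : ∀ x → S.sum (λ i → δ (el i) x) A.≈ A.1#
  ∑δ≈1 x = begin
    S.sum (λ i → δ (el i) x)                    ≈⟨ A.+-identityʳ _ ⟨
    S.sum (λ i → δ (el i) x) A.+ A.0#           ≈⟨ A.+-congˡ (A.-‿inverseʳ A.1#) ⟨
    S.sum (λ i → δ (el i) x) A.+ (A.1# A.- A.1#)           ≈⟨ A.+-congˡ (A.+-congˡ h-top) ⟨
    S.sum (λ i → δ (el i) x) A.+ (A.1# A.+ Σh (suc n))      ≈⟨ A.+-congˡ (A.+-comm _ _) ⟩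
    S.sum (λ i → δ (el i) x) A.+ (Σh (suc n) A.+ A.1#)      ≈⟨ A.+-assoc _ _ _ ⟨
    S.sum (λ i → δ (el i) x) A.+ Σh (suc n) A.+ A.1#
      ≈⟨ A.+-congʳ (S.∑-distrib-+ (λ i → δ (el i) x) (λ i → H.h (suc n) (ι (el i)) x)) ⟨
    S.sum (λ i → δ (el i) x A.+ H.h (suc n) (ι (el i)) x) A.+ A.1#
      ≈⟨ A.+-congʳ (A-sum-cong (λ i → δ (el i) x A.+ H.h (suc n) (ι (el i)) x) (λ i → ι (el i ^ 0))
           λ i → A.trans (A.+-assoc _ _ _)
           (A.trans (A.+-congˡ (A.-‿inverseˡ _)) (A.trans (A.+-identityʳ _) (A.sym ι.1#-homo)))) ⟩
    S.sum (λ i → ι (el i ^ 0)) A.+ A.1#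
      ≈⟨ A.+-congʳ (A.trans (A.sym (ι-sum (λ i → el i ^ 0))) (A.trans (ι.⟦⟧-cong ∑1≈0) ι.0#-homo)) ⟩
    A.0# A.+ A.1#                               ≈⟨ A.+-identityˡ _ ⟩
    A.1#                                        ∎
    where
    Σh : ℕ → A.Carrier
    Σh k = S.sum (λ i → H.h k (ι (el i)) x)

    Σh-suc : ∀ k → Σh (suc k) A.≈ ι (powerSum k) A.+ x A.* Σh k
    Σh-suc k = A.trans (S.∑-distrib-+ (λ i → ι (el i) E.^ k) (λ i → x A.* H.h k (ι (el i)) x))
      (A.+-cong (A.trans (A-sum-cong (λ i → ι (el i) E.^ k) (λ i → ι (el i ^ k)) λ i → A.sym (ι-^ (el i) k))
                         (A.sym (ι-sum (λ i → el i ^ k))))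
                (A.sym (S.*-distribˡ-sum x (λ i → H.h k (ι (el i)) x))))

    h-low : ∀ k → k ≤ n → Σh k A.≈ A.0#
    h-low zero    _   = S.sum-replicate-zero (suc n)
    h-low (suc k) k<n = A.trans (Σh-suc k) (A.trans
      (A.+-cong (A.trans (ι.⟦⟧-cong (powerSum≈0 k k<n)) ι.0#-homo)
                (A.trans (A.*-congˡ (h-low k (ℕ.<⇒≤ k<n))) (A.zeroʳ x)))
      (A.+-identityˡ _))

    h-top : Σh (suc n) A.≈ A.- A.1#
    h-top = A.trans (Σh-suc n) (A.trans
      (A.+-cong (A.trans (ι.⟦⟧-cong (powerSum≈-1 0<n)) (A.trans (ι.-‿homo 1#) (A.-‿cong ι.1#-homo)))
                (A.trans (A.*-congˡ (h-low n ℕ.≤-refl)) (A.zeroʳ x)))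
      (A.+-identityʳ _))

  -- Since x^q = x by hypothesis and a^q = a in the field, (x - a) h = x^q - a^q = x - a, that is,
  -- (x - a)(1 - h) = 0.
  x*δ≈ιa*δ : ∀ a {x} → x E.^ suc n A.≈ x → x A.* δ a x A.≈ ι a A.* δ a x
  x*δ≈ιa*δ a {x} x^q≈x′ = begin
    x A.* δ a x                     ≈⟨ x[y-z]≈xy-xz x A.1# _ ⟩
    x A.* A.1# A.- x A.* hq         ≈⟨ A.+-congʳ (A.*-identityʳ x) ⟩
    x A.- x A.* hq                  ≈⟨ exchange (begin
      x A.* hq A.+ ι a                ≈⟨ A.+-congˡ (A.trans (A.sym (ι.⟦⟧-cong (x^q≈x a))) (ι-^ a (suc n))) ⟩
      x A.* hq A.+ ι a E.^ suc n      ≈⟨ H.h-geometric (suc n) (ι a) x ⟩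
      ι a A.* hq A.+ x E.^ suc n      ≈⟨ A.+-congˡ x^q≈x′ ⟩
      ι a A.* hq A.+ x                ∎) ⟩
    ι a A.- ι a A.* hq              ≈⟨ A.+-congʳ (A.*-identityʳ (ι a)) ⟨
    ι a A.* A.1# A.- ι a A.* hq     ≈⟨ x[y-z]≈xy-xz (ι a) A.1# _ ⟨
    ι a A.* δ a x                   ∎
    where
    open RingProperties A.ring using (x[y-z]≈xy-xz)
    hq = H.h (suc n) (ι a) x

    exchange : ∀ {x y u v} → u A.+ y A.≈ v A.+ x → x A.- u A.≈ y A.- v
    exchange {x} {y} {u} {v} eq = GroupProperties.∙-cancelˡ A.+-group (v A.+ u) _ _ (begin
      v A.+ u A.+ (x A.- u)     ≈⟨ regroup x v u ⟩
      v A.+ x A.+ (u A.- u)     ≈⟨ A.trans (A.+-congˡ (A.-‿inverseʳ u)) (A.+-identityʳ _) ⟩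
      v A.+ x                   ≈⟨ eq ⟨
      u A.+ y                   ≈⟨ A.trans (A.+-congˡ (A.-‿inverseʳ v)) (A.+-identityʳ _) ⟨
      u A.+ y A.+ (v A.- v)     ≈⟨ regroup y u v ⟨
      u A.+ v A.+ (y A.- v)     ≈⟨ A.+-congʳ (A.+-comm u v) ⟩
      v A.+ u A.+ (y A.- v)     ∎)
      where
      open import Algebra.Properties.CommutativeSemigroup A.+-commutativeSemigroup using (interchange)
      regroup : ∀ x v u → v A.+ u A.+ (x A.- u) A.≈ v A.+ x A.+ (u A.- u)
      regroup x v u = interchange v u x (A.- u)

-- Ideals and quotient rings

module IdealProperties {c ℓ : Level} (R : CommutativeRing c ℓ) where
  open CommutativeRing R hiding (zero)
  open Ideals rawRing
  open SemiringSum semiring using (sum; *-distribˡ-sum)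
  open MonoidSums +-commutativeMonoid using (sum-cong)
  open RingProperties ring using (-1*x≈-x; -‿+-comm)
  open GroupProperties +-group using (⁻¹-involutive; x≈y⇒x∙y⁻¹≈ε)
  open CommutativeSemigroupProperties +-commutativeSemigroup using (interchange)

  record IsIdeal {s : Level} (I : Pred Carrier s) : Set (c ⊔ ℓ ⊔ s) where
    field
      resp     : ∀ {p p′} → p ≈ p′ → p ∈ I → p′ ∈ I
      0∈       : 0# ∈ I
      +-closed : ∀ {p p′} → p ∈ I → p′ ∈ I → p + p′ ∈ I
      *-closed : ∀ r {p} → p ∈ I → r * p ∈ I

    -‿closed : ∀ {p} → p ∈ I → - p ∈ I
    -‿closed {p} p∈I = resp (-1*x≈-x p) (*-closed (- 1#) p∈I)

  sum-split : ∀ k {l} (f : Vector Carrier (k ℕ.+ l)) →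
              sum f ≈ sum (f ∘ (_↑ˡ l)) + sum (f ∘ (k ↑ʳ_))
  sum-split zero    f = sym (+-identityˡ _)
  sum-split (suc k) f = trans (+-congˡ (sum-split k (tail f))) (sym (+-assoc _ _ _))

  ⟨⟩-isIdeal : ∀ {s} (S : Pred Carrier s) → IsIdeal ⟨ S ⟩
  ⟨⟩-isIdeal S = record
    { resp     = λ p≈p′ (k , r , g , g∈S , p≈) → k , r , g , g∈S , trans (sym p≈p′) p≈
    ; 0∈       = 0 , (λ ()) , (λ ()) , (λ ()) , refl
    ; +-closed = plus
    ; *-closed = λ a (k , r , g , g∈S , p≈) → k , (λ i → a * r i) , g , g∈S ,
        trans (*-congˡ p≈) (trans (*-distribˡ-sum a (λ i → r i * g i))
          (sum-cong (λ i → a * (r i * g i)) (λ i → a * r i * g i) λ i → sym (*-assoc _ _ _)))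
    }
    where
    plus : ∀ {p p′} → p ∈ ⟨ S ⟩ → p′ ∈ ⟨ S ⟩ → p + p′ ∈ ⟨ S ⟩
    plus (k , r , g , g∈S , p≈) (l , r′ , g′ , g′∈S , p′≈) =
      k ℕ.+ l , r Vector.++ r′ , g Vector.++ g′ , g++g′∈S ,
      trans (+-cong
        (trans p≈ (sum-cong (λ i → r i * g i) (λ i → ρ (i ↑ˡ l)) λ i →
          sym (reflexive (≡.cong₂ _*_ (left r r′ i) (left g g′ i)))))
        (trans p′≈ (sum-cong (λ i → r′ i * g′ i) (λ i → ρ (k ↑ʳ i)) λ i →
          sym (reflexive (≡.cong₂ _*_ (right r r′ i) (right g g′ i))))))
        (sym (sum-split k ρ))
      where
      ρ : Vector Carrier (k ℕ.+ l)
      ρ i = (r Vector.++ r′) i * (g Vector.++ g′) i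

      left : (u : Vector Carrier k) (v : Vector Carrier l) → ∀ i → (u Vector.++ v) (i ↑ˡ l) ≡ u i
      left u v i = ≡.cong Sum.[ u , v ] (Fin.splitAt-↑ˡ k i l)

      right : (u : Vector Carrier k) (v : Vector Carrier l) → ∀ i → (u Vector.++ v) (k ↑ʳ i) ≡ v i
      right u v i = ≡.cong Sum.[ u , v ] (Fin.splitAt-↑ʳ k l i)

      g++g′∈S : ∀ i → (g Vector.++ g′) i ∈ S
      g++g′∈S i with Data.Fin.Base.splitAt k i
      ... | inj₁ j = g∈S j
      ... | inj₂ j = g′∈S j

  ∈⟨⟩ : ∀ {s} {S : Pred Carrier s} p → p ∈ S → p ∈ ⟨ S ⟩
  ∈⟨⟩ p p∈S = 1 , (λ _ → 1#) , (λ _ → p) , (λ _ → p∈S) ,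
    sym (trans (+-identityʳ _) (*-identityˡ p))

  +ᴵ-isIdeal : ∀ {s t} {I : Pred Carrier s} {J : Pred Carrier t} →
               IsIdeal I → IsIdeal J → IsIdeal (I +ᴵ J)
  +ᴵ-isIdeal isI isJ = record
    { resp     = λ p≈p′ (a , b , a∈I , b∈J , p≈) → a , b , a∈I , b∈J , trans (sym p≈p′) p≈
    ; 0∈       = 0# , 0# , I.0∈ , J.0∈ , sym (+-identityˡ 0#)
    ; +-closed = λ (a , b , a∈I , b∈J , p≈) (a′ , b′ , a′∈I , b′∈J , p′≈) →
        a + a′ , b + b′ , I.+-closed a∈I a′∈I , J.+-closed b∈J b′∈J ,
        trans (+-cong p≈ p′≈) (interchange a b a′ b′)
    ; *-closed = λ r (a , b , a∈I , b∈J , p≈) →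
        r * a , r * b , I.*-closed r a∈I , J.*-closed r b∈J , trans (*-congˡ p≈) (distribˡ r a b)
    }
    where
    module I = IsIdeal isI
    module J = IsIdeal isJ

  +ᴵ-inˡ : ∀ {s t} {I : Pred Carrier s} {J : Pred Carrier t} →
           IsIdeal J → ∀ p → p ∈ I → p ∈ I +ᴵ J
  +ᴵ-inˡ isJ p p∈I = p , 0# , p∈I , IsIdeal.0∈ isJ , sym (+-identityʳ p)

  +ᴵ-inʳ : ∀ {s t} {I : Pred Carrier s} {J : Pred Carrier t} →
           IsIdeal I → ∀ p → p ∈ J → p ∈ I +ᴵ J
  +ᴵ-inʳ isI p p∈J = 0# , p , IsIdeal.0∈ isI , p∈J , sym (+-identityˡ p)

  module _ {s} {I : Pred Carrier s} (isIdeal : IsIdeal I) where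
    open IsIdeal isIdeal

    infix 4 _≈ᴵ_
    -- A record rather than a synonym for membership of the difference, so that both sides can be
    -- recovered from the type.
    record _≈ᴵ_ (x y : Carrier) : Set s where
      constructor mk≈ᴵ
      field difference : x - y ∈ I
    open _≈ᴵ_ public

    ≈⇒≈ᴵ : ∀ {x y} → x ≈ y → x ≈ᴵ y
    ≈⇒≈ᴵ x≈y = mk≈ᴵ (resp (sym (x≈y⇒x∙y⁻¹≈ε x≈y)) 0∈)

    quotientRing : CommutativeRing c s
    quotientRing = record
      { RawRing rawRing hiding (_≈_)
      ; _≈_ = _≈ᴵ_
      ; isCommutativeRing = record
        { isRing = record
          { +-isAbelianGroup = record
            { isGroup = record
              { isMonoid = record
                { isSemigroup = record
                  { isMagma = record
                    { isEquivalence = record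
                      { refl  = ≈⇒≈ᴵ refl
                      ; sym   = λ {x} {y} (mk≈ᴵ d) → mk≈ᴵ (resp (flip-difference x y) (-‿closed d))
                      ; trans = λ {x} {y} {z} (mk≈ᴵ d) (mk≈ᴵ e) →
                          mk≈ᴵ (resp (telescope x y z) (+-closed d e))
                      }
                    ; ∙-cong = λ {x} {x′} {y} {y′} (mk≈ᴵ d) (mk≈ᴵ e) →
                        mk≈ᴵ (resp (trans (interchange x (- x′) y (- y′)) (+-congˡ (-‿+-comm x′ y′)))
                                   (+-closed d e))
                    }
                  ; assoc = λ x y z → ≈⇒≈ᴵ (+-assoc x y z)
                  }
                ; identity = (λ x → ≈⇒≈ᴵ (+-identityˡ x)) , (λ x → ≈⇒≈ᴵ (+-identityʳ x))
                }
              ; inverse = (λ x → ≈⇒≈ᴵ (-‿inverseˡ x)) , (λ x → ≈⇒≈ᴵ (-‿inverseʳ x))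
              ; ⁻¹-cong = λ {x} {y} (mk≈ᴵ d) → mk≈ᴵ (resp (sym (-‿+-comm x (- y))) (-‿closed d))
              }
            ; comm = λ x y → ≈⇒≈ᴵ (+-comm x y)
            }
          ; *-cong = λ {x} {x′} {y} {y′} (mk≈ᴵ d) (mk≈ᴵ e) →
              mk≈ᴵ (resp (difference-* x x′ y y′) (+-closed (*-closed x e) (*-closed y′ d)))
          ; *-assoc = λ x y z → ≈⇒≈ᴵ (*-assoc x y z)
          ; *-identity = (λ x → ≈⇒≈ᴵ (*-identityˡ x)) , (λ x → ≈⇒≈ᴵ (*-identityʳ x))
          ; distrib = (λ x y z → ≈⇒≈ᴵ (distribˡ x y z)) , (λ x y z → ≈⇒≈ᴵ (distribʳ x y z))
          }
        ; *-comm = λ x y → ≈⇒≈ᴵ (*-comm x y)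
        }
      }
      where
      open SetoidReasoning setoid

      flip-difference : ∀ x y → - (x - y) ≈ y - x
      flip-difference x y = trans (sym (-‿+-comm x (- y))) (trans (+-congˡ (⁻¹-involutive y)) (+-comm (- x) y))

      telescope : ∀ x y z → (x - y) + (y - z) ≈ x - z
      telescope x y z = begin
        (x - y) + (y - z)     ≈⟨ +-assoc x (- y) (y - z) ⟩
        x + (- y + (y - z))   ≈⟨ +-congˡ (+-assoc (- y) y (- z)) ⟨
        x + (- y + y - z)     ≈⟨ +-congˡ (+-congʳ (-‿inverseˡ y)) ⟩
        x + (0# - z)          ≈⟨ +-congˡ (+-identityˡ (- z)) ⟩
        x - z                 ∎

      difference-* : ∀ x x′ y y′ → x * (y - y′) + y′ * (x - x′) ≈ x * y - x′ * y′
      difference-* x x′ y y′ = begin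
        x * (y - y′) + y′ * (x - x′)
          ≈⟨ +-cong (RingProperties.x[y-z]≈xy-xz ring x y y′) (RingProperties.x[y-z]≈xy-xz ring y′ x x′) ⟩
        (x * y - x * y′) + (y′ * x - y′ * x′)
          ≈⟨ +-congˡ (+-cong (*-comm y′ x) (-‿cong (*-comm y′ x′))) ⟩
        (x * y - x * y′) + (x * y′ - x′ * y′)
          ≈⟨ telescope (x * y) (x * y′) (x′ * y′) ⟩
        x * y - x′ * y′ ∎

-- A bijective numbering of a subset of a finite set. Applied to the points of V it provides the
-- index set of a basis, which a finite-dimensional space must carry as an initial segment of the
-- naturals.
record Listing {n p} (P : Pred (Fin n) p) : Set p where
  field
    size      : ℕ
    list      : Fin size → Fin n
    injective : Injective _≡_ _≡_ list
    sound     : ∀ j → list j ∈ P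
    position  : ∀ {i} → i ∈ P → Fin size
    list-position : ∀ {i} (i∈P : i ∈ P) → list (position i∈P) ≡ i

listing : ∀ {n p} (P : Pred (Fin n) p) → (∀ i → i ∈ P ⊎ ¬ (i ∈ P)) → Listing P
listing {zero}  P P? = record
  { size = 0 ; list = λ () ; injective = λ {} ; sound = λ ()
  ; position = λ { {()} } ; list-position = λ { {()} } }
listing {suc n} P P? with listing (P ∘ suc) (P? ∘ suc) | P? zero
... | L | inj₁ P0 = record
  { size      = suc L.size
  ; list      = list
  ; injective = injective _ _
  ; sound     = λ { zero → P0 ; (suc j) → L.sound j }
  ; position  = λ { {zero} _ → zero ; {suc i} i∈P → suc (L.position i∈P) }
  ; list-position = λ { {zero} _ → ≡.refl ; {suc i} i∈P → ≡.cong suc (L.list-position i∈P) }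
  }
  where
  module L = Listing L
  list : Fin (suc L.size) → Fin (suc n)
  list zero    = zero
  list (suc j) = suc (L.list j)
  injective : ∀ i j → list i ≡ list j → i ≡ j
  injective zero    zero    _  = ≡.refl
  injective (suc i) (suc j) eq = ≡.cong suc (L.injective (Fin.suc-injective eq))
... | L | inj₂ ¬P0 = record
  { size      = L.size
  ; list      = suc ∘ L.list
  ; injective = L.injective ∘ Fin.suc-injective
  ; sound     = L.sound
  ; position  = λ { {zero} P0 → contradiction P0 ¬P0 ; {suc i} i∈P → L.position i∈P }
  ; list-position = λ { {zero} P0 → contradiction P0 ¬P0 ; {suc i} i∈P → ≡.cong suc (L.list-position i∈P) }
  }
  where module L = Listing L

-- Lagrange functions in several variables

module LagrangePoints {n : ℕ} (0<n : 0 < n) {c ℓ a ℓa : Level} (𝔽 : FiniteField (suc n) c ℓ)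
  (A : CommutativeRing a ℓa) (ι : FiniteField.Carrier 𝔽 → CommutativeRing.Carrier A)
  (ι-hom : IsRingHomomorphism (FiniteField.rawRing 𝔽) (CommutativeRing.rawRing A) ι) where
  private
    module 𝔽 = FiniteField 𝔽
    module ι = IsRingHomomorphism ι-hom
  open FiniteFieldProperties 𝔽 using (el)
  open Lagrange 0<n 𝔽 A ι ι-hom
  open CommutativeRing A hiding (zero)
  open CommutativeSemiringExp commutativeSemiring using (_^_)
  open SemiringSum semiring using (sum; *-distribˡ-sum)
  open MonoidSums +-commutativeMonoid using (sum-all-ε)
  open CommutativeMonoidSum *-commutativeMonoid using () renaming (sum to product)
  open CommutativeMonoidSum 𝔽.*-commutativeMonoid using () renaming (sum to 𝔽-product)
  open MonoidSums *-commutativeMonoid using () renaming (∙-sum-cong to product-absorb)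
  open CommutativeSemigroupProperties *-commutativeSemigroup using (x∙yz≈y∙xz)
  open SetoidReasoning setoid

  Δ : ∀ {m} → Vector 𝔽.Carrier m → Vector Carrier m → Carrier
  Δ s ξ = product (λ i → δ (s i) (ξ i))

  -- The form in which the partition of unity by the Δ_s is applied. It is unfolded one coordinate
  -- at a time: `y` is the sum of the products y δ_a(ξ_0), and each of these is annihilated by every
  -- Δ in the remaining coordinates. The sum over all points is never formed.
  *Δ≈0⇒≈0 : ∀ {m} (ξ : Vector Carrier m) y → (∀ s → y * Δ s ξ ≈ 0#) → y ≈ 0#
  *Δ≈0⇒≈0 {zero}  ξ y yΔ≈0 = trans (sym (*-identityʳ y)) (yΔ≈0 λ ())
  *Δ≈0⇒≈0 {suc m} ξ y yΔ≈0 = begin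
    y                                        ≈⟨ *-identityʳ y ⟨
    y * 1#                                   ≈⟨ *-congˡ (∑δ≈1 (ξ zero)) ⟨
    y * sum (λ i → δ (el i) (ξ zero))        ≈⟨ *-distribˡ-sum y (λ i → δ (el i) (ξ zero)) ⟩
    sum (λ i → y * δ (el i) (ξ zero))
      ≈⟨ sum-all-ε (λ i → y * δ (el i) (ξ zero)) (λ i →
           *Δ≈0⇒≈0 (tail ξ) (y * δ (el i) (ξ zero)) λ s →
             trans (*-assoc y _ _) (yΔ≈0 (el i Vector.∷ s))) ⟩
    0#                                       ∎

  module _ {m} (ξ : Vector Carrier m) (ξ^q≈ξ : ∀ i → ξ i ^ suc n ≈ ξ i)
           (s : Vector 𝔽.Carrier m) where

    infix 4 _acts-as_
    -- `Δ s ξ` is a common eigenvector of all multiplications, and `b` is an eigenvalue for `y`.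
    -- Eigenvalues are compatible with sums and products, so it suffices to know them for constants
    -- and for the coordinates of `ξ`.
    _acts-as_ : Carrier → 𝔽.Carrier → Set ℓa
    y acts-as b = y * Δ s ξ ≈ ι b * Δ s ξ

    ξ-acts : ∀ i → ξ i acts-as s i
    ξ-acts i = product-absorb (λ i → δ (s i) (ξ i)) i (x*δ≈ιa*δ (s i) (ξ^q≈ξ i))

    +-acts : ∀ {x y a b} → x acts-as a → y acts-as b → x + y acts-as a 𝔽.+ b
    +-acts {x} {y} {a} {b} x∼a y∼b = begin
      (x + y) * Δ s ξ              ≈⟨ distribʳ (Δ s ξ) x y ⟩
      x * Δ s ξ + y * Δ s ξ        ≈⟨ +-cong x∼a y∼b ⟩
      ι a * Δ s ξ + ι b * Δ s ξ    ≈⟨ distribʳ (Δ s ξ) (ι a) (ι b) ⟨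
      (ι a + ι b) * Δ s ξ          ≈⟨ *-congʳ (ι.+-homo a b) ⟨
      ι (a 𝔽.+ b) * Δ s ξ          ∎

    *-acts : ∀ {x y a b} → x acts-as a → y acts-as b → x * y acts-as a 𝔽.* b
    *-acts {x} {y} {a} {b} x∼a y∼b = begin
      x * y * Δ s ξ                ≈⟨ *-assoc x y _ ⟩
      x * (y * Δ s ξ)              ≈⟨ *-congˡ y∼b ⟩
      x * (ι b * Δ s ξ)            ≈⟨ x∙yz≈y∙xz x (ι b) _ ⟩
      ι b * (x * Δ s ξ)            ≈⟨ *-congˡ x∼a ⟩
      ι b * (ι a * Δ s ξ)          ≈⟨ x∙yz≈y∙xz (ι b) (ι a) _ ⟩
      ι a * (ι b * Δ s ξ)          ≈⟨ *-assoc (ι a) (ι b) _ ⟨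
      ι a * ι b * Δ s ξ            ≈⟨ *-congʳ (ι.*-homo a b) ⟨
      ι (a 𝔽.* b) * Δ s ξ          ∎

    1-acts : 1# acts-as 𝔽.1#
    1-acts = *-congʳ (sym ι.1#-homo)

    ^-acts : ∀ {x a} k → x acts-as a → x ^ k acts-as a 𝔽.^ k
    ^-acts zero    x∼a = 1-acts
    ^-acts {x} {a} (suc k) x∼a = *-acts {x} {x ^ k} {a} {a 𝔽.^ k} x∼a (^-acts {x} {a} k x∼a)

    product-acts : ∀ {k} (x : Vector Carrier k) (a : Vector 𝔽.Carrier k) →
                   (∀ i → x i acts-as a i) → product x acts-as 𝔽-product a
    product-acts {zero}  x a x∼a = 1-acts
    product-acts {suc k} x a x∼a =
      *-acts {x zero} {product (tail x)} {a zero} {𝔽-product (tail a)}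
        (x∼a zero) (product-acts (tail x) (tail a) (x∼a ∘ suc))

-- Ideals that contain the field equations

module Nullstellensatz {n : ℕ} (0<n : 0 < n) {c ℓ : Level} (𝔽 : FiniteField (suc n) c ℓ) {m : ℕ} where
  open FiniteField 𝔽
  open FiniteFieldProperties 𝔽
  open Polynomials commutativeRing
  open PolynomialRing commutativeRing
  open Evaluation commutativeRing
  open SemiringSum semiring using (sum)
  open CommutativeSemiringExp commutativeSemiring using (^-congˡ)
  open MonoidSums +-commutativeMonoid using (sum-cong; sum-single)
  open MonoidSums *-commutativeMonoid using () renaming (sum-cong to product-cong; sum-all-ε to product-all-1)
  open CommutativeMonoidSum *-commutativeMonoid using () renaming (sum to product)
  open GroupProperties +-group using (x≈y⇒x∙y⁻¹≈ε)
  open Ideals (polyRing m) using (Radical)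
  open IdealProperties (polyCommutativeRing m)

  private
    module P = RawRing (polyRing m)
    module PR = CommutativeRing (polyCommutativeRing m)
    module PSum = CommutativeMonoidSum PR.*-commutativeMonoid
    module PS = RawSemiringDefinitions P.rawSemiring
    module PH = PolynomialFunctions (polyCommutativeRing m)
    module KH = PolynomialFunctions commutativeRing
    module KL = Lagrange 0<n 𝔽 commutativeRing id (Identity.isRingHomomorphism rawRing refl)

  Point : Set c
  Point = Vector Carrier m

  δ : Carrier → P.Carrier → P.Carrier
  δ a x = P.1# P.+ P.- PH.h (suc n) (C a) x

  Δ : Point → P.Carrier
  Δ s = PS.product (λ i → δ (s i) (var i))

  eval-h : ∀ s k a x → eval s (PH.h k (C a) x) ≈ KH.h k a (eval s x)
  eval-h s zero    a x = refl
  eval-h s (suc k) a x = trans (eval-+ s (C a PS.^ k) (x P.* PH.h k (C a) x))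
    (+-cong (trans (eval-^ s (C a) k) (^-congˡ k (eval-C s a)))
            (trans (eval-* s x (PH.h k (C a) x)) (*-congˡ (eval-h s k a x))))

  eval-δ : ∀ s a x → eval s (δ a x) ≈ KL.δ a (eval s x)
  eval-δ s a x = trans (eval-+ s P.1# (P.- PH.h (suc n) (C a) x))
    (+-cong (eval-C s 1#)
            (trans (eval-- s (PH.h (suc n) (C a) x)) (-‿cong (eval-h s (suc n) a x))))

  δ-cong : ∀ a {x y} → x ≈ y → KL.δ a x ≈ KL.δ a y
  δ-cong a {x} {y} x≈y = +-congˡ (-‿cong (h-cong (suc n)))
    where
    h-cong : ∀ k → KH.h k a x ≈ KH.h k a y
    h-cong zero    = refl
    h-cong (suc k) = +-congˡ (*-cong x≈y (h-cong k))

  -- From b δ_a(b) = a δ_a(b), a nonzero value δ_a(b) could be cancelled, giving b = a.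
  δ-≉ : ∀ {a b} → b ≉ a → KL.δ a b ≈ 0#
  δ-≉ {a} {b} b≉a with KL.δ a b ≟ 0#
  ... | yes eq  = eq
  ... | no  δ≉0 = contradiction
    (*-cancelˡ-≉0 _ δ≉0 (trans (*-comm _ b) (trans (KL.x*δ≈ιa*δ a (x^q≈x b)) (*-comm a _)))) b≉a

  -- The geometric sum is not computed: the values of all the δ at this element add up to 1, and all
  -- but one of them vanish.
  δ-≈ : ∀ i → KL.δ (el i) (el i) ≈ 1#
  δ-≈ i = trans (sym (sum-single (λ j → KL.δ (el j) (el i)) i
                  λ j j≢i → δ-≉ (λ eq → j≢i (≡.sym (el-injective eq)))))
                (KL.∑δ≈1 (el i))

  eval-Δ : ∀ s t → eval t (Δ s) ≈ product (λ i → KL.δ (s i) (t i))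
  eval-Δ s t = trans (eval-product t (λ i → δ (s i) (var i)))
    (product-cong (λ i → eval t (δ (s i) (var i))) (λ i → KL.δ (s i) (t i)) λ i →
      trans (eval-δ t (s i) (var i)) (δ-cong (s i) (eval-var t i)))

  eval-Δ-≉ : ∀ {s t} i → t i ≉ s i → eval t (Δ s) ≈ 0#
  eval-Δ-≉ {s} {t} i t≉s =
    trans (eval-Δ s t) (product-zero (λ i → KL.δ (s i) (t i)) i (δ-≉ t≉s))

  point : Fin (suc n ℕ.^ m) → Point
  point i k = el (finToFun i k)

  pointIndex : Point → Fin (suc n ℕ.^ m)
  pointIndex s = funToFin (index ∘ s)

  point-pointIndex : ∀ s k → point (pointIndex s) k ≈ s k
  point-pointIndex s k =
    trans (reflexive (≡.cong el (Fin.finToFun-funToFin (index ∘ s) k))) (el-index (s k))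

  eval-Δ-point : ∀ i → eval (point i) (Δ (point i)) ≈ 1#
  eval-Δ-point i = trans (eval-Δ (point i) (point i))
    (product-all-1 (λ k → KL.δ (point i k) (point i k)) λ k → δ-≈ (finToFun {suc n} {m} i k))

  eval-Δ-distinct : ∀ {i j} → i ≢ j → eval (point j) (Δ (point i)) ≈ 0#
  eval-Δ-distinct {i} {j} i≢j with Fin.all? (λ k → finToFun {suc n} {m} i k Fin.≟ finToFun j k)
  ... | yes same = contradiction
    (≡.trans (≡.sym (Fin.funToFin-finToFin {m} {suc n} i))
      (≡.trans (funToFin-cong same) (Fin.funToFin-finToFin {m} {suc n} j))) i≢j
    where
    funToFin-cong : ∀ {k} {f g : Fin k → Fin (suc n)} → (∀ i → f i ≡ g i) → funToFin f ≡ funToFin g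
    funToFin-cong {zero}  f≗g = ≡.refl
    funToFin-cong {suc k} f≗g = ≡.cong₂ Data.Fin.Base.combine (f≗g zero) (funToFin-cong (f≗g ∘ suc))
  ... | no  differ with k , ≢ ← Fin.¬∀⟶∃¬ m _ (λ k → finToFun {suc n} {m} i k Fin.≟ finToFun j k) differ =
    eval-Δ-≉ {point i} {point j} k λ eq → ≢ (≡.sym (el-injective eq))

  -- A constructive excluded middle for membership in the algebraic set. The negative case carries a
  -- polynomial with nonzero value, because that value must be inverted to place Δ_s in the ideal.
  Dichotomy : ∀ {s} → Pred P.Carrier s → Set (c ⊔ ℓ ⊔ s)
  Dichotomy S = ∀ s → s ∈ AlgebraicSet S ⊎ ∃ λ g → g ∈ S × eval s g ≉ 0#

  C-isRingHomomorphism : IsRingHomomorphism rawRing (polyRing m) C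
  C-isRingHomomorphism = record
    { isSemiringHomomorphism = record
      { isNearSemiringHomomorphism = record
        { +-isMonoidHomomorphism = record
          { isMagmaHomomorphism = record
            { isRelHomomorphism = record
              { cong = λ {a} {b} a≈b → ∫-ext (C a) (C b) λ f →
                  trans (∫-C a f) (trans (*-congʳ a≈b) (sym (∫-C b f))) }
            ; homo = λ a b → ∫-ext (C (a + b)) (C a P.+ C b) λ f →
                trans (∫-C (a + b) f) (trans (distribʳ _ a b)
                  (sym (trans (∫-++ (C a) (C b) f) (+-cong (∫-C a f) (∫-C b f)))))
            }
          ; ε-homo = ∫-ext (C 0#) [] λ f → trans (∫-C 0# f) (zeroˡ _)
          }
        ; *-homo = λ a b → ∫-ext (C (a * b)) (C a P.* C b) λ f →
            trans (∫-C (a * b) f) (trans (*-assoc a b _)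
              (sym (trans (∫-C* a (C b) f) (*-congˡ (∫-C b f)))))
        }
      ; 1#-homo = λ _ → refl
      }
    ; -‿homo = λ a _ → refl
    }

  module _ {s} {I : Pred P.Carrier s} (isIdeal : IsIdeal I)
           (fieldEquations : ∀ i → var i PS.^ suc n P.+ P.- var i ∈ I)
           (dichotomy : Dichotomy I) where
    open IsIdeal isIdeal

    private
      Q : CommutativeRing c s
      Q = quotientRing isIdeal
      module Q = CommutativeRing Q

      C-hom : IsRingHomomorphism rawRing Q.rawRing C
      C-hom = record
        { isSemiringHomomorphism = record
          { isNearSemiringHomomorphism = record
            { +-isMonoidHomomorphism = record
              { isMagmaHomomorphism = record
                { isRelHomomorphism = record { cong = ≈⇒≈ᴵ isIdeal ∘ C.⟦⟧-cong }
                ; homo = λ a b → ≈⇒≈ᴵ isIdeal (C.+-homo a b)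
                }
              ; ε-homo = ≈⇒≈ᴵ isIdeal C.0#-homo
              }
            ; *-homo = λ a b → ≈⇒≈ᴵ isIdeal (C.*-homo a b)
            }
          ; 1#-homo = ≈⇒≈ᴵ isIdeal C.1#-homo
          }
        ; -‿homo = λ a → ≈⇒≈ᴵ isIdeal (C.-‿homo a)
        }
        where module C = IsRingHomomorphism C-isRingHomomorphism

      module QL = LagrangePoints 0<n 𝔽 Q C C-hom

      ∈⇒≈0 : ∀ {p} → p ∈ I → p Q.≈ Q.0#
      ∈⇒≈0 {p} p∈I = mk≈ᴵ (resp {p} {p P.+ P.0#} (PR.sym {p P.+ P.0#} {p} (PR.+-identityʳ p)) p∈I)

      ≈0⇒∈ : ∀ {p} → p Q.≈ Q.0# → p ∈ I
      ≈0⇒∈ {p} eq = resp (PR.+-identityʳ p) (difference eq)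

      infixr 8 _Q^_
      _Q^_ : P.Carrier → ℕ → P.Carrier
      _Q^_ = RawSemiringDefinitions._^_ (RawRing.rawSemiring Q.rawRing)

      -- The powers taken in the ring and in its quotient agree, but not
      -- judgementally.
      Q^≡^ : ∀ p k → p Q^ k ≡ p PS.^ k
      Q^≡^ p zero    = ≡.refl
      Q^≡^ p (suc k) = ≡.cong (p P.*_) (Q^≡^ p k)

      var^q≈var : ∀ i → var i Q^ suc n Q.≈ var i
      var^q≈var i = Q.trans (Q.reflexive (Q^≡^ (var i) (suc n))) (mk≈ᴵ (fieldEquations i))

      Δᴵ : Point → P.Carrier
      Δᴵ s = QL.Δ s var

      _acts-as_at_ : P.Carrier → Carrier → Point → Set _
      p acts-as a at s = p P.* Δᴵ s Q.≈ C a P.* Δᴵ s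

      acts-as-value : ∀ s p → p acts-as eval s p at s
      acts-as-value s []            = Q.*-congʳ {Δᴵ s} {[]} {C 0#} (Q.sym (IsRingHomomorphism.0#-homo C-hom))
      acts-as-value s ((a , u) ∷ p) =
        Q.trans (Q.*-congʳ {Δᴵ s} (≈⇒≈ᴵ isIdeal {(a , u) ∷ p} {C a P.* M P.+ p} (∷-decompose a u p)))
          (QL.+-acts var var^q≈var s {C a P.* M} {p} {a * power s u} {eval s p}
            (QL.*-acts var var^q≈var s {C a} {M} {a} {power s u} Q.refl M-acts)
            (acts-as-value s p))
        where
        M = PS.product λ i → var i PS.^ Vec.lookup u i
        M-acts : M acts-as power s u at s
        M-acts = ≡.subst (_acts-as power s u at s)
          (PSum.sum-cong-≗ (λ i → Q^≡^ (var i) (Vec.lookup u i)))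
          (QL.product-acts var var^q≈var s (λ i → var i Q^ Vec.lookup u i) (λ i → s i ^ Vec.lookup u i)
            λ i → QL.^-acts var var^q≈var s {var i} {s i} (Vec.lookup u i) (QL.ξ-acts var var^q≈var s i))

    vanishing⇒∈ : ∀ p → (∀ s → s ∈ AlgebraicSet I → eval s p ≈ 0#) → p ∈ I
    vanishing⇒∈ p p-vanishes = ≈0⇒∈ (QL.*Δ≈0⇒≈0 var p λ s → Q.trans (acts-as-value s p) (kill s (dichotomy s)))
      where
      kill : ∀ s → s ∈ AlgebraicSet I ⊎ (∃ λ g → g ∈ I × eval s g ≉ 0#) →
             C (eval s p) P.* Δᴵ s Q.≈ Q.0#
      kill s (inj₁ s∈V) =
        Q.trans (Q.*-congʳ (Q.trans (IsRingHomomorphism.⟦⟧-cong C-hom (p-vanishes s s∈V))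
                                    (IsRingHomomorphism.0#-homo C-hom)))
                (Q.zeroˡ (Δᴵ s))
      -- With `b` the inverse of g(s), Δ_s = b g(s) Δ_s ≡ b g Δ_s, which lies in the ideal together
      -- with `g`.
      kill s (inj₂ (g , g∈I , gs≉0)) with b , bg≈1 , _ ← invertible gs≉0 =
        Q.trans (Q.*-congˡ {C (eval s p)} (begin
          Δᴵ s                               ≈⟨ Q.*-identityˡ (Δᴵ s) ⟨
          P.1# P.* Δᴵ s                      ≈⟨ Q.*-congʳ {Δᴵ s} (IsRingHomomorphism.⟦⟧-cong C-hom bg≈1) ⟨
          C (b * eval s g) P.* Δᴵ s          ≈⟨ Q.*-congʳ {Δᴵ s} (IsRingHomomorphism.*-homo C-hom b (eval s g)) ⟩
          C b P.* C (eval s g) P.* Δᴵ s      ≈⟨ Q.*-assoc (C b) (C (eval s g)) (Δᴵ s) ⟩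
          C b P.* (C (eval s g) P.* Δᴵ s)    ≈⟨ Q.*-congˡ {C b} (acts-as-value s g) ⟨
          C b P.* (g P.* Δᴵ s)               ≈⟨ Q.*-congˡ {C b} (Q.*-congʳ {Δᴵ s} (∈⇒≈0 g∈I)) ⟩
          C b P.* (P.0# P.* Δᴵ s)            ≈⟨ Q.zeroʳ (C b) ⟩
          Q.0#                              ∎))
          (Q.zeroʳ (C (eval s p)))
        where open SetoidReasoning Q.setoid

    radical : Radical I
    radical p k p^k∈I = vanishing⇒∈ p λ s s∈V → base s s∈V
      where
      base : ∀ s → s ∈ AlgebraicSet I → eval s p ≈ 0#
      base s s∈V with eval s p ≟ 0#
      ... | yes eq = eq
      ... | no  ps≉0 = contradiction (trans (sym (eval-^ s p k)) (s∈V (p PS.^ k) p^k∈I)) (^-≉0 ps≉0 k)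

    zeroDimensional : ZeroDimensional I
    zeroDimensional = L.size , basis , spans , independent
      where
      decide : ∀ i → point i ∈ AlgebraicSet I ⊎ ¬ (point i ∈ AlgebraicSet I)
      decide i with dichotomy (point i)
      ... | inj₁ i∈V               = inj₁ i∈V
      ... | inj₂ (g , g∈I , gi≉0) = inj₂ λ i∈V → gi≉0 (i∈V g g∈I)

      module L = Listing (listing (λ i → point i ∈ AlgebraicSet I) decide)

      basis : Vector P.Carrier L.size
      basis j = Δ (point (L.list j))

      eval-basis : ∀ (t : Vector Carrier L.size) j →
                   eval (point (L.list j)) (PS.sum λ i → C (t i) P.* basis i) ≈ t j
      eval-basis t j = trans (eval-sum x (λ i → C (t i) P.* basis i)) (trans
        (sum-single (λ i → eval x (C (t i) P.* basis i)) j λ i i≢j →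
          trans (eval-* x (C (t i)) (basis i))
            (trans (*-congˡ (eval-Δ-distinct (i≢j ∘ L.injective))) (zeroʳ _)))
        (trans (eval-* x (C (t j)) (basis j))
          (trans (*-cong (eval-C x (t j)) (eval-Δ-point (L.list j))) (*-identityʳ (t j)))))
        where x = point (L.list j)

      spans : ∀ v → Σ[ t ∈ Vector Carrier L.size ] v P.+ P.- PS.sum (λ i → C (t i) P.* basis i) ∈ I
      -- The coordinates of `v` are its values on V, so `v` minus its interpolant vanishes on V. An
      -- arbitrary point of V agrees only coordinatewise with an enumerated one, hence the transport
      -- of membership and of values.
      spans v = t , vanishing⇒∈ (v P.+ P.- Σ) λ s s∈V →
        let s∈V′ = λ p p∈I → trans (eval-congʳ (point-pointIndex s) p) (s∈V p p∈I)
            j    = L.position s∈V′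
            j≈s  = λ p → trans (reflexive (≡.cong (λ i → eval (point i) p) (L.list-position s∈V′)))
                               (eval-congʳ (point-pointIndex s) p)
        in trans (eval-+ s v (P.- Σ)) (trans (+-congˡ (eval-- s Σ))
             (x≈y⇒x∙y⁻¹≈ε (trans (sym (j≈s v)) (trans (sym (eval-basis t j)) (j≈s Σ)))))
        where
        t : Vector Carrier L.size
        t j = eval (point (L.list j)) v
        Σ = PS.sum (λ i → C (t i) P.* basis i)

      independent : ∀ (t : Vector Carrier L.size) →
                    PS.sum (λ i → C (t i) P.* basis i) P.+ P.- P.0# ∈ I → ∀ i → t i ≈ 0#
      independent t Σ∈I j = trans (sym (eval-basis t j))
        (trans (eval-congˡ _ Σ (Σ P.+ P.- P.0#) (PR.sym {Σ P.+ P.- P.0#} {Σ} (PR.+-identityʳ Σ)))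
               (L.sound j _ Σ∈I))
        where Σ = PS.sum (λ i → C (t i) P.* basis i)

-- Polynomials in x and y as coefficient matrices

module BivariatePolynomials {c ℓ : Level} (K : CommutativeRing c ℓ) where
  open CommutativeRing K hiding (zero)
  open Polynomials K
  open PolynomialRing K
  open Evaluation K
  open CommutativeSemiringExp commutativeSemiring using (_^_; ^-congˡ)
  open SemiringSum semiring using (sum; ∑-comm)
  open MonoidSums +-commutativeMonoid using (sum-cong; sum-single; sum-all-ε)
  open SetoidReasoning setoid

  private
    module P = RawRing (polyRing 2)
    module PS = RawSemiringDefinitions P.rawSemiring

  infix 5 _∙∙_
  _∙∙_ : ℕ → ℕ → Vec ℕ 2
  u ∙∙ v = u Vec.∷ v Vec.∷ Vec.[]

  pair : ∀ {a} {A : Set a} → A → A → Vector A 2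
  pair t a = t Vector.∷ a Vector.∷ Vector.[]

  X Y : Poly 2
  X = var zero
  Y = var (suc zero)

  -- The shape of `toPoly` with a square matrix of any size: size q - 1 for the points of the
  -- algebraic set, size q for a polynomial known only to have degree less than q in each variable.
  box : ∀ {k} → (Fin k → Fin k → Carrier) → Poly 2
  box c = PS.sum λ i → PS.sum λ j → C (c i j) P.* (X PS.^ toℕ i P.* Y PS.^ toℕ j)

  val : ∀ {k} → (Fin k → Fin k → Carrier) → Carrier → Carrier → Carrier
  val c t a = sum λ i → sum λ j → c i j * (t ^ toℕ i * a ^ toℕ j)

  sum₂-cong : ∀ {k l} (f g : Fin k → Fin l → Carrier) → (∀ i j → f i j ≈ g i j) →
              sum (λ i → sum (f i)) ≈ sum (λ i → sum (g i))
  sum₂-cong f g eq = sum-cong (λ i → sum (f i)) (λ i → sum (g i)) λ i → sum-cong (f i) (g i) (eq i)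

  val-cong : ∀ {k} (c : Fin k → Fin k → Carrier) {t t′ a a′} → t ≈ t′ → a ≈ a′ → val c t a ≈ val c t′ a′
  val-cong c t≈t′ a≈a′ = sum₂-cong
    (λ i j → c i j * (_ ^ toℕ i * _ ^ toℕ j)) (λ i j → c i j * (_ ^ toℕ i * _ ^ toℕ j))
    λ i j → *-congˡ (*-cong (^-congˡ (toℕ i) t≈t′) (^-congˡ (toℕ j) a≈a′))

  val-transpose : ∀ {k} (c : Fin k → Fin k → Carrier) t a → val (flip c) a t ≈ val c t a
  val-transpose c t a = trans (∑-comm (λ i j → c j i * (a ^ toℕ i * t ^ toℕ j)))
    (sum₂-cong (λ i j → c i j * (a ^ toℕ j * t ^ toℕ i)) (λ i j → c i j * (t ^ toℕ i * a ^ toℕ j))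
      λ i j → *-congˡ (*-comm _ _))

  X^-isMonomial : ∀ k → IsMonomial (X PS.^ k) (k ∙∙ 0)
  X^-isMonomial k f = trans (^-isMonomial {p = X} {𝟎 Vec.[ zero ]≔ 1} k (var-isMonomial zero) f)
    (reflexive (≡.cong f (≡.cong₂ _∙∙_ (ℕ.*-identityʳ k) (ℕ.*-zeroʳ k))))

  Y^-isMonomial : ∀ k → IsMonomial (Y PS.^ k) (0 ∙∙ k)
  Y^-isMonomial k f = trans (^-isMonomial {p = Y} {𝟎 Vec.[ suc zero ]≔ 1} k (var-isMonomial (suc zero)) f)
    (reflexive (≡.cong f (≡.cong₂ _∙∙_ (ℕ.*-zeroʳ k) (ℕ.*-identityʳ k))))

  X^*Y^-isMonomial : ∀ i j → IsMonomial (X PS.^ i P.* Y PS.^ j) (i ∙∙ j)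
  X^*Y^-isMonomial i j f = trans
    (*-isMonomial {p = X PS.^ i} {Y PS.^ j} {i ∙∙ 0} {0 ∙∙ j} (X^-isMonomial i) (Y^-isMonomial j) f)
    (reflexive (≡.cong (λ k → f (k ∙∙ j)) (ℕ.+-identityʳ i)))

  ∫-box : ∀ {k} (c : Fin k → Fin k → Carrier) f →
          ∫ (box c) f ≈ sum λ i → sum λ j → c i j * f (toℕ i ∙∙ toℕ j)
  ∫-box {k} c f = trans (∫-sum row f)
    (sum-cong (λ i → ∫ (row i) f) (λ i → sum λ j → c i j * f (toℕ i ∙∙ toℕ j)) λ i →
      trans (∫-sum (term i) f)
        (sum-cong (λ j → ∫ (term i j) f) (λ j → c i j * f (toℕ i ∙∙ toℕ j)) λ j →
          trans (∫-C* (c i j) (X PS.^ toℕ i P.* Y PS.^ toℕ j) f)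
                (*-congˡ (X^*Y^-isMonomial (toℕ i) (toℕ j) f))))
    where
    term : Fin k → Fin k → Poly 2
    term i j = C (c i j) P.* (X PS.^ toℕ i P.* Y PS.^ toℕ j)
    row : Fin k → Poly 2
    row i = PS.sum (term i)

  eval-box : ∀ {k} (c : Fin k → Fin k → Carrier) t a → eval (pair t a) (box c) ≈ val c t a
  eval-box c t a = trans (eval-∫ (pair t a) (box c)) (trans (∫-box c (power (pair t a)))
    (sum₂-cong (λ i j → c i j * power (pair t a) (toℕ i ∙∙ toℕ j)) (λ i j → c i j * (t ^ toℕ i * a ^ toℕ j))
      λ i j → *-congˡ (*-congˡ (*-identityʳ _))))

  indicator-≡ : ∀ {n} {u m : Vec ℕ n} → u ≡ m → indicator m u ≈ 1#
  indicator-≡ {u = u} {m} u≡m with Vec.≡-dec ℕ._≟_ u m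
  ... | yes _   = refl
  ... | no  u≢m = contradiction u≡m u≢m

  indicator-≢ : ∀ {n} {u m : Vec ℕ n} → u ≢ m → indicator m u ≈ 0#
  indicator-≢ {u = u} {m} u≢m with Vec.≡-dec ℕ._≟_ u m
  ... | yes u≡m = contradiction u≡m u≢m
  ... | no  _   = refl

  coeff-monomial-≢ : ∀ {n} (p : Poly n) {u m} → IsMonomial p u → u ≢ m → coeff p m ≈ 0#
  coeff-monomial-≢ p {u} {m} p∼u u≢m = trans (coeff-∫ p m) (trans (p∼u (indicator m)) (indicator-≢ u≢m))

  coeff-box-inside : ∀ {k} (c : Fin k → Fin k → Carrier) i j →
                     coeff (box c) (toℕ i ∙∙ toℕ j) ≈ c i j
  coeff-box-inside c i j = begin
    coeff (box c) m                                 ≈⟨ coeff-∫ (box c) m ⟩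
    ∫ (box c) (indicator m)                         ≈⟨ ∫-box c (indicator m) ⟩
    sum (λ i′ → sum (entry i′))
      ≈⟨ sum-single (λ i′ → sum (entry i′)) i (λ i′ i′≢i → sum-all-ε (entry i′) λ j′ →
           off i′ j′ (λ eq → i′≢i (Fin.toℕ-injective (Vec.∷-injectiveˡ eq)))) ⟩
    sum (entry i)
      ≈⟨ sum-single (entry i) j (λ j′ j′≢j →
           off i j′ (λ eq → j′≢j (Fin.toℕ-injective (Vec.∷-injectiveˡ (Vec.∷-injectiveʳ eq))))) ⟩
    c i j * indicator m m                           ≈⟨ *-congˡ (indicator-≡ {u = m} ≡.refl) ⟩
    c i j * 1#                                      ≈⟨ *-identityʳ _ ⟩
    c i j                                           ∎
    where
    m = toℕ i ∙∙ toℕ j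
    entry : ∀ i′ j′ → Carrier
    entry i′ j′ = c i′ j′ * indicator m (toℕ i′ ∙∙ toℕ j′)
    off : ∀ i′ j′ → toℕ i′ ∙∙ toℕ j′ ≢ m → entry i′ j′ ≈ 0#
    off i′ j′ ≢m = trans (*-congˡ (indicator-≢ ≢m)) (zeroʳ _)

  coeff-box-outside : ∀ {k} (c : Fin k → Fin k → Carrier) {u v} → k ≤ u ⊎ k ≤ v →
                      coeff (box c) (u ∙∙ v) ≈ 0#
  coeff-box-outside {k} c {u} {v} out =
    trans (coeff-∫ (box c) (u ∙∙ v)) (trans (∫-box c (indicator (u ∙∙ v)))
      (sum-all-ε (λ i → sum (λ j → c i j * indicator (u ∙∙ v) (toℕ i ∙∙ toℕ j))) λ i →
        sum-all-ε (λ j → c i j * indicator (u ∙∙ v) (toℕ i ∙∙ toℕ j)) λ j →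
          trans (*-congˡ (indicator-≢ (elsewhere i j out))) (zeroʳ _)))
    where
    elsewhere : ∀ i j → k ≤ u ⊎ k ≤ v → toℕ i ∙∙ toℕ j ≢ u ∙∙ v
    elsewhere i j (inj₁ k≤u) eq =
      ℕ.<⇒≱ (Fin.toℕ<n i) (ℕ.≤-trans k≤u (ℕ.≤-reflexive (≡.sym (Vec.∷-injectiveˡ eq))))
    elsewhere i j (inj₂ k≤v) eq =
      ℕ.<⇒≱ (Fin.toℕ<n j) (ℕ.≤-trans k≤v (ℕ.≤-reflexive (≡.sym (Vec.∷-injectiveˡ (Vec.∷-injectiveʳ eq)))))

  coeff-box : ∀ {k} (c : Fin k → Fin k → Carrier) {u v} (u<k : u < k) (v<k : v < k) →
              coeff (box c) (u ∙∙ v) ≈ c (fromℕ< u<k) (fromℕ< v<k)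
  coeff-box c u<k v<k = trans
    (reflexive (≡.cong (coeff (box c))
      (≡.cong₂ _∙∙_ (≡.sym (Fin.toℕ-fromℕ< u<k)) (≡.sym (Fin.toℕ-fromℕ< v<k)))))
    (coeff-box-inside c (fromℕ< u<k) (fromℕ< v<k))

  bounded⇒≈box : ∀ {k} (p : Poly 2) (c : Fin k → Fin k → Carrier) →
                 (∀ i j → coeff p (toℕ i ∙∙ toℕ j) ≈ c i j) →
                 (∀ u v → k ≤ u ⊎ k ≤ v → coeff p (u ∙∙ v) ≈ 0#) → p P.≈ box c
  bounded⇒≈box {k} p c inside outside (u Vec.∷ v Vec.∷ Vec.[]) with u ℕ.<? k | v ℕ.<? k
  ... | no u≮k  | _       = trans (outside u v (inj₁ (ℕ.≮⇒≥ u≮k))) (sym (coeff-box-outside c (inj₁ (ℕ.≮⇒≥ u≮k))))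
  ... | yes _   | no v≮k  = trans (outside u v (inj₂ (ℕ.≮⇒≥ v≮k))) (sym (coeff-box-outside c (inj₂ (ℕ.≮⇒≥ v≮k))))
  ... | yes u<k | yes v<k = trans
    (trans (reflexive (≡.cong (coeff p)
             (≡.cong₂ _∙∙_ (≡.sym (Fin.toℕ-fromℕ< u<k)) (≡.sym (Fin.toℕ-fromℕ< v<k)))))
           (inside (fromℕ< u<k) (fromℕ< v<k)))
    (sym (coeff-box c u<k v<k))

  -- Because 0^0 = 1 and higher powers of 0 vanish, putting y = 0 keeps exactly the monomials free
  -- of y. The last factor 1 is the empty tail of the product over the two variables.
  ∫-X^*0^ : ∀ k l f → ∫ (X PS.^ k P.* (P.0# PS.^ l P.* P.1#)) f ≈
            (if does (l ℕ.≟ 0) then f (k ∙∙ 0) else 0#)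
  ∫-X^*0^ k zero    f = trans
    (*-isMonomial {p = X PS.^ k} {P.1# P.* P.1#} {k ∙∙ 0} {𝟎 ⊕ 𝟎} (X^-isMonomial k)
      (*-isMonomial {p = P.1#} {P.1#} {𝟎} {𝟎} 1-isMonomial 1-isMonomial) f)
    (reflexive (≡.cong (λ i → f (i ∙∙ 0)) (ℕ.+-identityʳ k)))
  ∫-X^*0^ k (suc l) f = trans (∫-* (X PS.^ k) [] f) (∫-zeroʳ (X PS.^ k))

  ∫-0^*Y^ : ∀ k l f → ∫ (P.0# PS.^ k P.* (Y PS.^ l P.* P.1#)) f ≈
            (if does (k ℕ.≟ 0) then f (0 ∙∙ l) else 0#)
  ∫-0^*Y^ zero    l f = trans
    (*-isMonomial {p = P.1#} {Y PS.^ l P.* P.1#} {𝟎} {(0 ∙∙ l) ⊕ 𝟎} 1-isMonomial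
      (*-isMonomial {p = Y PS.^ l} {P.1#} {0 ∙∙ l} {𝟎} (Y^-isMonomial l) 1-isMonomial) f)
    (reflexive (≡.cong (λ i → f (0 ∙∙ i)) (ℕ.+-identityʳ l)))
  ∫-0^*Y^ (suc k) l f = refl

  coeff-subst-y≔0 : ∀ p k l → coeff (subst (pair X P.0#) p) (k ∙∙ l) ≈
                    (if does (l ℕ.≟ 0) then coeff p (k ∙∙ 0) else 0#)
  coeff-subst-y≔0 p k l = begin
    coeff (subst (pair X P.0#) p) (k ∙∙ l)      ≈⟨ coeff-∫ (subst (pair X P.0#) p) (k ∙∙ l) ⟩
    ∫ (subst (pair X P.0#) p) (indicator (k ∙∙ l))  ≈⟨ ∫-subst (pair X P.0#) p (indicator (k ∙∙ l)) ⟩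
    ∫ p (λ u → ∫ (PS.product λ i → pair X P.0# i PS.^ Vec.lookup u i) (indicator (k ∙∙ l)))
      ≈⟨ ∫-congʳ p (λ { (i Vec.∷ j Vec.∷ Vec.[]) → trans (∫-X^*0^ i j (indicator (k ∙∙ l))) (select l i j) }) ⟩
    ∫ p (λ u → if does (l ℕ.≟ 0) then indicator (k ∙∙ 0) u else 0#)   ≈⟨ collect l ⟩
    (if does (l ℕ.≟ 0) then coeff p (k ∙∙ 0) else 0#)                 ∎
    where
    -- The test for a zero y-exponent moves from the term to the monomial whose coefficient is
    -- sought, where it is constant along the formal sum.
    select : ∀ l i j → (if does (j ℕ.≟ 0) then indicator (k ∙∙ l) (i ∙∙ 0) else 0#) ≈
                     (if does (l ℕ.≟ 0) then indicator (k ∙∙ 0) (i ∙∙ j) else 0#)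
    select zero    i zero    = refl
    select zero    i (suc j) = sym (indicator-≢ {u = i ∙∙ suc j} {k ∙∙ 0} λ ())
    select (suc l) i zero    = indicator-≢ {u = i ∙∙ 0} {k ∙∙ suc l} λ ()
    select (suc l) i (suc j) = refl

    collect : ∀ l → ∫ p (λ u → if does (l ℕ.≟ 0) then indicator (k ∙∙ 0) u else 0#) ≈
              (if does (l ℕ.≟ 0) then coeff p (k ∙∙ 0) else 0#)
    collect zero    = sym (coeff-∫ p (k ∙∙ 0))
    collect (suc l) = ∫-zeroʳ p

  coeff-subst-x≔0 : ∀ p k l → coeff (subst (pair P.0# Y) p) (k ∙∙ l) ≈
                    (if does (k ℕ.≟ 0) then coeff p (0 ∙∙ l) else 0#)
  coeff-subst-x≔0 p k l = begin
    coeff (subst (pair P.0# Y) p) (k ∙∙ l)      ≈⟨ coeff-∫ (subst (pair P.0# Y) p) (k ∙∙ l) ⟩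
    ∫ (subst (pair P.0# Y) p) (indicator (k ∙∙ l))  ≈⟨ ∫-subst (pair P.0# Y) p (indicator (k ∙∙ l)) ⟩
    ∫ p (λ u → ∫ (PS.product λ i → pair P.0# Y i PS.^ Vec.lookup u i) (indicator (k ∙∙ l)))
      ≈⟨ ∫-congʳ p (λ { (i Vec.∷ j Vec.∷ Vec.[]) → trans (∫-0^*Y^ i j (indicator (k ∙∙ l))) (select k i j) }) ⟩
    ∫ p (λ u → if does (k ℕ.≟ 0) then indicator (0 ∙∙ l) u else 0#)   ≈⟨ collect k ⟩
    (if does (k ℕ.≟ 0) then coeff p (0 ∙∙ l) else 0#)                 ∎
    where
    select : ∀ k i j → (if does (i ℕ.≟ 0) then indicator (k ∙∙ l) (0 ∙∙ j) else 0#) ≈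
                     (if does (k ℕ.≟ 0) then indicator (0 ∙∙ l) (i ∙∙ j) else 0#)
    select zero    zero    j = refl
    select zero    (suc i) j = sym (indicator-≢ {u = suc i ∙∙ j} {0 ∙∙ l} λ ())
    select (suc k) zero    j = indicator-≢ {u = 0 ∙∙ j} {suc k ∙∙ l} λ ()
    select (suc k) (suc i) j = refl

    collect : ∀ k → ∫ p (λ u → if does (k ℕ.≟ 0) then indicator (0 ∙∙ l) u else 0#) ≈
              (if does (k ℕ.≟ 0) then coeff p (0 ∙∙ l) else 0#)
    collect zero    = sym (coeff-∫ p (0 ∙∙ l))
    collect (suc k) = ∫-zeroʳ p

-- Local permutation polynomials and the points that represent them

module LocalPermutationPolynomials {n : ℕ} (1<n : 1 < n) {c ℓ : Level} (𝔽 : FiniteField (suc n) c ℓ) where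
  open FiniteField 𝔽
  open FiniteFieldProperties 𝔽
  open PolynomialFunctions commutativeRing using (P)
  open Polynomials commutativeRing
  open Evaluation commutativeRing
  open BivariatePolynomials commutativeRing hiding (X; Y)
  open LocalPermutation 𝔽
  open CommutativeSemigroupProperties *-commutativeSemigroup using (x∙yz≈y∙xz)
  open SemiringSum semiring using (sum; ∑-comm; *-distribˡ-sum; *-distribʳ-sum)
  open MonoidSums +-commutativeMonoid using (sum-cong; sum-single)
  open RingProperties ring using (-1*x≈-x; -0#≈0#)
  open GroupProperties +-group using (⁻¹-injective)
  open SetoidReasoning ≈-setoid

  private
    module P₂ = RawRing (polyRing 2)
    module PR₂ = CommutativeRing (PolynomialRing.polyCommutativeRing commutativeRing 2)

  -- Summing the permutation t ↦ val c t a over all t gives ∑ t = 0 on one side and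
  -- minus the coefficient of x^(q-1) on the other.
  val-injective⇒top≈0 : (k : Fin (suc n) → Fin (suc n) → Carrier) →
                        (∀ a → Injective _≈_ _≈_ (λ t → val k t a)) → ∀ j → k (fromℕ n) j ≈ 0#
  -- The coefficient of x^(q-1) is a polynomial in `a` with q coefficients; vanishing at all q
  -- elements, it is zero coefficient by coefficient.
  val-injective⇒top≈0 k inj = vanishing⇒≈0 ℕ.≤-refl (k (fromℕ n)) λ a →
    ⁻¹-injective (begin
      - P (k (fromℕ n)) a         ≈⟨ total a ⟨
      sum (λ t → val k (el t) a)
        ≈⟨ sum-reindex (λ t → val k t a) (λ t≈t′ → val-cong k t≈t′ refl) (inj a) +-commutativeMonoid id id ⟨
      sum el                      ≈⟨ sum-cong el (λ i → el i ^ 1) (λ i → sym (*-identityʳ (el i))) ⟩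
      powerSum 1                  ≈⟨ powerSum≈0 1 1<n ⟩
      0#                          ≈⟨ -0#≈0# ⟨
      - 0#                        ∎)
    where
    total : ∀ a → sum (λ t → val k (el t) a) ≈ - P (k (fromℕ n)) a
    total a = begin
      sum (λ t → val k (el t) a)
        ≈⟨ sum₂-cong (λ t i → sum λ j → k i j * (el t ^ toℕ i * a ^ toℕ j))
                     (λ t i → el t ^ toℕ i * P (k i) a) (λ t i →
             trans (sum-cong (λ j → k i j * (el t ^ toℕ i * a ^ toℕ j))
                             (λ j → el t ^ toℕ i * (k i j * a ^ toℕ j))
                      λ j → x∙yz≈y∙xz (k i j) (el t ^ toℕ i) (a ^ toℕ j))
                   (sym (*-distribˡ-sum (el t ^ toℕ i) (λ j → k i j * a ^ toℕ j)))) ⟩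
      sum (λ t → sum λ i → el t ^ toℕ i * P (k i) a)   ≈⟨ ∑-comm (λ t i → el t ^ toℕ i * P (k i) a) ⟩
      sum (λ i → sum λ t → el t ^ toℕ i * P (k i) a)
        ≈⟨ sum-cong (λ i → sum λ t → el t ^ toℕ i * P (k i) a) (λ i → powerSum (toℕ i) * P (k i) a)
             (λ i → sym (*-distribʳ-sum (P (k i) a) (λ t → el t ^ toℕ i))) ⟩
      sum (λ i → powerSum (toℕ i) * P (k i) a)
        ≈⟨ sum-single (λ i → powerSum (toℕ i) * P (k i) a) (fromℕ n) (λ i i≢n →
             trans (*-congʳ (powerSum≈0 (toℕ i) (toℕ<n i i≢n))) (zeroˡ _)) ⟩
      powerSum (toℕ (fromℕ n)) * P (k (fromℕ n)) a
        ≈⟨ *-congʳ (trans (reflexive (≡.cong powerSum (Fin.toℕ-fromℕ n))) (powerSum≈-1 (ℕ.<⇒≤ 1<n))) ⟩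
      - 1# * P (k (fromℕ n)) a                         ≈⟨ -1*x≈-x _ ⟩
      - P (k (fromℕ n)) a                              ∎
      where
      toℕ<n : ∀ i → i ≢ fromℕ n → toℕ i < n
      toℕ<n i i≢n = ℕ.≤∧≢⇒< (Fin.toℕ≤pred[n] i)
        λ eq → i≢n (Fin.toℕ-injective (≡.trans eq (≡.sym (Fin.toℕ-fromℕ n))))

  degree⇒coeff≈0 : ∀ {f} → (∀ i → (DegreeIn i < suc n) f) →
                   ∀ u v → suc n ≤ u ⊎ suc n ≤ v → coeff f (u ∙∙ v) ≈ 0#
  degree⇒coeff≈0 {f} deg u v big with coeff f (u ∙∙ v) ≟ 0#
  ... | yes eq  = eq
  degree⇒coeff≈0 deg u v (inj₁ q≤u) | no ≉0 = contradiction q≤u (ℕ.<⇒≱ (deg zero (u ∙∙ v) ≉0))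
  degree⇒coeff≈0 deg u v (inj₂ q≤v) | no ≉0 = contradiction q≤v (ℕ.<⇒≱ (deg (suc zero) (u ∙∙ v) ≉0))

  -- Sharpens the bound on each degree from q - 1 to q - 2, the largest exponent for which a
  -- variable x_ij exists; without this `fromPoly` would lose coefficients. Exponents of y are
  -- treated by transposing the coefficient matrix.
  LP⇒coeff≈0 : ∀ {f} → f ∈ LP → ∀ u v → n ≤ u ⊎ n ≤ v → coeff f (u ∙∙ v) ≈ 0#
  LP⇒coeff≈0 {f} (deg , rows , cols) = vanish
    where
    k : Fin (suc n) → Fin (suc n) → Carrier
    k i j = coeff f (toℕ i ∙∙ toℕ j)

    val≈eval : ∀ t a → val k t a ≈ eval (pair t a) f
    val≈eval t a = trans (sym (eval-box k t a)) (eval-congˡ (pair t a) (box k) f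
      (PR₂.sym {f} {box k} (bounded⇒≈box f k (λ _ _ → refl) (degree⇒coeff≈0 {f} deg))))

    ≤-split : ∀ {u} {A : Set ℓ} → n ≤ u → (suc n ≤ u → A) → (u ≡ n → A) → A
    ≤-split n≤u above equal with ℕ.m≤n⇒m<n∨m≡n n≤u
    ... | inj₁ n<u = above n<u
    ... | inj₂ n≡u = equal (≡.sym n≡u)

    top : ∀ v → coeff f (n ∙∙ v) ≈ 0#
    top v with v ℕ.<? suc n
    ... | no  v≮q = degree⇒coeff≈0 {f} deg n v (inj₂ (ℕ.≮⇒≥ v≮q))
    ... | yes v<q = trans
      (reflexive (≡.cong (coeff f) (≡.cong₂ _∙∙_ (≡.sym (Fin.toℕ-fromℕ n)) (≡.sym (Fin.toℕ-fromℕ< v<q)))))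
      (val-injective⇒top≈0 k
        (λ a {x} {y} eq → proj₁ (rows a) (trans (sym (val≈eval x a)) (trans eq (val≈eval y a)))) (fromℕ< v<q))

    right : ∀ u → coeff f (u ∙∙ n) ≈ 0#
    right u with u ℕ.<? suc n
    ... | no  u≮q = degree⇒coeff≈0 {f} deg u n (inj₁ (ℕ.≮⇒≥ u≮q))
    ... | yes u<q = trans
      (reflexive (≡.cong (coeff f) (≡.cong₂ _∙∙_ (≡.sym (Fin.toℕ-fromℕ< u<q)) (≡.sym (Fin.toℕ-fromℕ n)))))
      (val-injective⇒top≈0 (flip k)
        (λ a {x} {y} eq → proj₁ (cols a) (trans (sym (flipped a x)) (trans eq (flipped a y)))) (fromℕ< u<q))
      where
      flipped : ∀ a x → val (flip k) x a ≈ eval (pair a x) f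
      flipped a x = trans (val-transpose k a x) (val≈eval a x)

    vanish : ∀ u v → n ≤ u ⊎ n ≤ v → coeff f (u ∙∙ v) ≈ 0#
    vanish u v (inj₁ n≤u) = ≤-split n≤u (λ q≤u → degree⇒coeff≈0 {f} deg u v (inj₁ q≤u)) λ { ≡.refl → top v }
    vanish u v (inj₂ n≤v) = ≤-split n≤v (λ q≤v → degree⇒coeff≈0 {f} deg u v (inj₂ q≤v)) λ { ≡.refl → right u }

  entries : Vector Carrier N → Fin n → Fin n → Carrier
  entries s i j = s ⟦ i , j ⟧

  value : Vector Carrier N → Carrier → Carrier → Carrier
  value s = val (entries s)

  eval-toPoly : ∀ s t a → eval (pair t a) (toPoly s) ≈ value s t a
  eval-toPoly s = eval-box (entries s)

  toPoly-cong : ∀ s s′ → (∀ k → s k ≈ s′ k) → toPoly s P₂.≈ toPoly s′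
  toPoly-cong s s′ s≈s′ = bounded⇒≈box (toPoly s) (entries s′)
    (λ i j → trans (coeff-box-inside (entries s) i j) (s≈s′ (combine i j)))
    (λ u v → coeff-box-outside (entries s))

  toPoly-injective : ∀ s s′ → toPoly s P₂.≈ toPoly s′ → ∀ k → s k ≈ s′ k
  toPoly-injective s s′ eq k = trans (reflexive (≡.cong s (≡.sym k≡)))
    (trans (sym (coeff-box-inside (entries s) i j)) (trans (eq (toℕ i ∙∙ toℕ j))
      (trans (coeff-box-inside (entries s′) i j) (reflexive (≡.cong s′ k≡)))))
    where
    i = proj₁ (remQuot {n} n k)
    j = proj₂ (remQuot {n} n k)
    k≡ : combine i j ≡ k
    k≡ = Fin.combine-remQuot {n} n k

  fromPoly : Poly 2 → Vector Carrier N
  fromPoly f k = coeff f (toℕ (proj₁ (remQuot {n} n k)) ∙∙ toℕ (proj₂ (remQuot {n} n k)))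

  entries-fromPoly : ∀ f i j → entries (fromPoly f) i j ≈ coeff f (toℕ i ∙∙ toℕ j)
  entries-fromPoly f i j = reflexive
    (≡.cong (λ (i , j) → coeff f (toℕ i ∙∙ toℕ j)) (Fin.remQuot-combine {n} i j))

  toPoly-fromPoly : ∀ {f} → f ∈ LP → f P₂.≈ toPoly (fromPoly f)
  toPoly-fromPoly {f} f∈LP = bounded⇒≈box f (entries (fromPoly f))
    (λ i j → sym (entries-fromPoly f i j)) (LP⇒coeff≈0 {f} f∈LP)

  -- Injectivity costs nothing, as `toPoly` is injective on the whole affine space. What remains is
  -- that `toPoly` maps V into T and that every element of T arises from the point of its
  -- coefficients.
  identified : ∀ {v t} {V : Pred (Vector Carrier N) v} {T : Pred (Poly 2) t} →
               (∀ {s} → s ∈ V → toPoly s ∈ T) →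
               (∀ {f} → f ∈ T → f P₂.≈ toPoly (fromPoly f) × fromPoly f ∈ V) →
               IdentifiedBytoPoly V T
  identified into onto = (λ {s} → into {s}) ,
    (λ { {s , _} {s′ , _} → toPoly-injective s s′ }) ,
    λ (f , f∈T) → (fromPoly f , proj₂ (onto {f} f∈T)) , λ { {s , _} s≈ →
      PR₂.trans {toPoly s} {toPoly (fromPoly f)} {f} (toPoly-cong s (fromPoly f) s≈)
        (PR₂.sym {f} {toPoly (fromPoly f)} (proj₁ (onto {f} f∈T))) }

  -- The meeting point of the two sides: conditions on a point that mention neither ideals nor
  -- degrees. As for `Grow`, the condition `row` fixes the first argument and varies the second.
  record IsReducedLatin (s : Vector Carrier N) : Set (c ⊔ ℓ) where
    field
      row : ∀ {a b} e → a ≉ b → value s e a ≉ value s e b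
      col : ∀ {a b} e → a ≉ b → value s a e ≉ value s b e
      s₀₀ : ∀ {i j} → toℕ i ≡ 0 → toℕ j ≡ 0 → entries s i j ≈ 0#
      s₁₀ : ∀ {i j} → toℕ i ≡ 1 → toℕ j ≡ 0 → entries s i j ≈ 1#
      s₀₁ : ∀ {i j} → toℕ i ≡ 0 → toℕ j ≡ 1 → entries s i j ≈ 1#
      s₀ᵢ : ∀ {z i} → toℕ z ≡ 0 → 2 ≤ toℕ i → entries s z i ≈ 0#
      sᵢ₀ : ∀ {z i} → toℕ z ≡ 0 → 2 ≤ toℕ i → entries s i z ≈ 0#

  coeff-toPoly-support : ∀ s u v → coeff (toPoly s) (u ∙∙ v) ≉ 0# → u < n × v < n
  coeff-toPoly-support s u v ≉0 with u ℕ.<? n | v ℕ.<? n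
  ... | yes u<n | yes v<n = u<n , v<n
  ... | no u≮n  | _       = contradiction (coeff-box-outside (entries s) (inj₁ (ℕ.≮⇒≥ u≮n))) ≉0
  ... | yes _   | no v≮n  = contradiction (coeff-box-outside (entries s) (inj₂ (ℕ.≮⇒≥ v≮n))) ≉0

  reducedLatin⇒RLP : ∀ {s} → IsReducedLatin s → toPoly s ∈ RLP
  reducedLatin⇒RLP {s} L = (degree , rows , cols) , x-axis , y-axis
    where
    open IsReducedLatin L
    f = toPoly s

    degree : ∀ i → (DegreeIn i < suc n) f
    degree zero       (u Vec.∷ v Vec.∷ Vec.[]) ≉0 = ℕ.m<n⇒m<1+n (proj₁ (coeff-toPoly-support s u v ≉0))
    degree (suc zero) (u Vec.∷ v Vec.∷ Vec.[]) ≉0 = ℕ.m<n⇒m<1+n (proj₂ (coeff-toPoly-support s u v ≉0))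

    injective⇒bijective : ∀ (φ : Carrier → Carrier) → (∀ {x y} → x ≈ y → φ x ≈ φ y) →
                          (∀ {x y} → x ≉ y → φ x ≉ φ y) → Bijective _≈_ _≈_ φ
    injective⇒bijective φ φ-cong φ-≉ = inj , injective⇒Surjective φ φ-cong inj
      where
      inj : Injective _≈_ _≈_ φ
      inj {x} {y} φx≈φy with x ≟ y
      ... | yes x≈y = x≈y
      ... | no  x≉y = contradiction φx≈φy (φ-≉ x≉y)

    rows : ∀ a → Bijective _≈_ _≈_ (λ t → eval (pair t a) f)
    rows a = injective⇒bijective _
      (λ {x} {y} x≈y → trans (eval-toPoly s x a)
        (trans (val-cong (entries s) x≈y refl) (sym (eval-toPoly s y a))))
      -- The names cross over: bijectivity of f(t,a) in t, with y fixed, rests on the column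
      -- condition, which varies the first argument.
      (λ {x} {y} x≉y eq → col a x≉y (trans (sym (eval-toPoly s x a)) (trans eq (eval-toPoly s y a))))

    cols : ∀ a → Bijective _≈_ _≈_ (λ t → eval (pair a t) f)
    cols a = injective⇒bijective _
      (λ {x} {y} x≈y → trans (eval-toPoly s a x)
        (trans (val-cong (entries s) refl x≈y) (sym (eval-toPoly s a y))))
      (λ {x} {y} x≉y eq → row a x≉y (trans (sym (eval-toPoly s a x)) (trans eq (eval-toPoly s a y))))

    0<n : 0 < n
    0<n = ℕ.<⇒≤ 1<n

    coeff≈ : ∀ {u v} (u<n : u < n) (v<n : v < n) {b} →
             (∀ {i j} → toℕ i ≡ u → toℕ j ≡ v → entries s i j ≈ b) → coeff f (u ∙∙ v) ≈ b
    coeff≈ u<n v<n entry = trans (coeff-box (entries s) u<n v<n) (entry (Fin.toℕ-fromℕ< u<n) (Fin.toℕ-fromℕ< v<n))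

    coeff-x : ∀ k → coeff f (k ∙∙ 0) ≈ coeff X (k ∙∙ 0)
    coeff-x 0 = trans (coeff≈ 0<n 0<n s₀₀) (sym (+-identityˡ _))
    coeff-x 1 = trans (coeff≈ 1<n 0<n s₁₀) (sym (+-identityʳ _))
    coeff-x k@(suc (suc k′)) with k ℕ.<? n
    ... | yes k<n = trans
      (coeff≈ k<n 0<n λ eq z → sᵢ₀ z (≡.subst (2 ≤_) (≡.sym eq) (s≤s (s≤s z≤n))))
      (sym (+-identityˡ _))
    ... | no  k≮n = trans (coeff-box-outside (entries s) (inj₁ (ℕ.≮⇒≥ k≮n))) (sym (+-identityˡ _))

    coeff-y : ∀ k → coeff f (0 ∙∙ k) ≈ coeff Y (0 ∙∙ k)
    coeff-y 0 = trans (coeff≈ 0<n 0<n s₀₀) (sym (+-identityˡ _))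
    coeff-y 1 = trans (coeff≈ 0<n 1<n s₀₁) (sym (+-identityʳ _))
    coeff-y k@(suc (suc k′)) with k ℕ.<? n
    ... | yes k<n = trans
      (coeff≈ 0<n k<n λ z eq → s₀ᵢ z (≡.subst (2 ≤_) (≡.sym eq) (s≤s (s≤s z≤n))))
      (sym (+-identityˡ _))
    ... | no  k≮n = trans (coeff-box-outside (entries s) (inj₂ (ℕ.≮⇒≥ k≮n))) (sym (+-identityˡ _))

    x-axis : subst (pair X P₂.0#) f P₂.≈ X
    x-axis (k Vec.∷ zero Vec.∷ Vec.[])  = trans (coeff-subst-y≔0 f k 0) (coeff-x k)
    x-axis (k Vec.∷ suc l Vec.∷ Vec.[]) = trans (coeff-subst-y≔0 f k (suc l))
      (sym (coeff-monomial-≢ X {1 ∙∙ 0} {k ∙∙ suc l} (var-isMonomial zero) λ ()))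

    y-axis : subst (pair P₂.0# Y) f P₂.≈ Y
    y-axis (zero Vec.∷ l Vec.∷ Vec.[])  = trans (coeff-subst-x≔0 f 0 l) (coeff-y l)
    y-axis (suc k Vec.∷ l Vec.∷ Vec.[]) = trans (coeff-subst-x≔0 f (suc k) l)
      (sym (coeff-monomial-≢ Y {0 ∙∙ 1} {suc k ∙∙ l} (var-isMonomial (suc zero)) λ ()))

  RLP⇒reducedLatin : ∀ {f} → f ∈ RLP → IsReducedLatin (fromPoly f)
  RLP⇒reducedLatin {f} (f∈LP@(_ , rows , cols) , x-axis , y-axis) = record
    { row = λ {a} {b} e a≉b eq → a≉b (proj₁ (cols e) (trans (eval≈ e a) (trans eq (sym (eval≈ e b)))))
    ; col = λ {a} {b} e a≉b eq → a≉b (proj₁ (rows e) (trans (eval≈ a e) (trans eq (sym (eval≈ b e)))))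
    ; s₀₀ = λ {i} {j} i≡0 j≡0 → trans (x-entry i j j≡0)
        (trans (reflexive (≡.cong (λ k → coeff X (k ∙∙ 0)) i≡0)) (+-identityˡ 0#))
    ; s₁₀ = λ {i} {j} i≡1 j≡0 → trans (x-entry i j j≡0)
        (trans (reflexive (≡.cong (λ k → coeff X (k ∙∙ 0)) i≡1)) (+-identityʳ 1#))
    ; s₀₁ = λ {i} {j} i≡0 j≡1 → trans (y-entry i j i≡0)
        (trans (reflexive (≡.cong (λ k → coeff Y (0 ∙∙ k)) j≡1)) (+-identityʳ 1#))
    ; s₀ᵢ = λ { {z} {i} z≡0 2≤i → trans (y-entry z i z≡0)
              (coeff-monomial-≢ Y {0 ∙∙ 1} {0 ∙∙ toℕ i} (var-isMonomial (suc zero))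
              λ eq → small 2≤i (Vec.∷-injectiveˡ (Vec.∷-injectiveʳ eq))) }
    ; sᵢ₀ = λ { {z} {i} z≡0 2≤i → trans (x-entry i z z≡0) (coeff-monomial-≢ X {1 ∙∙ 0} {toℕ i ∙∙ 0} (var-isMonomial zero)
              λ eq → small 2≤i (Vec.∷-injectiveˡ eq)) }
    }
    where
    s = fromPoly f

    small : ∀ {k} → 2 ≤ k → 1 ≢ k
    small (s≤s ()) ≡.refl

    eval≈ : ∀ t a → eval (pair t a) f ≈ value s t a
    eval≈ t a = trans (eval-congˡ (pair t a) f (toPoly s) (toPoly-fromPoly {f} f∈LP)) (eval-toPoly s t a)

    x-entry : ∀ i j → toℕ j ≡ 0 → entries s i j ≈ coeff X (toℕ i ∙∙ 0)
    x-entry i j j≡0 = trans (entries-fromPoly f i j)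
      (trans (reflexive (≡.cong (λ k → coeff f (toℕ i ∙∙ k)) j≡0))
        (trans (sym (coeff-subst-y≔0 f (toℕ i) 0)) (x-axis (toℕ i ∙∙ 0))))

    y-entry : ∀ i j → toℕ i ≡ 0 → entries s i j ≈ coeff Y (0 ∙∙ toℕ j)
    y-entry i j i≡0 = trans (entries-fromPoly f i j)
      (trans (reflexive (≡.cong (λ k → coeff f (k ∙∙ toℕ j)) i≡0))
        (trans (sym (coeff-subst-x≔0 f 0 (toℕ j))) (y-axis (0 ∙∙ toℕ j))))

  -- Total degree in terms of coefficients: the first half is what the generators `Above d` impose,
  -- the second half what `diagonal d` imposes.
  HasDegree : ℕ → Vector Carrier N → Set ℓ
  HasDegree d s = (∀ i j → d < toℕ i ℕ.+ toℕ j → entries s i j ≈ 0#)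
                × (∃₂ λ i j → toℕ i ℕ.+ toℕ j ≡ d × entries s i j ≉ 0#)

  hasDegree⇒TotalDegree : ∀ {d s} → HasDegree d s → toPoly s ∈ TotalDegree d
  hasDegree⇒TotalDegree {d} {s} (above , i , j , i+j≡d , sᵢⱼ≉0) =
    (toℕ i ∙∙ toℕ j , (λ eq → sᵢⱼ≉0 (trans (sym (coeff-box-inside (entries s) i j)) eq)) ,
      ≡.trans (≡.cong (toℕ i ℕ.+_) (ℕ.+-identityʳ (toℕ j))) i+j≡d) ,
    bound
    where
    bound : ∀ m → coeff (toPoly s) m ≉ 0# → Vec.sum m ≤ d
    bound (u Vec.∷ v Vec.∷ Vec.[]) ≉0 with u<n , v<n ← coeff-toPoly-support s u v ≉0 =
      ℕ.≮⇒≥ λ d<u+v → ≉0 (trans (coeff-box (entries s) u<n v<n)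
        (above (fromℕ< u<n) (fromℕ< v<n) (≡.subst (d <_)
          (≡.trans (≡.cong (u ℕ.+_) (ℕ.+-identityʳ v))
            (≡.sym (≡.cong₂ ℕ._+_ (Fin.toℕ-fromℕ< u<n) (Fin.toℕ-fromℕ< v<n)))) d<u+v)))

  -- Membership in `LP` keeps both exponents of the monomial of degree `d` below q - 1, so that this
  -- monomial belongs to one of the variables x_ij.
  TotalDegree⇒hasDegree : ∀ {d f} → f ∈ LP → f ∈ TotalDegree d → HasDegree d (fromPoly f)
  TotalDegree⇒hasDegree {d} {f} f∈LP ((u Vec.∷ v Vec.∷ Vec.[] , ≉0 , sum≡d) , bound) = above , attained
    where
    above : ∀ i j → d < toℕ i ℕ.+ toℕ j → entries (fromPoly f) i j ≈ 0#
    above i j d<i+j with coeff f (toℕ i ∙∙ toℕ j) ≟ 0#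
    ... | yes eq = trans (entries-fromPoly f i j) eq
    ... | no ≉0′ = contradiction
      (≡.subst (_≤ d) (≡.cong (toℕ i ℕ.+_) (ℕ.+-identityʳ (toℕ j))) (bound (toℕ i ∙∙ toℕ j) ≉0′))
      (ℕ.<⇒≱ d<i+j)

    attained : ∃₂ λ i j → toℕ i ℕ.+ toℕ j ≡ d × entries (fromPoly f) i j ≉ 0#
    attained with u<n , v<n ← coeff-toPoly-support (fromPoly f) u v
                                (λ eq → ≉0 (trans (toPoly-fromPoly {f} f∈LP (u ∙∙ v)) eq)) =
      fromℕ< u<n , fromℕ< v<n ,
      ≡.trans (≡.cong₂ ℕ._+_ (Fin.toℕ-fromℕ< u<n) (Fin.toℕ-fromℕ< v<n))
        (≡.trans (≡.cong (u ℕ.+_) (≡.sym (ℕ.+-identityʳ v))) sum≡d) ,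
      λ eq → ≉0 (trans (toPoly-fromPoly {f} f∈LP (u ∙∙ v))
                   (trans (coeff-box (entries (fromPoly f)) u<n v<n) eq))

-- Deciding whether a point is a common zero

module ZeroSets {n : ℕ} (0<n : 0 < n) {c ℓ : Level} (𝔽 : FiniteField (suc n) c ℓ) {m : ℕ} where
  open FiniteField 𝔽
  open FiniteFieldProperties 𝔽
  open Polynomials commutativeRing
  open PolynomialRing commutativeRing
  open Evaluation commutativeRing
  open SemiringSum semiring using (sum)
  open MonoidSums +-commutativeMonoid using (sum-all-ε)
  open Ideals (polyRing m) using (⟨_⟩; _+ᴵ_)
  open IdealProperties (polyCommutativeRing m)
  open Nullstellensatz 0<n 𝔽 {m} using (Dichotomy)

  private
    module P = RawRing (polyRing m)

  vanishes-⟨⟩ : ∀ {t} {S : Pred P.Carrier t} {s} → s ∈ AlgebraicSet S → s ∈ AlgebraicSet ⟨ S ⟩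
  vanishes-⟨⟩ {s = s} S≈0 p (k , r , g , g∈S , p≈) =
    trans (eval-congˡ s p (RawSemiringDefinitions.sum P.rawSemiring (λ i → r i P.* g i)) p≈)
      (trans (eval-sum s (λ i → r i P.* g i))
        (sum-all-ε (λ i → eval s (r i P.* g i)) λ i →
          trans (eval-* s (r i) (g i)) (trans (*-congˡ (S≈0 (g i) (g∈S i))) (zeroʳ _))))

  vanishes-+ᴵ : ∀ {t u} {I : Pred P.Carrier t} {J : Pred P.Carrier u} {s} →
                s ∈ AlgebraicSet I → s ∈ AlgebraicSet J → s ∈ AlgebraicSet (I +ᴵ J)
  vanishes-+ᴵ {s = s} I≈0 J≈0 p (a , b , a∈I , b∈J , p≈) =
    trans (eval-congˡ s p (a P.+ b) p≈)
      (trans (eval-+ s a b) (trans (+-cong (I≈0 a a∈I) (J≈0 b b∈J)) (+-identityˡ 0#)))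

  ⟨⟩-dichotomy : ∀ {t} {S : Pred P.Carrier t} → Dichotomy S → Dichotomy ⟨ S ⟩
  ⟨⟩-dichotomy {S = S} dich s with dich s
  ... | inj₁ S≈0               = inj₁ (vanishes-⟨⟩ {S = S} {s} S≈0)
  ... | inj₂ (g , g∈S , g≉0) = inj₂ (g , ∈⟨⟩ g g∈S , g≉0)

  +ᴵ-dichotomy : ∀ {t u} {I : Pred P.Carrier t} {J : Pred P.Carrier u} →
                 IsIdeal I → IsIdeal J → Dichotomy I → Dichotomy J → Dichotomy (I +ᴵ J)
  +ᴵ-dichotomy {I = I} {J} isI isJ dichI dichJ s with dichI s | dichJ s
  ... | inj₂ (g , g∈I , g≉0) | _                       = inj₂ (g , +ᴵ-inˡ isJ g g∈I , g≉0)
  ... | inj₁ _                | inj₂ (g , g∈J , g≉0) = inj₂ (g , +ᴵ-inʳ isI g g∈J , g≉0)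
  ... | inj₁ I≈0              | inj₁ J≈0              = inj₁ (vanishes-+ᴵ {I = I} {J} {s} I≈0 J≈0)

  -- Finiteness in the form in which it is consumed. It passes to products, so generators indexed by
  -- pairs or triples are searched without coding the indices into one number.
  Searchable : Set → Set (Level.suc ℓ)
  Searchable A = ∀ {P : Pred A ℓ} → Decidable P → Dec (∃ P)

  Fin-searchable : ∀ {k} → Searchable (Fin k)
  Fin-searchable = Fin.any?

  ×-searchable : ∀ {A B} → Searchable A → Searchable B → Searchable (A × B)
  ×-searchable A? B? P? = map′ (λ (a , b , p) → (a , b) , p) (λ ((a , b) , p) → a , b , p)
    (A? λ a → B? λ b → P? (a , b))

  -- Handles one constructor of a generating family at a time: `A` collects its indices and `cond`
  -- its side condition, so only genuine generators are tested. Decidable equality turns the failure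
  -- of the search into vanishing.
  family-dichotomy : ∀ {t} (S : Pred P.Carrier t) {A : Set} → Searchable A →
    {cond : A → Set} → Decidable cond → (g : A → P.Carrier) → (∀ a → cond a → g a ∈ S) →
    ∀ s → (∀ a → cond a → eval s (g a) ≈ 0#) ⊎ ∃ λ p → p ∈ S × eval s p ≉ 0#
  family-dichotomy S search {cond} cond? g g∈S s with search bad?
    where
    Bad : Pred _ ℓ
    Bad a = cond a × eval s (g a) ≉ 0#
    bad? : Decidable Bad
    bad? a = cond? a ×-dec ¬? (eval s (g a) ≟ 0#)
  ... | yes (a , cond-a , ≉0) = inj₂ (g a , g∈S a cond-a , ≉0)
  ... | no  none = inj₁ good
    where
    good : ∀ a → cond a → eval s (g a) ≈ 0#
    good a cond-a with eval s (g a) ≟ 0#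
    ... | yes eq = eq
    ... | no  ≉0 = contradiction (a , cond-a , ≉0) none

-- The ideals J_q and J_{q,d} and their zeros

module LatinIdeals {n : ℕ} (1<n : 1 < n) {c ℓ : Level} (𝔽 : FiniteField (suc n) c ℓ) where
  private
    0<n : 0 < n
    0<n = ℕ.<⇒≤ 1<n
  open FiniteField 𝔽
  open FiniteFieldProperties 𝔽
  open Polynomials commutativeRing
  open PolynomialRing commutativeRing
  open Evaluation commutativeRing
  open BivariatePolynomials commutativeRing using (val; val-cong; val-transpose; sum₂-cong)
  open LocalPermutation 𝔽
  open LocalPermutationPolynomials 1<n 𝔽
  open LPIdeals 𝔽
  open Ideals (polyRing N)
  open IdealProperties (polyCommutativeRing N)
  open Nullstellensatz 0<n 𝔽 {N} using (Dichotomy; radical; zeroDimensional)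
  open ZeroSets 0<n 𝔽 {N}
  open CommutativeSemigroupProperties +-commutativeSemigroup using (interchange)
  open CommutativeSemiringExp commutativeSemiring using (^-congˡ)
  open SemiringSum semiring using (sum)
  open MonoidSums +-commutativeMonoid using (sum-cong)
  open CommutativeMonoidSum *-commutativeMonoid using () renaming (sum to product)
  open GroupProperties +-group using (x∙y⁻¹≈ε⇒x≈y; x≈y⇒x∙y⁻¹≈ε)
  open RingProperties ring using (-‿+-comm; [y-z]x≈yx-zx)
  open SetoidReasoning ≈-setoid

  private
    module P = RawRing (polyRing N)
    module PS = RawSemiringDefinitions P.rawSemiring
    Point = Vector Carrier N

  -- `F` encodes an inequality as an equation. In this direction 0^(q-1) = 0 differs from 1, the
  -- exponent being positive; the converse is Fermat's identity.
  z^[q-1]-1≈0⇒z≉0 : ∀ {z} → z ^ n - 1# ≈ 0# → z ≉ 0#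
  z^[q-1]-1≈0⇒z≉0 {z} eq z≈0 =
    0≉1 (trans (sym (0^ n 0<n)) (trans (^-congˡ n (sym z≈0)) (x∙y⁻¹≈ε⇒x≈y _ _ eq)))
    where
    0^ : ∀ k → 0 < k → 0# ^ k ≈ 0#
    0^ (suc k) _ = zeroˡ _

  z≉0⇒z^[q-1]-1≈0 : ∀ {z} → z ≉ 0# → z ^ n - 1# ≈ 0#
  z≉0⇒z^[q-1]-1≈0 z≉0 = x≈y⇒x∙y⁻¹≈ε (x^[q-1]≈1 z≉0)

  eval-F : ∀ s p → eval s (F p) ≈ eval s p ^ n - 1#
  eval-F s p = trans (eval-+ s (p PS.^ n) (P.- P.1#)) (+-cong (eval-^ s p n)
    (trans (eval-- s P.1#) (-‿cong (eval-C s 1#))))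

  eval-x : ∀ s i j → eval s (x i j) ≈ entries s i j
  eval-x s i j = eval-var s (combine i j)

  sum-- : ∀ {k} (f g : Vector Carrier k) → sum (λ i → f i - g i) ≈ sum f - sum g
  sum-- {zero}  f g = sym (-‿inverseʳ 0#)
  sum-- {suc k} f g = trans (+-congˡ (sum-- (tail f) (tail g)))
    (trans (interchange _ _ _ _) (+-congˡ (-‿+-comm _ _)))

  -- The argument of `F` evaluates to f(a,e) - f(b,e), where f has coefficient matrix `k`. With `Z`
  -- and `k` left free, the transposed matrix serves for `Grow`.
  eval-weighted : ∀ s a b e (Z : Fin n → Fin n → P.Carrier) (k : Fin n → Fin n → Carrier) →
    (∀ i j → eval s (Z i j) ≈ k i j) →
    eval s (PS.sum λ i → PS.sum λ j → C (((a ^ toℕ i) - (b ^ toℕ i)) * (e ^ toℕ j)) P.* Z i j) ≈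
    val k a e - val k b e
  eval-weighted s a b e Z k Z≈k = begin
    eval s (PS.sum λ i → PS.sum λ j → term i j)            ≈⟨ eval-sum s (λ i → PS.sum (term i)) ⟩
    sum (λ i → eval s (PS.sum (term i)))
      ≈⟨ sum-cong (λ i → eval s (PS.sum (term i))) (λ i → sum λ j → eval s (term i j)) (λ i → eval-sum s (term i)) ⟩
    sum (λ i → sum λ j → eval s (term i j))
      ≈⟨ sum₂-cong (λ i j → eval s (term i j))
           (λ i j → k i j * (a ^ toℕ i * e ^ toℕ j) - k i j * (b ^ toℕ i * e ^ toℕ j)) entry ⟩
    sum (λ i → sum λ j → k i j * (a ^ toℕ i * e ^ toℕ j) - k i j * (b ^ toℕ i * e ^ toℕ j))
      ≈⟨ sum-cong (λ i → sum λ j → k i j * (a ^ toℕ i * e ^ toℕ j) - k i j * (b ^ toℕ i * e ^ toℕ j))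
           (λ i → (sum λ j → k i j * (a ^ toℕ i * e ^ toℕ j)) - (sum λ j → k i j * (b ^ toℕ i * e ^ toℕ j)))
           (λ i → sum-- (λ j → k i j * (a ^ toℕ i * e ^ toℕ j)) (λ j → k i j * (b ^ toℕ i * e ^ toℕ j))) ⟩
    sum (λ i → (sum λ j → k i j * (a ^ toℕ i * e ^ toℕ j)) - (sum λ j → k i j * (b ^ toℕ i * e ^ toℕ j)))
      ≈⟨ sum-- (λ i → sum λ j → k i j * (a ^ toℕ i * e ^ toℕ j)) (λ i → sum λ j → k i j * (b ^ toℕ i * e ^ toℕ j)) ⟩
    val k a e - val k b e                                  ∎
    where
    term : Fin n → Fin n → P.Carrier
    term i j = C (((a ^ toℕ i) - (b ^ toℕ i)) * (e ^ toℕ j)) P.* Z i j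

    entry : ∀ i j → eval s (term i j) ≈ k i j * (a ^ toℕ i * e ^ toℕ j) - k i j * (b ^ toℕ i * e ^ toℕ j)
    entry i j = begin
      eval s (term i j)            ≈⟨ eval-* s (C ((A - B) * E)) (Z i j) ⟩
      eval s (C ((A - B) * E)) * eval s (Z i j)  ≈⟨ *-cong (eval-C s _) (Z≈k i j) ⟩
      (A - B) * E * k i j          ≈⟨ *-comm _ _ ⟩
      k i j * ((A - B) * E)        ≈⟨ *-congˡ ([y-z]x≈yx-zx E A B) ⟩
      k i j * (A * E - B * E)      ≈⟨ RingProperties.x[y-z]≈xy-xz ring (k i j) (A * E) (B * E) ⟩
      k i j * (A * E) - k i j * (B * E)  ∎
      where
      A = a ^ toℕ i
      B = b ^ toℕ i
      E = e ^ toℕ j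

  eval-Grow : ∀ s a b e → eval s (Grow a b e) ≈ (value s e a - value s e b) ^ n - 1#
  eval-Grow s a b e = trans (eval-F s _) (+-congʳ (^-congˡ n
    (trans (eval-weighted s a b e (λ i j → x j i) (flip (entries s)) (λ i j → eval-x s j i))
      (+-cong (val-transpose (entries s) e a) (-‿cong (val-transpose (entries s) e b))))))

  eval-Gcol : ∀ s a b e → eval s (Gcol a b e) ≈ (value s a e - value s b e) ^ n - 1#
  eval-Gcol s a b e = trans (eval-F s _) (+-congʳ (^-congˡ n
    (eval-weighted s a b e x (entries s) (eval-x s))))

  Grow-zero⇒ : ∀ s a b e → eval s (Grow a b e) ≈ 0# → value s e a ≉ value s e b
  Grow-zero⇒ s a b e eq same =
    z^[q-1]-1≈0⇒z≉0 (trans (sym (eval-Grow s a b e)) eq) (x≈y⇒x∙y⁻¹≈ε same)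

  Gcol-zero⇒ : ∀ s a b e → eval s (Gcol a b e) ≈ 0# → value s a e ≉ value s b e
  Gcol-zero⇒ s a b e eq same =
    z^[q-1]-1≈0⇒z≉0 (trans (sym (eval-Gcol s a b e)) eq) (x≈y⇒x∙y⁻¹≈ε same)

  ⇒Grow-zero : ∀ s a b e → value s e a ≉ value s e b → eval s (Grow a b e) ≈ 0#
  ⇒Grow-zero s a b e differ = trans (eval-Grow s a b e)
    (z≉0⇒z^[q-1]-1≈0 (differ ∘ x∙y⁻¹≈ε⇒x≈y _ _))

  ⇒Gcol-zero : ∀ s a b e → value s a e ≉ value s b e → eval s (Gcol a b e) ≈ 0#
  ⇒Gcol-zero s a b e differ = trans (eval-Gcol s a b e)
    (z≉0⇒z^[q-1]-1≈0 (differ ∘ x∙y⁻¹≈ε⇒x≈y _ _))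

  -- The generators range over the carrier, where an element may have many representatives, but only
  -- the representatives `el i` are searched. The remaining generators are reached through their
  -- meaning, that two values differ, which respects the equality of the field.
  Latin-dichotomy : Dichotomy Latin
  Latin-dichotomy s with
      family-dichotomy Latin search distinct? (λ (i , j , k) → Grow (el i) (el j) (el k))
        (λ (i , j , k) i≢j → row (el k) (i≢j ∘ el-injective)) s
    | family-dichotomy Latin search distinct? (λ (i , j , k) → Gcol (el i) (el j) (el k))
        (λ (i , j , k) i≢j → col (el k) (i≢j ∘ el-injective)) s
    where
    search : Searchable (Fin (suc n) × Fin (suc n) × Fin (suc n))
    search = ×-searchable Fin-searchable (×-searchable Fin-searchable Fin-searchable)
    distinct? : Decidable (λ ((i , j , k) : Fin (suc n) × Fin (suc n) × Fin (suc n)) → i ≢ j)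
    distinct? (i , j , k) = ¬? (i Fin.≟ j)
  ... | inj₂ found | _          = inj₂ found
  ... | inj₁ _     | inj₂ found = inj₂ found
  ... | inj₁ rows  | inj₁ cols  = inj₁ vanishes
    where
    value-index : ∀ t a → value s t a ≈ value s (el (index t)) (el (index a))
    value-index t a = val-cong (entries s) (sym (el-index t)) (sym (el-index a))

    vanishes : s ∈ AlgebraicSet Latin
    vanishes _ (row {a} {b} e a≉b) = ⇒Grow-zero s a b e λ same →
      Grow-zero⇒ s (el (index a)) (el (index b)) (el (index e))
        (rows (index a , index b , index e) (a≉b ∘ index-injective))
        (trans (sym (value-index e a)) (trans same (value-index e b)))
    vanishes _ (col {a} {b} e a≉b) = ⇒Gcol-zero s a b e λ same →
      Gcol-zero⇒ s (el (index a)) (el (index b)) (el (index e))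
        (cols (index a , index b , index e) (a≉b ∘ index-injective))
        (trans (sym (value-index a e)) (trans same (value-index b e)))

  fieldEquation-vanishes : ∀ s → s ∈ AlgebraicSet FieldEquation
  fieldEquation-vanishes s _ (fieldEq i j) = begin
    eval s (x i j PS.^ suc n P.+ P.- x i j)      ≈⟨ eval-+ s (x i j PS.^ suc n) (P.- x i j) ⟩
    eval s (x i j PS.^ suc n) + eval s (P.- x i j)
      ≈⟨ +-cong (eval-^ s (x i j) (suc n)) (eval-- s (x i j)) ⟩
    eval s (x i j) ^ suc n - eval s (x i j)      ≈⟨ x≈y⇒x∙y⁻¹≈ε (x^q≈x _) ⟩
    0#                                           ∎

  private
    indices : Searchable (Fin n × Fin n)
    indices = ×-searchable Fin-searchable Fin-searchable

  Initial-dichotomy : Dichotomy Initial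
  Initial-dichotomy s with
      family-dichotomy Initial indices (λ (i , j) → (toℕ i ℕ.≟ 0) ×-dec (toℕ j ℕ.≟ 0))
        (λ (i , j) → x i j) (λ _ (i≡ , j≡) → x₀₀ i≡ j≡) s
    | family-dichotomy Initial indices (λ (i , j) → (toℕ i ℕ.≟ 1) ×-dec (toℕ j ℕ.≟ 0))
        (λ (i , j) → x i j P.+ P.- P.1#) (λ _ (i≡ , j≡) → x₁₀-1 i≡ j≡) s
    | family-dichotomy Initial indices (λ (i , j) → (toℕ i ℕ.≟ 0) ×-dec (toℕ j ℕ.≟ 1))
        (λ (i , j) → x i j P.+ P.- P.1#) (λ _ (i≡ , j≡) → x₀₁-1 i≡ j≡) s
  ... | inj₂ found | _ | _ = inj₂ found
  ... | inj₁ _ | inj₂ found | _ = inj₂ found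
  ... | inj₁ _ | inj₁ _ | inj₂ found = inj₂ found
  ... | inj₁ h₀₀ | inj₁ h₁₀ | inj₁ h₀₁ = inj₁ λ where
    _ (x₀₀   i≡ j≡) → h₀₀ _ (i≡ , j≡)
    _ (x₁₀-1 i≡ j≡) → h₁₀ _ (i≡ , j≡)
    _ (x₀₁-1 i≡ j≡) → h₀₁ _ (i≡ , j≡)

  Border-dichotomy : Dichotomy Border
  Border-dichotomy s with
      family-dichotomy Border indices (λ (z , i) → (toℕ z ℕ.≟ 0) ×-dec (2 ℕ.≤? toℕ i))
        (λ (z , i) → x z i) (λ _ (z≡ , 2≤i) → x₀ᵢ z≡ 2≤i) s
    | family-dichotomy Border indices (λ (z , i) → (toℕ z ℕ.≟ 0) ×-dec (2 ℕ.≤? toℕ i))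
        (λ (z , i) → x i z) (λ _ (z≡ , 2≤i) → xᵢ₀ z≡ 2≤i) s
  ... | inj₂ found | _ = inj₂ found
  ... | inj₁ _ | inj₂ found = inj₂ found
  ... | inj₁ h₀ᵢ | inj₁ hᵢ₀ = inj₁ λ where
    _ (x₀ᵢ z≡ 2≤i) → h₀ᵢ _ (z≡ , 2≤i)
    _ (xᵢ₀ z≡ 2≤i) → hᵢ₀ _ (z≡ , 2≤i)

  Above-dichotomy : ∀ d → Dichotomy (Above d)
  Above-dichotomy d s with
      family-dichotomy (Above d) indices (λ (i , j) → d ℕ.<? toℕ i ℕ.+ toℕ j)
        (λ (i , j) → x i j) (λ (i , j) d< → above i j d<) s
  ... | inj₂ found = inj₂ found
  ... | inj₁ h = inj₁ λ { _ (above i j d<) → h (i , j) d< }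

  singleton-dichotomy : ∀ p → Dichotomy ｛ p ｝
  singleton-dichotomy p s with eval s p ≟ 0#
  ... | yes eq = inj₁ λ { _ ≡.refl → eq }
  ... | no ≉0  = inj₂ (p , ≡.refl , ≉0)


  𝒥-isIdeal : IsIdeal 𝒥
  𝒥-isIdeal = +ᴵ-isIdeal (⟨⟩-isIdeal Latin) (⟨⟩-isIdeal FieldEquation)

  𝒥-dichotomy : Dichotomy 𝒥
  𝒥-dichotomy = +ᴵ-dichotomy (⟨⟩-isIdeal Latin) (⟨⟩-isIdeal FieldEquation)
    (⟨⟩-dichotomy Latin-dichotomy)
    (⟨⟩-dichotomy λ s → inj₁ (fieldEquation-vanishes s))

  fieldEquations∈𝒥 : ∀ k → var k PS.^ suc n P.+ P.- var k ∈ 𝒥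
  fieldEquations∈𝒥 k = +ᴵ-inʳ (⟨⟩-isIdeal Latin) p (∈⟨⟩ {S = FieldEquation} p
    (≡.subst (λ k → FieldEquation (var k PS.^ suc n P.+ P.- var k)) (Fin.combine-remQuot {n} n k)
      (fieldEq (proj₁ (remQuot {n} n k)) (proj₂ (remQuot {n} n k)))))
    where p = var k PS.^ suc n P.+ P.- var k

  module _ (d : ℕ) where

    𝒥ᵃ : Pred P.Carrier (c ⊔ ℓ)
    𝒥ᵃ = 𝒥 +ᴵ ⟨ Above d ⟩

    𝒥ᵃ-isIdeal : IsIdeal 𝒥ᵃ
    𝒥ᵃ-isIdeal = +ᴵ-isIdeal 𝒥-isIdeal (⟨⟩-isIdeal (Above d))

    𝒥[d]-isIdeal : IsIdeal 𝒥[ d ]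
    𝒥[d]-isIdeal = +ᴵ-isIdeal 𝒥ᵃ-isIdeal (⟨⟩-isIdeal ｛ diagonal d ｝)

    𝒥[d]-dichotomy : Dichotomy 𝒥[ d ]
    𝒥[d]-dichotomy = +ᴵ-dichotomy 𝒥ᵃ-isIdeal (⟨⟩-isIdeal ｛ diagonal d ｝)
      (+ᴵ-dichotomy 𝒥-isIdeal (⟨⟩-isIdeal (Above d)) 𝒥-dichotomy (⟨⟩-dichotomy (Above-dichotomy d)))
      (⟨⟩-dichotomy (singleton-dichotomy (diagonal d)))

    𝒥⊆𝒥[d] : ∀ p → p ∈ 𝒥 → p ∈ 𝒥[ d ]
    𝒥⊆𝒥[d] p p∈𝒥 = +ᴵ-inˡ (⟨⟩-isIdeal ｛ diagonal d ｝) p (+ᴵ-inˡ (⟨⟩-isIdeal (Above d)) p p∈𝒥)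

  -- The equations of reducedness, added to any suitable ideal containing J_q

  module Reduced {I : Pred P.Carrier (c ⊔ ℓ)} (isIdeal : IsIdeal I) (dichotomy : Dichotomy I)
                 (𝒥⊆I : ∀ p → p ∈ 𝒥 → p ∈ I) where

    private
      I₀ : Pred P.Carrier _
      I₀ = I +ᴵ ⟨ Initial ⟩

      I₀-isIdeal : IsIdeal I₀
      I₀-isIdeal = +ᴵ-isIdeal isIdeal (⟨⟩-isIdeal Initial)

    reduced-isIdeal : IsIdeal (reduced I)
    reduced-isIdeal = +ᴵ-isIdeal I₀-isIdeal (⟨⟩-isIdeal Border)

    reduced-dichotomy : Dichotomy (reduced I)
    reduced-dichotomy = +ᴵ-dichotomy I₀-isIdeal (⟨⟩-isIdeal Border)
      (+ᴵ-dichotomy isIdeal (⟨⟩-isIdeal Initial) dichotomy (⟨⟩-dichotomy Initial-dichotomy))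
      (⟨⟩-dichotomy Border-dichotomy)

    I⊆reduced : ∀ p → p ∈ I → p ∈ reduced I
    I⊆reduced p p∈I = +ᴵ-inˡ (⟨⟩-isIdeal Border) p (+ᴵ-inˡ (⟨⟩-isIdeal Initial) p p∈I)

    Initial⊆reduced : ∀ p → p ∈ Initial → p ∈ reduced I
    Initial⊆reduced p p∈ = +ᴵ-inˡ (⟨⟩-isIdeal Border) p (+ᴵ-inʳ isIdeal p (∈⟨⟩ p p∈))

    Border⊆reduced : ∀ p → p ∈ Border → p ∈ reduced I
    Border⊆reduced p p∈ = +ᴵ-inʳ I₀-isIdeal p (∈⟨⟩ p p∈)

    fieldEquations∈reduced : ∀ k → var k PS.^ suc n P.+ P.- var k ∈ reduced I
    fieldEquations∈reduced k = I⊆reduced p (𝒥⊆I p (fieldEquations∈𝒥 k))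
      where p = var k PS.^ suc n P.+ P.- var k

    reduced-zeroDimensional : ZeroDimensional (reduced I)
    reduced-zeroDimensional = zeroDimensional reduced-isIdeal fieldEquations∈reduced reduced-dichotomy

    reduced-radical : Radical (reduced I)
    reduced-radical = radical reduced-isIdeal fieldEquations∈reduced reduced-dichotomy

    zero⇒reducedLatin : ∀ {s} → s ∈ AlgebraicSet (reduced I) → IsReducedLatin s
    zero⇒reducedLatin {s} zeros = record
      { row = λ {a} {b} e a≉b → Grow-zero⇒ s a b e (zeros (Grow a b e) (latin _ (row e a≉b)))
      ; col = λ {a} {b} e a≉b → Gcol-zero⇒ s a b e (zeros (Gcol a b e) (latin _ (col e a≉b)))
      ; s₀₀ = λ {i} {j} i≡ j≡ → entry i j (Initial⊆reduced _ (x₀₀ i≡ j≡))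
      ; s₁₀ = λ {i} {j} i≡ j≡ → entry-1 i j (Initial⊆reduced _ (x₁₀-1 i≡ j≡))
      ; s₀₁ = λ {i} {j} i≡ j≡ → entry-1 i j (Initial⊆reduced _ (x₀₁-1 i≡ j≡))
      ; s₀ᵢ = λ {z} {i} z≡ 2≤i → entry z i (Border⊆reduced _ (x₀ᵢ z≡ 2≤i))
      ; sᵢ₀ = λ {z} {i} z≡ 2≤i → entry i z (Border⊆reduced _ (xᵢ₀ z≡ 2≤i))
      }
      where
      latin : ∀ p → p ∈ Latin → p ∈ reduced I
      latin p p∈ = I⊆reduced p (𝒥⊆I p (+ᴵ-inˡ (⟨⟩-isIdeal FieldEquation) p (∈⟨⟩ p p∈)))

      entry : ∀ i j → x i j ∈ reduced I → entries s i j ≈ 0#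
      entry i j x∈ = trans (sym (eval-x s i j)) (zeros (x i j) x∈)

      entry-1 : ∀ i j → x i j P.+ P.- P.1# ∈ reduced I → entries s i j ≈ 1#
      entry-1 i j x∈ = trans (sym (eval-x s i j)) (x∙y⁻¹≈ε⇒x≈y _ _
        (trans (sym (trans (eval-+ s (x i j) (P.- P.1#))
                      (+-congˡ (trans (eval-- s P.1#) (-‿cong (eval-C s 1#))))))
               (zeros (x i j P.+ P.- P.1#) x∈)))

    reducedLatin⇒zero : ∀ {s} → IsReducedLatin s → s ∈ AlgebraicSet I → s ∈ AlgebraicSet (reduced I)
    reducedLatin⇒zero {s} L I≈0 = vanishes-+ᴵ {I = I₀} {⟨ Border ⟩} {s}
      (vanishes-+ᴵ {I = I} {⟨ Initial ⟩} {s} I≈0 (vanishes-⟨⟩ {S = Initial} {s} initial))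
      (vanishes-⟨⟩ {S = Border} {s} border)
      where
      open IsReducedLatin L

      unit : ∀ i j → entries s i j ≈ 1# → eval s (x i j P.+ P.- P.1#) ≈ 0#
      unit i j eq = trans (eval-+ s (x i j) (P.- P.1#))
        (trans (+-cong (trans (eval-x s i j) eq) (trans (eval-- s P.1#) (-‿cong (eval-C s 1#))))
               (-‿inverseʳ 1#))

      initial : s ∈ AlgebraicSet Initial
      initial _ (x₀₀   {i} {j} i≡ j≡) = trans (eval-x s i j) (s₀₀ i≡ j≡)
      initial _ (x₁₀-1 {i} {j} i≡ j≡) = unit i j (s₁₀ i≡ j≡)
      initial _ (x₀₁-1 {i} {j} i≡ j≡) = unit i j (s₀₁ i≡ j≡)

      border : s ∈ AlgebraicSet Border
      border _ (x₀ᵢ {z} {i} z≡ 2≤i) = trans (eval-x s z i) (s₀ᵢ z≡ 2≤i)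
      border _ (xᵢ₀ {z} {i} z≡ 2≤i) = trans (eval-x s i z) (sᵢ₀ z≡ 2≤i)

  reducedLatin⇒𝒥-vanishes : ∀ {s} → IsReducedLatin s → s ∈ AlgebraicSet 𝒥
  reducedLatin⇒𝒥-vanishes {s} L = vanishes-+ᴵ {I = ⟨ Latin ⟩} {⟨ FieldEquation ⟩} {s}
    (vanishes-⟨⟩ {S = Latin} {s} latin)
    (vanishes-⟨⟩ {S = FieldEquation} {s} (fieldEquation-vanishes s))
    where
    latin : s ∈ AlgebraicSet Latin
    latin _ (row {a} {b} e a≉b) = ⇒Grow-zero s a b e (IsReducedLatin.row L e a≉b)
    latin _ (col {a} {b} e a≉b) = ⇒Gcol-zero s a b e (IsReducedLatin.col L e a≉b)

  -- The diagonal product and coefficients of degree d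

  module _ (d : ℕ) (s : Point) where

    private
      factor : Fin n → Fin n → P.Carrier
      factor i j = if does (toℕ i ℕ.+ toℕ j ℕ.≟ d) then x i j PS.^ n P.+ P.- P.1# else P.1#

      eval-diagonal : eval s (diagonal d) ≈ product λ i → product λ j → eval s (factor i j)
      eval-diagonal = trans (eval-product s (λ i → PS.product (factor i)))
        (MonoidSums.sum-cong *-commutativeMonoid
          (λ i → eval s (PS.product (factor i))) (λ i → product λ j → eval s (factor i j))
          (λ i → eval-product s (factor i)))

      eval-factor : ∀ i j → eval s (x i j PS.^ n P.+ P.- P.1#) ≈ entries s i j ^ n - 1#
      eval-factor i j = trans (eval-F s (x i j)) (+-congʳ (^-congˡ n (eval-x s i j)))

      eval-factor-≡ : ∀ i j → toℕ i ℕ.+ toℕ j ≡ d → eval s (factor i j) ≈ entries s i j ^ n - 1#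
      eval-factor-≡ i j i+j≡d = trans
        (reflexive (≡.cong (λ b → eval s (if b then x i j PS.^ n P.+ P.- P.1# else P.1#))
          (dec-true (toℕ i ℕ.+ toℕ j ℕ.≟ d) i+j≡d)))
        (eval-factor i j)

      eval-factor-≢ : ∀ i j → toℕ i ℕ.+ toℕ j ≢ d → eval s (factor i j) ≈ 1#
      eval-factor-≢ i j i+j≢d = trans
        (reflexive (≡.cong (λ b → eval s (if b then x i j PS.^ n P.+ P.- P.1# else P.1#))
          (dec-false (toℕ i ℕ.+ toℕ j ℕ.≟ d) i+j≢d)))
        (eval-C s 1#)

    -- A product in a field vanishes only through one of its factors, and a factor 1 cannot vanish,
    -- so the factor found has i + j = d. For d > 2q - 4 all factors are 1 and no point satisfies
    -- the hypothesis.
    diagonal-zero⇒ : eval s (diagonal d) ≈ 0# → ∃₂ λ i j → toℕ i ℕ.+ toℕ j ≡ d × entries s i j ≉ 0#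
    diagonal-zero⇒ eq with i , row≈0 ← product≈0⇒ _ (trans (sym eval-diagonal) eq)
                      with j , factor≈0 ← product≈0⇒ _ row≈0
                      with toℕ i ℕ.+ toℕ j ℕ.≟ d
    ... | yes i+j≡d = i , j , i+j≡d , z^[q-1]-1≈0⇒z≉0 (trans (sym (eval-factor-≡ i j i+j≡d)) factor≈0)
    ... | no  i+j≢d = contradiction (trans (sym factor≈0) (eval-factor-≢ i j i+j≢d)) 0≉1

    ⇒diagonal-zero : ∀ i j → toℕ i ℕ.+ toℕ j ≡ d → entries s i j ≉ 0# → eval s (diagonal d) ≈ 0#
    ⇒diagonal-zero i j i+j≡d sᵢⱼ≉0 = trans eval-diagonal
      (product-zero (λ i → product λ j → eval s (factor i j)) i
        (product-zero (λ j → eval s (factor i j)) j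
          (trans (eval-factor-≡ i j i+j≡d) (z≉0⇒z^[q-1]-1≈0 sᵢⱼ≉0))))

  -- Identification of the algebraic sets

  module R = Reduced 𝒥-isIdeal 𝒥-dichotomy (λ _ → id)
  module Rᵈ (d : ℕ) = Reduced (𝒥[d]-isIdeal d) (𝒥[d]-dichotomy d) (𝒥⊆𝒥[d] d)

  RLP-identified : IdentifiedBytoPoly (AlgebraicSet (reduced 𝒥)) RLP
  RLP-identified = identified (λ {s} s∈V → reducedLatin⇒RLP (R.zero⇒reducedLatin {s} s∈V)) λ {f} f∈RLP →
    toPoly-fromPoly {f} (proj₁ f∈RLP) ,
    R.reducedLatin⇒zero (RLP⇒reducedLatin {f} f∈RLP) (reducedLatin⇒𝒥-vanishes (RLP⇒reducedLatin {f} f∈RLP))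

  RLP[]-identified : ∀ d → IdentifiedBytoPoly (AlgebraicSet (reduced 𝒥[ d ])) RLP[ d ]
  RLP[]-identified d = identified
    (λ {s} s∈V → reducedLatin⇒RLP (Rᵈ.zero⇒reducedLatin d {s} s∈V) ,
       hasDegree⇒TotalDegree {d} {s} (hasDegree s s∈V))
    λ {f} (f∈RLP , degree) →
      toPoly-fromPoly {f} (proj₁ f∈RLP) ,
      Rᵈ.reducedLatin⇒zero d (RLP⇒reducedLatin {f} f∈RLP)
        (vanishes (fromPoly f) (RLP⇒reducedLatin {f} f∈RLP) (TotalDegree⇒hasDegree {d} {f} (proj₁ f∈RLP) degree))
    where
    hasDegree : ∀ s → s ∈ AlgebraicSet (reduced 𝒥[ d ]) → HasDegree d s
    hasDegree s s∈V =
      (λ i j d< → trans (sym (eval-x s i j)) (s∈V (x i j) (Rᵈ.I⊆reduced d (x i j)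
        (+ᴵ-inˡ (⟨⟩-isIdeal ｛ diagonal d ｝) (x i j)
          (+ᴵ-inʳ 𝒥-isIdeal (x i j) (∈⟨⟩ {S = Above d} (x i j) (above i j d<))))))) ,
      diagonal-zero⇒ d s (s∈V (diagonal d) (Rᵈ.I⊆reduced d (diagonal d)
        (+ᴵ-inʳ (𝒥ᵃ-isIdeal d) (diagonal d) (∈⟨⟩ {S = ｛ diagonal d ｝} (diagonal d) ≡.refl))))

    vanishes : ∀ s → IsReducedLatin s → HasDegree d s → s ∈ AlgebraicSet 𝒥[ d ]
    vanishes s L (high , i , j , i+j≡d , ≉0) = vanishes-+ᴵ {I = 𝒥ᵃ d} {⟨ ｛ diagonal d ｝ ⟩} {s}
      (vanishes-+ᴵ {I = 𝒥} {⟨ Above d ⟩} {s} (reducedLatin⇒𝒥-vanishes L)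
        (vanishes-⟨⟩ {S = Above d} {s} λ { _ (above i j d<) → trans (eval-x s i j) (high i j d<) }))
      (vanishes-⟨⟩ {S = ｛ diagonal d ｝} {s} λ { _ ≡.refl → ⇒diagonal-zero d s i j i+j≡d ≉0 })

proposition3p4 :
    ∀ {c ℓ : Level} (q : ℕ) → IsPrimePower q → 3 < q → (𝔽 : FiniteField q c ℓ) →
    let open FiniteField 𝔽 using (commutativeRing)
        open Polynomials commutativeRing
        open LocalPermutation 𝔽
        open LPIdeals 𝔽
        open Ideals (polyRing N) using (Radical)
    in
      ( ZeroDimensional (reduced 𝒥)
      × Radical (reduced 𝒥)
      × IdentifiedBytoPoly (AlgebraicSet (reduced 𝒥)) RLP )
    × ( ∀ (d : ℕ) →
        ZeroDimensional (reduced 𝒥[ d ])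
      × Radical (reduced 𝒥[ d ])
      × IdentifiedBytoPoly (AlgebraicSet (reduced 𝒥[ d ])) RLP[ d ] )
proposition3p4 (suc n) _ (s≤s 3≤n) 𝔽 =
  (M.R.reduced-zeroDimensional , M.R.reduced-radical , M.RLP-identified) ,
  λ d → M.Rᵈ.reduced-zeroDimensional d , M.Rᵈ.reduced-radical d , M.RLP[]-identified d
  where module M = LatinIdeals (ℕ.<⇒≤ 3≤n) 𝔽
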